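{- Let $k,t$ be integers with $1\le t\le k$, let $s_1,\dots,s_k$ and $r_1,\dots,r_k$ be positive integers with $r_i\le s_i$ for all $i$, and put $G=\mathbb{Z}_{s_1}\times\cdots\times\mathbb{Z}_{s_k}$, $H=\mathbb{Z}_{r_1}\times\cdots\times\mathbb{Z}_{r_k}$. Let $A$ be an $\mathrm{OA}(|A|,s_1s_2\cdots s_k,t)$ over $G$ and $B$ an $\mathrm{OA}(|B|,r_1r_2\cdots r_k,t)$ over $H$ such that $A$ contains $B$ as a subarray. Let $\Psi_A=\bigl(\chi_{\mathbf a}(\mathbf x)\bigr)_{\mathbf x\in A,\ \chi_{\mathbf a}\in\mathcal F}$ be the $|A|\times|\mathcal F|$ complex matrix defined in the context, and let $\Psi_A\Psi_A^{H}$ be its Gram matrix, where $\Psi_A^{H}$ is the conjugate transpose of $\Psi_A$. Then: (1) All nonzero eigenvalues of $\Psi_A\Psi_A^{H}$ are equal to $|A|$. (2) Suppose $\frac{s_1}{r_1}=\max\{\frac{s_i}{r_i}:1\le i\le k\}$. If $t$ is even, then $$|A|\ \ge\ |B|\sum_{i=0}^{t/2}\ \sum_{\substack{I\subseteq\{1,\dots,k\}\\ |I|=i}}\ \prod_{j\in I}\Bigl(\frac{s_j}{r_j}-1\Bigr),$$ and if $t$ is odd, then $$|A|\ \ge\ |B|\left[\sum_{i=0}^{\lfloor t/2\rfloor}\ \sum_{\substack{I\subseteq\{1,\dots,k\}\\ |I|=i}}\ \prod_{j\in I}\Bigl(\frac{s_j}{r_j}-1\Bigr)+\Bigl(\frac{s_1}{r_1}-1\Bigr)\sum_{\substack{I\subseteq\{2,\dots,k\}\\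 |I|=\lfloor t/2\rfloor}}\ \prod_{j\in I}\Bigl(\frac{s_j}{r_j}-1\Bigr)\right].$$
   Context: For a positive integer $s$, $\mathbb{Z}_s=\{0,1,\dots,s-1\}$ is the additive group modulo $s$. Since $r_i\le s_i$, the set $H=\prod_i\{0,\dots,r_i-1\}$ is regarded as a subset (not a subgroup) of $G=\prod_i\{0,\dots,s_i-1\}$. Arrays are nonempty finite multisets of rows; $|A|$ is the number of rows counted with multiplicity, and sums or index sets "$\mathbf x\in A$" run over rows with multiplicity. For $I=\{i_1,\dots,i_t\}\subseteq\{1,\dots,k\}$ let $G_I=\mathbb{Z}_{s_{i_1}}\times\cdots\times\mathbb{Z}_{s_{i_t}}$ and let $\pi_I:G\to G_I$ be the coordinate projection. For $1\le t\le k$, a finite multiset $A$ of elements of $G$ is an orthogonal array of strength $t$ over $G$, denoted $\mathrm{OA}(|A|,s_1s_2\cdots s_k,t)$, if for every $I\subseteq\{1,\dots,k\}$ with $|I|=t$ there is a positive integer $\lambda_I$ such that $|\{\alpha\in A:\pi_I(\alpha)=\beta\}|=\lambda_I$ for all $\beta\in G_I$ (counted with multiplicity). Here $s_1s_2\cdots s_k$ is the list of numbers of levels, not a product. "$A$ contains $B$ as a subarray" means that the rows of $B$ form a sub-multiset of the rows of $A$. For $\mathbf a=(a_1,\dots,a_k)\in G$, $\chi_{\mathbf a}:G\to\mathbb{C}^*$ is the character $\chi_{\mathbf a}(\mathbf x)=\prod_{j=1}^k e^{2\pi i a_jx_j/s_j}$, and $\operatorname{supp}(\mathbf a)=\{j: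 a_j\ne0\}$. The set of characters $\mathcal F$ is $$\mathcal F=\{\chi_{\mathbf a}:\mathbf a\in G,\ |\operatorname{supp}(\mathbf a)|\le t/2\}\quad\text{if } t\text{ is even},$$ $$\mathcal F=\{\chi_{\mathbf a}:|\operatorname{supp}(\mathbf a)|\le\lfloor t/2\rfloor\}\cup\{\chi_{\mathbf a}:|\operatorname{supp}(\mathbf a)|=\lceil t/2\rceil,\ 1\in\operatorname{supp}(\mathbf a)\}\quad\text{if } t\text{ is odd}.$$ The matrix $\Psi_A$ has rows indexed by the rows of $A$ (with multiplicity), columns indexed by $\mathcal F$, and $(\mathbf x,\chi_{\mathbf a})$ entry $\chi_{\mathbf a}(\mathbf x)$. Empty products equal $1$. -}

module Defs where

open import Level using (Level; _⊔_) renaming (suc to lsuc)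
open import Data.Empty using (⊥-elim)
open import Data.Fin.Base using (Fin; zero; suc; toℕ; inject≤)
import Data.Fin.Properties as Fin
open import Data.Fin.Subset using (Subset; inside; outside; ∣_∣; _∈_)
open import Data.Fin.Subset.Properties using (_∈?_)
open import Data.Integer.Base using (+_)
open import Data.List.Base
  using (List; []; _∷_; _++_; map; foldr; filter; length; lookup; allFin;
         cartesianProductWith)
open import Data.Nat.Base as ℕ using (ℕ; NonZero; ⌊_/2⌋; ⌈_/2⌉; _!)
open import Data.Nat.Divisibility using (_∤_; _∣?_)
import Data.Nat.Properties as ℕ
open import Data.Product.Base using (Σ; ∃; _×_; _,_; proj₁)
open import Data.Rational.Base as ℚ using (ℚ; 0ℚ; 1ℚ)
open import Data.Sum.Base using (_⊎_; inj₂)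
import Data.Vec.Base as Vec
open import Function.Base using (_∘_)
open import Function.Bundles using (_⇔_; _↣_; module Equivalence; module Injection)
open import Relation.Binary.Core using (Rel)
open import Relation.Binary.PropositionalEquality using (_≡_)
open import Relation.Binary.Structures using (IsStrictPartialOrder)
open import Relation.Nullary using (¬_; Dec; yes; no; does; ¬?; _⊎-dec_; _×-dec_)
open import Relation.Nullary.Decidable using (map′)
open import Relation.Unary using (Decidable)
open import Algebra.Apartness.Bundles using (HeytingField; HeytingCommutativeRing)
open import Algebra.Bundles using (CommutativeRing)
open import Algebra.Bundles.Raw using (RawRing)
import Algebra.Definitions.RawMonoid as RawMonoidDefs
import Algebra.Definitions.RawSemiring as RawSemiringDefs

private
  variable
    k m n N M : ℕ
    s r : Fin k → ℕ

-- ℤ_{s₁} × ⋯ × ℤ_{sₖ}, as a set of residue representatives; rows are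
-- compared coordinatewise.
Row : (Fin k → ℕ) → Set
Row s = ∀ i → Fin (s i)

-- A multiset of N rows, presented as a family indexed by Fin N.  Nothing
-- below depends on the order of the family.
Array : ℕ → (Fin k → ℕ) → Set
Array N s = Fin N → Row s

-- G_I, the product of the factors with index in I; an entry must not depend on
-- the proof of membership.
Row∣ : (Fin k → ℕ) → Subset k → Set
Row∣ s I = ∀ i → .(i ∈ I) → Fin (s i)

π : (I : Subset k) → Row s → Row∣ s I
π I x i _ = x i

infix 4 _≐_ _≐?_

_≐_ : {I : Subset k} → Row∣ s I → Row∣ s I → Set
_≐_ {I = I} β γ = ∀ i (i∈I : i ∈ I) → β i i∈I ≡ γ i i∈I

_≐?_ : {I : Subset k} (β γ : Row∣ s I) → Dec (β ≐ γ)
_≐?_ {s = s} {I = I} β γ = Fin.all? at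
  where
  at : ∀ i → Dec (∀ (i∈I : i ∈ I) → β i i∈I ≡ γ i i∈I)
  at i with i ∈? I
  ... | no  i∉I = yes λ i∈I → ⊥-elim (i∉I i∈I)
  ... | yes p   = map′ (λ eq _ → eq) (λ eq → eq p) (β i p Fin.≟ γ i p)

occurrences : (I : Subset k) → Array N s → Row∣ s I → ℕ
occurrences {N = N} I A β = length (filter (λ x → π I (A x) ≐? β) (allFin N))

IsOA : ℕ → Array {k} N s → Set
IsOA {k = k} {s = s} t A =
  ∀ (I : Subset k) → ∣ I ∣ ≡ t →
  ∃ λ index → 0 ℕ.< index × (∀ (β : Row∣ s I) → occurrences I A β ≡ index)

-- The residue representatives below rᵢ are among those below sᵢ.
embed : (∀ i → r i ℕ.≤ s i) → Row r → Row s
embed r≤s x i = inject≤ (x i) (r≤s i)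

-- A sub-multiset: distinct rows of B (counted with multiplicity) are matched
-- with distinct equal rows of A.
Subarray : (∀ i → r i ℕ.≤ s i) → Array M r → Array N s → Set
Subarray {M = M} {N = N} r≤s B A =
  Σ (Fin M ↣ Fin N) λ f →
    ∀ y i → A (Injection.to f y) i ≡ embed r≤s (B y) i

supp : Row {k} s → Subset k
supp a = Vec.tabulate λ j → does (¬? (toℕ (a j) ℕ.≟ 0))

-- The coordinate written 1 in the usual numbering 1, …, k is zero here.
InF : ℕ → {s : Fin (ℕ.suc n) → ℕ} → Row s → Set
InF t a = ∣ supp a ∣ ℕ.≤ ⌊ t /2⌋
        ⊎ (2 ∤ t × ∣ supp a ∣ ≡ ⌈ t /2⌉ × zero ∈ supp a)

InF? : ∀ t {s : Fin (ℕ.suc n) → ℕ} → Decidable (InF t {s})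
InF? t a = (∣ supp a ∣ ℕ.≤? ⌊ t /2⌋)
  ⊎-dec (¬? (2 ∣? t) ×-dec ((∣ supp a ∣ ℕ.≟ ⌈ t /2⌉) ×-dec (zero ∈? supp a)))

rows : (s : Fin k → ℕ) → List (Row s)
rows {ℕ.zero}  s = (λ ()) ∷ []
rows {ℕ.suc k} s =
  cartesianProductWith Fin.∀-cons (allFin (s zero)) (rows (s ∘ suc))

-- Over ℂ distinct a give distinct characters χ_a, so ℱ is listed through
-- the indices a, each occurring once.
ℱ : ℕ → (s : Fin (ℕ.suc n) → ℕ) → List (Row s)
ℱ t s = filter (InF? t) (rows s)

-- A Cauchy-complete Archimedean ordered field.  The axioms are those of
-- constructive analysis (apartness and cotransitivity in place of trichotomy);
-- classically they determine ℝ up to isomorphism.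
record RealNumbers (c ℓ₁ ℓ₂ ℓ₃ : Level) : Set (lsuc (c ⊔ ℓ₁ ⊔ ℓ₂ ⊔ ℓ₃)) where
  field
    heytingField : HeytingField c ℓ₁ ℓ₂

  open HeytingField heytingField public
  open CommutativeRing (HeytingCommutativeRing.commutativeRing heytingCommutativeRing)
    using (+-rawMonoid)
  open RawMonoidDefs +-rawMonoid using () renaming (_×_ to _·_)

  fromℕ : ℕ → Carrier
  fromℕ n = n · 1#

  infix 4 _<_
  field
    _<_                  : Rel Carrier ℓ₃
    isStrictPartialOrder : IsStrictPartialOrder _≈_ _<_
    #⇔<⊎>                : ∀ {x y} → x # y ⇔ (x < y ⊎ y < x)
    0<1                  : 0# < 1#
    +-monoˡ-<            : ∀ {x y} z → x < y → x + z < y + z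
    *-positive           : ∀ {x y} → 0# < x → 0# < y → 0# < x * y
    archimedean          : ∀ x → ∃ λ n → x < fromℕ n

  IsCauchy : (ℕ → Carrier) → Set (c ⊔ ℓ₃)
  IsCauchy u = ∀ ε → 0# < ε → ∃ λ K →
    ∀ m n → K ℕ.≤ m → K ℕ.≤ n → u m - u n < ε

  infix 4 _⟶_
  _⟶_ : (ℕ → Carrier) → Carrier → Set (c ⊔ ℓ₃)
  u ⟶ l = ∀ ε → 0# < ε → ∃ λ K →
    ∀ n → K ℕ.≤ n → (u n - l < ε) × (l - u n < ε)

  field
    complete : ∀ u → IsCauchy u → ∃ λ l → u ⟶ l

  private
    module < = IsStrictPartialOrder isStrictPartialOrder

  0<fromℕ : ∀ n .⦃ _ : NonZero n ⦄ → 0# < fromℕ n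
  0<fromℕ 1               = <.<-respʳ-≈ (sym (+-identityʳ 1#)) 0<1
  0<fromℕ (ℕ.suc n@(ℕ.suc _)) =
    <.trans (0<fromℕ n)
            (<.<-respˡ-≈ (+-identityˡ (fromℕ n)) (+-monoˡ-< (fromℕ n) 0<1))

  -- The field axiom inverts differences of apart elements; here n - 0 ≈ n.
  1/_ : ∀ n .⦃ _ : NonZero n ⦄ → Carrier
  1/ n = proj₁ (#⇒invertible (Equivalence.from #⇔<⊎> (inj₂ (0<fromℕ n))))

module Complex {c ℓ₁ ℓ₂ ℓ₃} (ℝ : RealNumbers c ℓ₁ ℓ₂ ℓ₃) where

  private
    module R = RealNumbers ℝ

  infix 5 _+i_
  record ℂ : Set c where
    constructor _+i_
    field
      re im : R.Carrier
  open ℂ public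

  ℂ-rawRing : RawRing c ℓ₁
  ℂ-rawRing = record
    { Carrier = ℂ
    ; _≈_     = λ z w → (re z R.≈ re w) × (im z R.≈ im w)
    ; _+_     = λ z w → (re z R.+ re w) +i (im z R.+ im w)
    ; _*_     = λ z w → (re z R.* re w R.- im z R.* im w)
                     +i (re z R.* im w R.+ im z R.* re w)
    ; -_      = λ z → (R.- re z) +i (R.- im z)
    ; 0#      = R.0# +i R.0#
    ; 1#      = R.1# +i R.0#
    }

  open RawRing ℂ-rawRing public
    using (_≈_; _≉_; _+_; _*_; -_; 0#; 1#)
  open RawSemiringDefs (RawRing.rawSemiring ℂ-rawRing) public
    using (sum; product; _^_)

  ofReal : R.Carrier → ℂ
  ofReal x = x +i R.0#

  ofℕ : ℕ → ℂ
  ofℕ n = ofReal (R.fromℕ n)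

  conj : ℂ → ℂ
  conj z = re z +i (R.- im z)

  Vector : ℕ → Set c
  Vector n = Fin n → ℂ

  Matrix : ℕ → ℕ → Set c
  Matrix m n = Fin m → Fin n → ℂ

  infix  9 _ᴴ
  infixl 7 _⊗_

  _ᴴ : Matrix m n → Matrix n m
  (P ᴴ) i j = conj (P j i)

  _⊗_ : Matrix k m → Matrix m n → Matrix k n
  (P ⊗ Q) i j = sum λ l → P i l * Q l j

  IsEigenvalue : Matrix n n → ℂ → Set (c ⊔ ℓ₁)
  IsEigenvalue {n} P μ = Σ (Vector n) λ v →
    ¬ (∀ i → v i ≈ 0#) × (∀ i → sum (λ j → P i j * v j) ≈ μ * v i)

-- exp and π, pinned down by their definitions: exp z is the sum of the series
-- Σ zⁿ / n!, and π is the least positive zero of sin x = Im (exp (i x)).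
record Exponential {c ℓ₁ ℓ₂ ℓ₃} (ℝ : RealNumbers c ℓ₁ ℓ₂ ℓ₃)
                   : Set (c ⊔ ℓ₁ ⊔ ℓ₂ ⊔ ℓ₃) where
  private
    module R = RealNumbers ℝ
  open Complex ℝ

  expPartialSum : ℂ → ℕ → ℂ
  expPartialSum z n =
    sum {n} λ i → let j = toℕ i in ofReal ((R.1/ (j !)) ⦃ j ℕ.!≢0 ⦄) * z ^ j

  field
    exp        : ℂ → ℂ
    exp-series : ∀ z → (re ∘ expPartialSum z) R.⟶ re (exp z)
                     × (im ∘ expPartialSum z) R.⟶ im (exp z)

  sin : R.Carrier → R.Carrier
  sin x = im (exp (R.0# +i x))

  field
    pi        : R.Carrier
    0<pi      : R.0# R.< pi
    sin-pi    : sin pi R.≈ R.0#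
    pi-least  : ∀ x → R.0# R.< x → x R.< pi → ¬ (sin x R.≈ R.0#)

module Characters {c ℓ₁ ℓ₂ ℓ₃} {ℝ : RealNumbers c ℓ₁ ℓ₂ ℓ₃} (E : Exponential ℝ) where

  private
    module R = RealNumbers ℝ
  open Complex ℝ
  open Exponential E

  χ : {s : Fin k → ℕ} .⦃ _ : ∀ {i} → NonZero (s i) ⦄ → Row s → Row s → ℂ
  χ {s = s} a x = product λ j →
    exp (R.0# +i (R.fromℕ 2 R.* pi R.* R.fromℕ (toℕ (a j) ℕ.* toℕ (x j)) R.* R.1/ s j))

  Ψ : ∀ t {s : Fin (ℕ.suc n) → ℕ} .⦃ _ : ∀ {i} → NonZero (s i) ⦄ →
      Array N s → Matrix N (length (ℱ t s))
  Ψ t {s} A x c = χ (lookup (ℱ t s) c) (A x)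

∑ : {X : Set} → List X → (X → ℚ) → ℚ
∑ xs f = foldr ℚ._+_ 0ℚ (map f xs)

subsets : ∀ k → List (Subset k)
subsets ℕ.zero    = Vec.[] ∷ []
subsets (ℕ.suc k) =
  map (outside Vec.∷_) (subsets k) ++ map (inside Vec.∷_) (subsets k)

∏∈ : Subset k → (Fin k → ℚ) → ℚ
∏∈ {k} I f = foldr ℚ._*_ 1ℚ (map f (filter (_∈? I) (allFin k)))

∑∏ : ℕ → (Fin k → ℚ) → ℚ
∑∏ {k} i f = ∑ (filter (λ I → ∣ I ∣ ℕ.≟ i) (subsets k)) λ I → ∏∈ I f

ratio : (s r : Fin k → ℕ) .⦃ _ : ∀ {i} → NonZero (r i) ⦄ → Fin k → ℚ
ratio s r j = + s j ℚ./ r j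

excess : (s r : Fin k → ℕ) .⦃ _ : ∀ {i} → NonZero (r i) ⦄ → Fin k → ℚ
excess s r j = ratio s r j ℚ.- 1ℚ

fromℕℚ : ℕ → ℚ
fromℕℚ n = + n ℚ./ 1

{-# OPTIONS --safe #-}

-- The characters indexed by ℱ give pairwise orthogonal columns of Ψ_A of squared norm |A|: for a, b with indices in ℱ
-- the supports of a and b together have at most t elements, so strength t turns the sum over the rows of A into |A| times
-- a product of averages over the factors ℤ_{s_j}, and such an average of a nontrivial character is 0.  Hence Ψᴴ Ψ = |A| I,
-- and a nonzero eigenvalue of Ψ Ψᴴ is one of Ψᴴ Ψ.
--
-- For (2), project the indicator of B in A onto the span of those columns.  The projection has a kernel with integer entries,
-- a sum over the admissible supports I of K_I(x, y) = ∏_{j ∈ I} (s_j [x_j = y_j] - 1), so no complex numbers are needed: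
-- Bessel's inequality reads 0 ≤ ∑_{x ∈ A} (|A| 1_B(x) - ∑_I ∑_{y ∈ B} K_I(x, y))², and strength t of B evaluates
-- ∑_{x, y ∈ B} K_I(x, y) as |B|² ∏_{j ∈ I} (s_j / r_j - 1).

module Submission where

open import Defs
open import Algebra.Apartness.Bundles using (HeytingCommutativeRing)
open import Algebra.Bundles using (CommutativeRing; RawRing; Semiring)
import Algebra.Definitions.RawSemiring as RawSemiringDefs
import Algebra.Properties.AbelianGroup as AbelianGroupProperties
import Algebra.Properties.CommutativeMonoid.Sum as MonoidSum
import Algebra.Properties.Ring as RingProperties
import Algebra.Properties.Semiring.Mult as SemiringMult
import Algebra.Properties.Semiring.Sum as SemiringSum
import Algebra.Solver.Ring
open import Algebra.Solver.Ring.AlmostCommutativeRing using (fromCommutativeRing; _-Raw-AlmostCommutative⟶_)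
open import Data.Bool.Base using (if_then_else_; true; false)
import Data.Bool.Properties as Bool
open import Data.Empty using (⊥; ⊥-elim)
open import Data.Fin.Base using (Fin; zero; suc; toℕ; fromℕ<; inject≤)
import Data.Fin.Properties as Fin
open import Data.Fin.Subset using (Subset; inside; outside; ∣_∣; _∈_; _∉_; _⊆_; _∪_)
open import Data.Fin.Subset.Properties
  using (_∈?_; ∣p∣≤n; ∣p∣≤∣p∪q∣; out⊆; s⊆s; ⊆-refl; ⊆-antisym; p⊆p∪q; q⊆p∪q)
open import Data.Integer.Base as ℤ using (ℤ; +_; -[1+_])
import Data.Integer.Properties as ℤ
open import Data.List.Base
  using (List; []; _∷_; _++_; map; foldr; filter; lookup; length; tabulate; upTo; allFin)
import Data.List.Membership.Propositional.Properties as List∈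
import Data.List.Properties as List
open import Data.List.Relation.Unary.All as All using ()
open import Data.List.Relation.Unary.AllPairs using (AllPairs; []; _∷_)
import Data.List.Relation.Unary.Unique.Propositional as Unique
import Data.List.Relation.Unary.Unique.Propositional.Properties as Unique
import Data.List.Relation.Unary.Unique.Setoid as Uniqueₛ
import Data.List.Relation.Unary.Unique.Setoid.Properties as Uniqueₛ
open import Data.Maybe.Base as Maybe using (Maybe)
open import Data.Nat.Base as ℕ using (ℕ; zero; suc; NonZero; ⌊_/2⌋; ⌈_/2⌉; z≤n; s≤s; _∸_; _!)
open import Data.Nat.Divisibility using (_∣_; _∤_; _∣?_; divides)
import Data.Nat.Properties as ℕ
open import Data.Product.Base using (∃; _×_; _,_; proj₁; proj₂)
open import Data.Rational.Base as ℚ using (ℚ; 0ℚ; 1ℚ)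
import Data.Rational.Properties as ℚ
open import Data.Rational.Unnormalised.Base as ℚᵘ using (mkℚᵘ)
import Data.Rational.Unnormalised.Properties as ℚᵘ
open import Data.Sign.Base as Sign using (Sign)
open import Data.Sum.Base using (_⊎_; inj₁; inj₂)
open import Data.Vec.Base as Vec using ([]; _∷_)
import Data.Vec.Properties as Vec
open import Function.Base using (_∘_; id)
open import Function.Bundles using (module Equivalence; module Injection)
open import Level using (Level; 0ℓ; _⊔_)
open import Relation.Binary.Bundles using (Poset; Setoid)
open import Relation.Binary.Core using (Rel)
open import Relation.Binary.Definitions using (Symmetric; tri<; tri≈; tri>)
open import Relation.Binary.PropositionalEquality as ≡ using (_≡_; _≢_)
import Relation.Binary.Reasoning.PartialOrder as PartialOrderReasoning
import Relation.Binary.Reasoning.Setoid as SetoidReasoning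
open import Relation.Binary.Structures using (IsStrictPartialOrder)
open import Relation.Nullary using (¬_; Dec; yes; no; does; ¬?; _→-dec_; _×-dec_; _⊎-dec_)
open import Relation.Nullary.Decidable using (dec⇒maybe)
open import Relation.Unary using (Pred; Decidable)

-- K_I(x, y) is the sum of χ_a(x) times the conjugate of χ_a(y) over all a with support exactly I:
-- in one factor the nontrivial characters add up to s[u = v] - 1. Its averages are polynomial
-- identities in the numbers of levels. With every denominator kept on the other side of its
-- equation they hold over any commutative ring, so averaging a product of one-variable functions
-- over an array is done once and then used over both `ℚ` and `ℂ`.
--
-- The obstacle in (1) is that `exp` is known only as the limit of its series and `pi` only as the
-- least positive zero of the sine. That a root of unity differs from 1 must be derived from this:
-- an addition law on the imaginary axis, obtained from a Cauchy product bounded by a real series,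
-- followed by E(2θ) ≠ 1 for 0 < θ < π. The reals are moreover constructive. Their order cannot be
-- decided, so estimates use the negated order, and the eigenvalue argument by contradiction rests
-- on the stability of equality under double negation.

-- Ring identities with integer coefficients

module IntegerSolver {c ℓ : Level} (R : CommutativeRing c ℓ) where
  open CommutativeRing R
  open RingProperties ring
  open AbelianGroupProperties +-abelianGroup using (⁻¹-∙-comm)
  open SemiringMult semiring using (×-homo-+; ×1-homo-*) renaming (_×_ to _·_)
  open SetoidReasoning setoid

  private
    ⟦_⟧ : ℤ → Carrier
    ⟦ + n ⟧      = n · 1#
    ⟦ -[1+ n ] ⟧ = - (suc n · 1#)

    cancel-head : ∀ x a b → (x + a) - (x + b) ≈ a - b
    cancel-head x a b = begin
      (x + a) + - (x + b)    ≈⟨ +-cong (+-comm x a) (sym (⁻¹-∙-comm x b)) ⟩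
      (a + x) + (- x + - b)  ≈⟨ +-assoc a x _ ⟩
      a + (x + (- x + - b))  ≈⟨ +-congˡ (+-assoc x _ _) ⟨
      a + ((x + - x) + - b)  ≈⟨ +-congˡ (+-congʳ (-‿inverseʳ x)) ⟩
      a + (0# + - b)         ≈⟨ +-congˡ (+-identityˡ _) ⟩
      a - b                  ∎

    ⟦⊖⟧ : ∀ m n → ⟦ m ℤ.⊖ n ⟧ ≈ m · 1# - n · 1#
    ⟦⊖⟧ m zero = begin
      m · 1#         ≈⟨ +-identityʳ _ ⟨
      m · 1# + 0#    ≈⟨ +-congˡ -0#≈0# ⟨
      m · 1# + - 0#  ∎
    ⟦⊖⟧ zero (suc n) = sym (+-identityˡ _)
    ⟦⊖⟧ (suc m) (suc n) = begin
      ⟦ suc m ℤ.⊖ suc n ⟧            ≡⟨ ≡.cong ⟦_⟧ (ℤ.[1+m]⊖[1+n]≡m⊖n m n) ⟩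
      ⟦ m ℤ.⊖ n ⟧                    ≈⟨ ⟦⊖⟧ m n ⟩
      m · 1# - n · 1#              ≈⟨ cancel-head 1# _ _ ⟨
      suc m · 1# - suc n · 1#      ∎

    ⟦+⟧ : ∀ i j → ⟦ i ℤ.+ j ⟧ ≈ ⟦ i ⟧ + ⟦ j ⟧
    ⟦+⟧ (+ m)      (+ n)      = ×-homo-+ 1# m n
    ⟦+⟧ (+ m)      -[1+ n ]   = ⟦⊖⟧ m (suc n)
    ⟦+⟧ -[1+ m ]   (+ n)      = trans (⟦⊖⟧ n (suc m)) (+-comm _ _)
    ⟦+⟧ -[1+ m ]   -[1+ n ]   = begin
      - (suc (suc (m ℕ.+ n)) · 1#)        ≈⟨ -‿cong (+-congˡ (×-homo-+ 1# (suc m) n)) ⟩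
      - (1# + (suc m · 1# + n · 1#))      ≈⟨ -‿cong (+-assoc 1# _ _) ⟨
      - (1# + suc m · 1# + n · 1#)        ≈⟨ -‿cong (+-congʳ (+-comm 1# _)) ⟩
      - (suc m · 1# + 1# + n · 1#)        ≈⟨ -‿cong (+-assoc _ 1# _) ⟩
      - (suc m · 1# + suc n · 1#)         ≈⟨ ⁻¹-∙-comm _ _ ⟨
      - (suc m · 1#) + - (suc n · 1#)     ∎

    ⟦-⟧ : ∀ i → ⟦ ℤ.- i ⟧ ≈ - ⟦ i ⟧
    ⟦-⟧ (+ zero)   = sym -0#≈0#
    ⟦-⟧ (+ suc n)  = refl
    ⟦-⟧ -[1+ n ]   = sym (-‿involutive _)

    -- `ℤ._*_` computes sign and absolute value separately, so the product law is assembled from one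
    -- law for signs and one for natural multiples of 1.
    signed : Sign → Carrier → Carrier
    signed Sign.+ x = x
    signed Sign.- x = - x

    ⟦◃⟧ : ∀ s n → ⟦ s ℤ.◃ n ⟧ ≈ signed s (n · 1#)
    ⟦◃⟧ Sign.+ zero    = refl
    ⟦◃⟧ Sign.- zero    = sym -0#≈0#
    ⟦◃⟧ Sign.+ (suc n) = refl
    ⟦◃⟧ Sign.- (suc n) = refl

    signed-* : ∀ s t x y → signed (s Sign.* t) (x * y) ≈ signed s x * signed t y
    signed-* Sign.+ Sign.+ x y = refl
    signed-* Sign.+ Sign.- x y = -‿distribʳ-* x y
    signed-* Sign.- Sign.+ x y = -‿distribˡ-* x y
    signed-* Sign.- Sign.- x y = begin
      x * y          ≈⟨ -‿involutive _ ⟨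
      - - (x * y)    ≈⟨ -‿cong (-‿distribʳ-* x y) ⟩
      - (x * - y)    ≈⟨ -‿distribˡ-* x (- y) ⟩
      - x * - y      ∎

    signed-cong : ∀ s {x y} → x ≈ y → signed s x ≈ signed s y
    signed-cong Sign.+ x≈y = x≈y
    signed-cong Sign.- x≈y = -‿cong x≈y

    ⟦⟧-signed : ∀ i → signed (ℤ.sign i) (ℤ.∣ i ∣ · 1#) ≈ ⟦ i ⟧
    ⟦⟧-signed (+ n)    = refl
    ⟦⟧-signed -[1+ n ] = refl

    ⟦*⟧ : ∀ i j → ⟦ i ℤ.* j ⟧ ≈ ⟦ i ⟧ * ⟦ j ⟧
    ⟦*⟧ i j = begin
      ⟦ ℤ.sign i Sign.* ℤ.sign j ℤ.◃ ℤ.∣ i ∣ ℕ.* ℤ.∣ j ∣ ⟧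
        ≈⟨ ⟦◃⟧ (ℤ.sign i Sign.* ℤ.sign j) (ℤ.∣ i ∣ ℕ.* ℤ.∣ j ∣) ⟩
      signed (ℤ.sign i Sign.* ℤ.sign j) ((ℤ.∣ i ∣ ℕ.* ℤ.∣ j ∣) · 1#)
        ≈⟨ signed-cong (ℤ.sign i Sign.* ℤ.sign j) (×1-homo-* ℤ.∣ i ∣ ℤ.∣ j ∣) ⟩
      signed (ℤ.sign i Sign.* ℤ.sign j) ((ℤ.∣ i ∣ · 1#) * (ℤ.∣ j ∣ · 1#))
        ≈⟨ signed-* (ℤ.sign i) (ℤ.sign j) _ _ ⟩
      signed (ℤ.sign i) (ℤ.∣ i ∣ · 1#) * signed (ℤ.sign j) (ℤ.∣ j ∣ · 1#)
        ≈⟨ *-cong (⟦⟧-signed i) (⟦⟧-signed j) ⟩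
      ⟦ i ⟧ * ⟦ j ⟧ ∎

    -- Agrees with ⟦_⟧, but sends 1 to 1# on the nose, as the solver's final check by refl needs.
    ⟦_⟧′ : ℤ → Carrier
    ⟦ + 1 ⟧′ = 1#
    ⟦ i ⟧′   = ⟦ i ⟧

    ⟦⟧′≈⟦⟧ : ∀ i → ⟦ i ⟧′ ≈ ⟦ i ⟧
    ⟦⟧′≈⟦⟧ (+ 0)             = refl
    ⟦⟧′≈⟦⟧ (+ 1)             = sym (+-identityʳ 1#)
    ⟦⟧′≈⟦⟧ (+ suc (suc n))   = refl
    ⟦⟧′≈⟦⟧ -[1+ n ]          = refl

    ℤ-rawRing : RawRing _ _
    ℤ-rawRing = record
      { Carrier = ℤ ; _≈_ = _≡_ ; _+_ = ℤ._+_ ; _*_ = ℤ._*_ ; -_ = ℤ.-_ ; 0# = + 0 ; 1# = + 1 }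

    ℤ⟶R : ℤ-rawRing -Raw-AlmostCommutative⟶ fromCommutativeRing R
    ℤ⟶R = record
      { ⟦_⟧ = ⟦_⟧′
      ; +-homo = λ i j → trans (⟦⟧′≈⟦⟧ (i ℤ.+ j)) (trans (⟦+⟧ i j) (sym (+-cong (⟦⟧′≈⟦⟧ i) (⟦⟧′≈⟦⟧ j))))
      ; *-homo = λ i j → trans (⟦⟧′≈⟦⟧ (i ℤ.* j)) (trans (⟦*⟧ i j) (sym (*-cong (⟦⟧′≈⟦⟧ i) (⟦⟧′≈⟦⟧ j))))
      ; -‿homo = λ i → trans (⟦⟧′≈⟦⟧ (ℤ.- i)) (trans (⟦-⟧ i) (sym (-‿cong (⟦⟧′≈⟦⟧ i))))
      ; 0-homo = refl ; 1-homo = refl }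

    -- Equality in an abstract ring is not decidable. Normal forms therefore have integer
    -- coefficients, whose equality is, and this lets terms cancel.
    _≟?_ : ∀ i j → Maybe (⟦ i ⟧′ ≈ ⟦ j ⟧′)
    i ≟? j = Maybe.map (λ i≡j → reflexive (≡.cong ⟦_⟧′ i≡j)) (dec⇒maybe (i ℤ.≟ j))

  open Algebra.Solver.Ring ℤ-rawRing (fromCommutativeRing R) ℤ⟶R _≟?_ public
    using (solve; _:=_; _:+_; _:*_; :-_; _:-_; con)

  𝟙 𝟘 : ℤ
  𝟙 = + 1
  𝟘 = + 0

-- Averages over orthogonal arrays

-- Strength speaks only of index sets of size exactly `t`, whereas the supports met below are often
-- smaller.
extend-to-size : ∀ {k t} (I : Subset k) → ∣ I ∣ ℕ.≤ t → t ℕ.≤ k → ∃ λ J → I ⊆ J × ∣ J ∣ ≡ t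
extend-to-size []            _         z≤n       = [] , ⊆-refl , ≡.refl
extend-to-size (inside ∷ I)  (s≤s I≤t) (s≤s t≤k) =
  let J , I⊆J , J≡t = extend-to-size I I≤t t≤k in inside ∷ J , s⊆s I⊆J , ≡.cong suc J≡t
extend-to-size {suc k} {t} (outside ∷ I) I≤t t≤1+k with t ℕ.≤? k
-- The head coordinate is left out as long as the other `k` coordinates can still supply `t`
-- elements; otherwise all coordinates are needed.
... | yes t≤k =
  let J , I⊆J , J≡t = extend-to-size I I≤t t≤k in outside ∷ J , s⊆s I⊆J , J≡t
extend-to-size {suc k} {zero}  (outside ∷ I) I≤t t≤1+k | no t≰k = ⊥-elim (t≰k z≤n)
extend-to-size {suc k} {suc t} (outside ∷ I) I≤t t≤1+k | no t≰k =
  let I≤t′ = ℕ.≤-trans (∣p∣≤n I) (ℕ.≤-pred (ℕ.≰⇒> t≰k))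
      J , I⊆J , J≡t = extend-to-size I I≤t′ (ℕ.≤-pred t≤1+k)
  in inside ∷ J , out⊆ I⊆J , ≡.cong suc J≡t

module FiniteSums {c ℓ : Level} (R : CommutativeRing c ℓ) where
  open CommutativeRing R hiding (zero)
  open SetoidReasoning setoid
  open MonoidSum +-commutativeMonoid public
    using (sum; sum-cong-≋; ∑-distrib-+; ∑-comm; sum-replicate; sum-replicate-zero)
  open MonoidSum *-commutativeMonoid public using ()
    renaming ( sum to product; sum-cong-≋ to product-cong; ∑-distrib-+ to product-distrib-*
             ; sum-replicate-zero to product-replicate-one)
  open SemiringSum semiring public using (*-distribˡ-sum; *-distribʳ-sum)
  open SemiringMult semiring public using () renaming (_×_ to _·_)

  private variable
    k N M n : ℕ
    p q : Level
    P : Set p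
    Q : Set q
    s : Fin k → ℕ

  -- Iverson bracket. It inspects only `does d`, so it reduces as soon as the boolean does, whatever
  -- the proof.
  ⟪_⟫ : Dec P → Carrier
  ⟪ d ⟫ = if does d then 1# else 0#

  ⟪⟫-yes : (d : Dec P) → P → ⟪ d ⟫ ≈ 1#
  ⟪⟫-yes (yes _) _  = refl
  ⟪⟫-yes (no ¬p) p  = ⊥-elim (¬p p)

  ⟪⟫-no : (d : Dec P) → ¬ P → ⟪ d ⟫ ≈ 0#
  ⟪⟫-no (yes p) ¬p = ⊥-elim (¬p p)
  ⟪⟫-no (no _)  _  = refl

  ⟪⟫-cong : (d : Dec P) (e : Dec Q) → (P → Q) → (Q → P) → ⟪ d ⟫ ≈ ⟪ e ⟫
  ⟪⟫-cong (yes p) e to from = sym (⟪⟫-yes e (to p))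
  ⟪⟫-cong (no ¬p) e to from = sym (⟪⟫-no e (¬p ∘ from))

  sum-zero : {f : Fin n → Carrier} → (∀ i → f i ≈ 0#) → sum f ≈ 0#
  sum-zero {n} f≈0 = trans (sum-cong-≋ f≈0) (sum-replicate-zero n)

  sum-const : ∀ n x → sum {n} (λ _ → x) ≈ n · 1# * x
  sum-const n x = begin
    sum {n} (λ _ → x)        ≈⟨ sum-cong-≋ {n} (λ _ → *-identityˡ x) ⟨
    sum {n} (λ _ → 1# * x)   ≈⟨ *-distribʳ-sum {n} x (λ _ → 1#) ⟨
    sum {n} (λ _ → 1#) * x   ≈⟨ *-congʳ (sum-replicate n) ⟩
    n · 1# * x               ∎

  sum-single : (f : Fin n → Carrier) (i : Fin n) → (∀ j → j ≢ i → f j ≈ 0#) → sum f ≈ f i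
  sum-single f zero    f≈0 = trans (+-congˡ (sum-zero λ j → f≈0 (suc j) λ ())) (+-identityʳ _)
  sum-single f (suc i) f≈0 = begin
    f zero + sum (f ∘ suc)  ≈⟨ +-cong (f≈0 zero λ ()) (sum-single (f ∘ suc) i λ j j≢i → f≈0 (suc j) (j≢i ∘ Fin.suc-injective)) ⟩
    0# + f (suc i)          ≈⟨ +-identityˡ _ ⟩
    f (suc i)               ∎

  product-one : {f : Fin n → Carrier} → (∀ i → f i ≈ 1#) → product f ≈ 1#
  product-one {n} f≈1 = trans (product-cong f≈1) (product-replicate-one n)

  product-zero : (f : Fin n → Carrier) (i : Fin n) → f i ≈ 0# → product f ≈ 0#
  product-zero f zero    fi≈0 = trans (*-congʳ fi≈0) (zeroˡ _)
  product-zero f (suc i) fi≈0 = trans (*-congˡ (product-zero (f ∘ suc) i fi≈0)) (zeroʳ _)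

  product-⟪⟫ : {P : Fin n → Set p} (P? : ∀ i → Dec (P i)) (d : Dec (∀ i → P i)) →
               product (λ i → ⟪ P? i ⟫) ≈ ⟪ d ⟫
  product-⟪⟫ P? (yes ∀P) = product-one λ i → ⟪⟫-yes (P? i) (∀P i)
  product-⟪⟫ {P = P} P? (no ¬∀P) with Fin.¬∀⟶∃¬ _ P P? ¬∀P
  ... | i , ¬Pi = product-zero _ i (⟪⟫-no (P? i) ¬Pi)

  length-filter-tabulate : ∀ {a} {A : Set a} {P : Pred A p} (P? : Decidable P) (f : Fin n → A) →
    length (filter P? (tabulate f)) · 1# ≈ sum λ i → ⟪ P? (f i) ⟫
  length-filter-tabulate {n = zero}  P? f = refl
  length-filter-tabulate {n = suc n} P? f with does (P? (f zero))
  ... | true  = +-congˡ (length-filter-tabulate P? (f ∘ suc))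
  ... | false = trans (length-filter-tabulate P? (f ∘ suc)) (sym (+-identityˡ _))

  -- Recursion over the coordinates makes the distributive law `∑Row-product` a direct induction,
  -- and building rows by `Fin.∀-cons` lets every coordinate reduce.
  ∑Row : (s : Fin k → ℕ) → (Row s → Carrier) → Carrier
  ∑Row {zero}  s f = f λ ()
  ∑Row {suc k} s f = sum λ u → ∑Row (s ∘ suc) λ β → f (Fin.∀-cons u β)

  ∑Row-cong : ∀ {k} {s : Fin k → ℕ} {f g : Row s → Carrier} → (∀ β → f β ≈ g β) → ∑Row s f ≈ ∑Row s g
  ∑Row-cong {zero}  f≈g = f≈g _
  ∑Row-cong {suc k} {s} f≈g = sum-cong-≋ {s zero} λ u → ∑Row-cong λ β → f≈g (Fin.∀-cons u β)

  ∑Row-*ˡ : ∀ {k} {s : Fin k → ℕ} x (f : Row s → Carrier) → ∑Row s (λ β → x * f β) ≈ x * ∑Row s f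
  ∑Row-*ˡ {zero}      x f = refl
  ∑Row-*ˡ {suc k} {s} x f = begin
    (sum λ u → ∑Row (s ∘ suc) λ β → x * f (Fin.∀-cons u β))   ≈⟨ sum-cong-≋ (λ u → ∑Row-*ˡ x (λ β → f (Fin.∀-cons u β))) ⟩
    (sum λ u → x * ∑Row (s ∘ suc) λ β → f (Fin.∀-cons u β))   ≈⟨ *-distribˡ-sum x (λ u → ∑Row (s ∘ suc) λ β → f (Fin.∀-cons u β)) ⟨
    x * ∑Row s f                                              ∎

  sum-∑Row-comm : ∀ {k} {s : Fin k → ℕ} (f : Fin N → Row s → Carrier) →
    (sum λ x → ∑Row s (f x)) ≈ ∑Row s λ β → sum λ x → f x β
  sum-∑Row-comm {k = zero}          f = refl
  sum-∑Row-comm {k = suc k} {s = s} f = trans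
    (∑-comm λ x u → ∑Row (s ∘ suc) λ β → f x (Fin.∀-cons u β))
    (sum-cong-≋ λ u → sum-∑Row-comm λ x β → f x (Fin.∀-cons u β))

  ∑Row-product : ∀ {k} {s : Fin k → ℕ} (h : ∀ j → Fin (s j) → Carrier) →
    ∑Row s (λ β → product λ j → h j (β j)) ≈ product λ j → sum (h j)
  ∑Row-product {zero}      h = refl
  ∑Row-product {suc k} {s} h = begin
    (sum λ u → ∑Row (s ∘ suc) λ β → h zero u * product λ j → h (suc j) (β j))
      ≈⟨ sum-cong-≋ (λ u → trans (∑Row-*ˡ (h zero u) (λ β → product λ j → h (suc j) (β j)))
                                 (*-congˡ (∑Row-product (h ∘ suc)))) ⟩
    (sum λ u → h zero u * product λ j → sum (h (suc j)))
      ≈⟨ *-distribʳ-sum _ (h zero) ⟨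
    sum (h zero) * product (λ j → sum (h (suc j))) ∎

  module _ {t : ℕ} {s : Fin k → ℕ} .⦃ s≢0 : ∀ {i} → NonZero (s i) ⦄
           (A : Array N s) (A-OA : IsOA t A) where

    private
      0ₛ : ∀ j → Fin (s j)
      0ₛ j = fromℕ< (ℕ.>-nonZero⁻¹ (s j))

      module _ (I : Subset k) (∣I∣≡t : ∣ I ∣ ≡ t) where

        index : ℕ
        index = proj₁ (A-OA I ∣I∣≡t)

        agree : ∀ j (u v : Fin (s j)) → Dec (j ∈ I → u ≡ v)
        agree j u v = (j ∈? I) →-dec (u Fin.≟ v)

        -- The rows that equal `0ₛ` outside `I` represent the elements of G_I. A sum over G_I thus
        -- becomes a sum over G with a weight in product form.
        vanish : ∀ j (v : Fin (s j)) → Dec (j ∉ I → v ≡ 0ₛ j)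
        vanish j v = ¬? (j ∈? I) →-dec (v Fin.≟ 0ₛ j)

        -- Strength enters here: the product of brackets is the indicator of agreement on `I`, so
        -- its sum over the array is a count of occurrences.
        sum-agree : ∀ β → (sum λ x → product λ j → ⟪ agree j (A x j) (β j) ⟫) ≈ index · 1#
        sum-agree β = begin
          (sum λ x → product λ j → ⟪ agree j (A x j) (β j) ⟫)
            ≈⟨ sum-cong-≋ (λ x → trans
                 (product-⟪⟫ (λ j → agree j (A x j) (β j)) (Fin.all? λ j → agree j (A x j) (β j)))
                 (⟪⟫-cong (Fin.all? λ j → agree j (A x j) (β j)) (_≐?_ {I = I} (π I (A x)) (π I β)) id id)) ⟩
          (sum λ x → ⟪ _≐?_ {I = I} (π I (A x)) (π I β) ⟫)
            ≈⟨ length-filter-tabulate (λ x → _≐?_ {I = I} (π I (A x)) (π I β)) id ⟨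
          occurrences I A (π I β) · 1#
            ≡⟨ ≡.cong (_· 1#) (proj₂ (proj₂ (A-OA I ∣I∣≡t)) (π I β)) ⟩
          index · 1# ∎

        module _ (h : ∀ j → Fin (s j) → Carrier) (h≈1 : ∀ j → j ∉ I → ∀ u → h j u ≈ 1#) where

          weight : ∀ j → Fin (s j) → Carrier
          weight j v = ⟪ vanish j v ⟫ * h j v

          -- Expansion of `h j` in indicators of levels. On `I` only `v = u` survives; off `I` only
          -- `v = 0ₛ j` does, where `h j` has the value 1 that it also has at `u`.
          sum-weight-agree : ∀ j u → (sum λ v → ⟪ agree j u v ⟫ * weight j v) ≈ h j u
          sum-weight-agree j u with j ∈? I
          ... | yes j∈I = begin
            (sum λ v → ⟪ u Fin.≟ v ⟫ * (1# * h j v))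
              ≈⟨ sum-single _ u (λ v v≢u → trans (*-congʳ (⟪⟫-no (u Fin.≟ v) (v≢u ∘ ≡.sym))) (zeroˡ _)) ⟩
            ⟪ u Fin.≟ u ⟫ * (1# * h j u)
              ≈⟨ *-cong (⟪⟫-yes (u Fin.≟ u) ≡.refl) (*-identityˡ _) ⟩
            1# * h j u
              ≈⟨ *-identityˡ _ ⟩
            h j u ∎
          ... | no j∉I = begin
            (sum λ v → 1# * (⟪ v Fin.≟ 0ₛ j ⟫ * h j v))
              ≈⟨ sum-single _ (0ₛ j) (λ v v≢0 → trans (*-identityˡ _)
                   (trans (*-congʳ (⟪⟫-no (v Fin.≟ 0ₛ j) v≢0)) (zeroˡ _))) ⟩
            1# * (⟪ 0ₛ j Fin.≟ 0ₛ j ⟫ * h j (0ₛ j))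
              ≈⟨ *-identityˡ _ ⟩
            ⟪ 0ₛ j Fin.≟ 0ₛ j ⟫ * h j (0ₛ j)
              ≈⟨ *-cong (⟪⟫-yes (0ₛ j Fin.≟ 0ₛ j) ≡.refl) (h≈1 j j∉I _) ⟩
            1# * 1#
              ≈⟨ *-identityˡ _ ⟩
            1#
              ≈⟨ h≈1 j j∉I u ⟨
            h j u ∎

          -- Every product is expanded over all of G and the sums are exchanged. The inner count is
          -- then `index`, whatever `β` is, so the outer sum factors again.
          sum-product-weight : (sum λ x → product λ j → h j (A x j)) ≈ index · 1# * product λ j → sum (weight j)
          sum-product-weight = begin
            (sum λ x → product λ j → h j (A x j))
              ≈⟨ sum-cong-≋ (λ x → product-cong λ j → sum-weight-agree j (A x j)) ⟨
            (sum λ x → product λ j → sum λ v → ⟪ agree j (A x j) v ⟫ * weight j v)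
              ≈⟨ sum-cong-≋ (λ x → ∑Row-product λ j v → ⟪ agree j (A x j) v ⟫ * weight j v) ⟨
            (sum λ x → ∑Row s λ β → product λ j → ⟪ agree j (A x j) (β j) ⟫ * weight j (β j))
              ≈⟨ sum-∑Row-comm (λ x β → product λ j → ⟪ agree j (A x j) (β j) ⟫ * weight j (β j)) ⟩
            ∑Row s (λ β → sum λ x → product λ j → ⟪ agree j (A x j) (β j) ⟫ * weight j (β j))
              ≈⟨ ∑Row-cong (λ β → begin
                   (sum λ x → product λ j → ⟪ agree j (A x j) (β j) ⟫ * weight j (β j))
                     ≈⟨ sum-cong-≋ (λ x → product-distrib-* (λ j → ⟪ agree j (A x j) (β j) ⟫) (λ j → weight j (β j))) ⟩
                   (sum λ x → product (λ j → ⟪ agree j (A x j) (β j) ⟫) * product (λ j → weight j (β j)))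
                     ≈⟨ *-distribʳ-sum (product λ j → weight j (β j)) (λ x → product λ j → ⟪ agree j (A x j) (β j) ⟫) ⟨
                   (sum λ x → product λ j → ⟪ agree j (A x j) (β j) ⟫) * product (λ j → weight j (β j))
                     ≈⟨ *-congʳ (sum-agree β) ⟩
                   index · 1# * product (λ j → weight j (β j)) ∎) ⟩
            ∑Row s (λ β → index · 1# * product λ j → weight j (β j))
              ≈⟨ ∑Row-*ˡ (index · 1#) (λ β → product λ j → weight j (β j)) ⟩
            index · 1# * ∑Row s (λ β → product λ j → weight j (β j))
              ≈⟨ *-congˡ (∑Row-product weight) ⟩
            index · 1# * product (λ j → sum (weight j)) ∎

        levels : Fin k → Carrier
        levels j = if does (j ∈? I) then s j · 1# else 1#

        -- `q j` is the mean of `h j` over its factor, described by a product because a general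
        -- commutative ring has no division.
        average-exact : (h : ∀ j → Fin (s j) → Carrier) (q : Fin k → Carrier) →
          (∀ j → j ∉ I → ∀ u → h j u ≈ 1#) → (∀ j → j ∉ I → q j ≈ 1#) →
          (∀ j → sum (h j) ≈ s j · 1# * q j) →
          (sum λ x → product λ j → h j (A x j)) ≈ index · 1# * product levels * product q
        average-exact h q h≈1 q≈1 sum-h = begin
          (sum λ x → product λ j → h j (A x j))               ≈⟨ sum-product-weight h h≈1 ⟩
          index · 1# * product (λ j → sum (weight h h≈1 j))   ≈⟨ *-congˡ (product-cong sum-weight) ⟩
          index · 1# * product (λ j → levels j * q j)         ≈⟨ *-congˡ (product-distrib-* levels q) ⟩
          index · 1# * (product levels * product q)           ≈⟨ *-assoc _ _ _ ⟨
          index · 1# * product levels * product q             ∎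
          where
          sum-weight : ∀ j → sum (weight h h≈1 j) ≈ levels j * q j
          sum-weight j with j ∈? I
          ... | yes j∈I = trans (sum-cong-≋ λ v → *-identityˡ (h j v)) (sum-h j)
          ... | no j∉I = begin
            (sum λ v → ⟪ v Fin.≟ 0ₛ j ⟫ * h j v)
              ≈⟨ sum-single _ (0ₛ j) (λ v v≢0 → trans (*-congʳ (⟪⟫-no (v Fin.≟ 0ₛ j) v≢0)) (zeroˡ _)) ⟩
            ⟪ 0ₛ j Fin.≟ 0ₛ j ⟫ * h j (0ₛ j)
              ≈⟨ *-cong (⟪⟫-yes (0ₛ j Fin.≟ 0ₛ j) ≡.refl) (trans (h≈1 j j∉I _) (sym (q≈1 j j∉I))) ⟩
            1# * q j ∎

    -- Orthogonality of the characters, orthogonality of the kernels and the evaluation of the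
    -- kernels over `B` are all instances, with different `h` and `q`.
    average : t ℕ.≤ k → (I : Subset k) → ∣ I ∣ ℕ.≤ t → (h : ∀ j → Fin (s j) → Carrier) (q : Fin k → Carrier) →
      (∀ j → j ∉ I → ∀ u → h j u ≈ 1#) → (∀ j → j ∉ I → q j ≈ 1#) →
      (∀ j → sum (h j) ≈ s j · 1# * q j) →
      (sum λ x → product λ j → h j (A x j)) ≈ N · 1# * product q
    average t≤k I I≤t h q h≈1 q≈1 sum-h with extend-to-size I I≤t t≤k
    ... | J , I⊆J , ∣J∣≡t = trans
      (average-exact J ∣J∣≡t h q (λ j j∉J → h≈1 j (j∉J ∘ I⊆J)) (λ j j∉J → q≈1 j (j∉J ∘ I⊆J)) sum-h)
      (*-congʳ index*levels)
      where
      -- The same identity for the constant function 1 counts the rows, which evaluates the unknown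
      -- `index` times the number of patterns.
      index*levels : index J ∣J∣≡t · 1# * product (levels J ∣J∣≡t) ≈ N · 1#
      index*levels = begin
        index J ∣J∣≡t · 1# * product (levels J ∣J∣≡t)
          ≈⟨ *-identityʳ _ ⟨
        index J ∣J∣≡t · 1# * product (levels J ∣J∣≡t) * 1#
          ≈⟨ *-congˡ (product-replicate-one k) ⟨
        index J ∣J∣≡t · 1# * product (levels J ∣J∣≡t) * product {k} (λ _ → 1#)
          ≈⟨ average-exact J ∣J∣≡t (λ _ _ → 1#) (λ _ → 1#) (λ _ _ _ → refl) (λ _ _ → refl)
               (λ j → sum-const (s j) 1#) ⟨
        sum {N} (λ _ → product {k} λ _ → 1#)
          ≈⟨ sum-cong-≋ {N} (λ _ → product-replicate-one k) ⟩
        sum {N} (λ _ → 1#)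
          ≈⟨ sum-replicate N ⟩
        N · 1# ∎

-- Admissible supports, their unions, and lists without repetition

∣p∪q∣≤∣p∣+∣q∣ : ∀ {k} (p q : Subset k) → ∣ p ∪ q ∣ ℕ.≤ ∣ p ∣ ℕ.+ ∣ q ∣
∣p∪q∣≤∣p∣+∣q∣ []            []            = z≤n
∣p∪q∣≤∣p∣+∣q∣ (outside ∷ p) (outside ∷ q) = ∣p∪q∣≤∣p∣+∣q∣ p q
∣p∪q∣≤∣p∣+∣q∣ (outside ∷ p) (inside ∷ q)  =
  ℕ.≤-trans (s≤s (∣p∪q∣≤∣p∣+∣q∣ p q)) (ℕ.≤-reflexive (≡.sym (ℕ.+-suc ∣ p ∣ ∣ q ∣)))
∣p∪q∣≤∣p∣+∣q∣ (inside ∷ p)  (outside ∷ q) = s≤s (∣p∪q∣≤∣p∣+∣q∣ p q)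
∣p∪q∣≤∣p∣+∣q∣ (inside ∷ p)  (inside ∷ q)  =
  s≤s (ℕ.≤-trans (∣p∪q∣≤∣p∣+∣q∣ p q) (ℕ.+-monoʳ-≤ ∣ p ∣ (ℕ.n≤1+n ∣ q ∣)))

-- The shared element is counted twice on the right. The unit gained pays for rounding t/2 up when
-- `t` is odd.
∣p∪q∣<∣p∣+∣q∣ : ∀ {k} (p q : Subset (suc k)) → zero ∈ p → zero ∈ q → ∣ p ∪ q ∣ ℕ.< ∣ p ∣ ℕ.+ ∣ q ∣
∣p∪q∣<∣p∣+∣q∣ (_ ∷ p) (_ ∷ q) Vec.here Vec.here =
  s≤s (ℕ.≤-trans (s≤s (∣p∪q∣≤∣p∣+∣q∣ p q)) (ℕ.≤-reflexive (≡.sym (ℕ.+-suc ∣ p ∣ ∣ q ∣))))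

-- χ_a ∈ ℱ depends on supp a only: InF t a is Small t (supp a).
Small : ∀ {n} → ℕ → Subset (suc n) → Set
Small t I = ∣ I ∣ ℕ.≤ ⌊ t /2⌋ ⊎ (2 ∤ t × ∣ I ∣ ≡ ⌈ t /2⌉ × zero ∈ I)

Small? : ∀ {n} t → Decidable (Small {n} t)
Small? t I = (∣ I ∣ ℕ.≤? ⌊ t /2⌋)
  ⊎-dec (¬? (2 ∣? t) ×-dec ((∣ I ∣ ℕ.≟ ⌈ t /2⌉) ×-dec (zero ∈? I)))

⌈n/2⌉≤1+⌊n/2⌋ : ∀ n → ⌈ n /2⌉ ℕ.≤ suc ⌊ n /2⌋
⌈n/2⌉≤1+⌊n/2⌋ zero          = z≤n
⌈n/2⌉≤1+⌊n/2⌋ (suc zero)    = s≤s z≤n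
⌈n/2⌉≤1+⌊n/2⌋ (suc (suc n)) = s≤s (⌈n/2⌉≤1+⌊n/2⌋ n)

odd⇒⌈n/2⌉≡1+⌊n/2⌋ : ∀ n → 2 ∤ n → ⌈ n /2⌉ ≡ suc ⌊ n /2⌋
odd⇒⌈n/2⌉≡1+⌊n/2⌋ zero          2∤n = ⊥-elim (2∤n (divides 0 ≡.refl))
odd⇒⌈n/2⌉≡1+⌊n/2⌋ (suc zero)    2∤n = ≡.refl
odd⇒⌈n/2⌉≡1+⌊n/2⌋ (suc (suc n)) 2∤n = ≡.cong suc
  (odd⇒⌈n/2⌉≡1+⌊n/2⌋ n λ { (divides q n≡q*2) → 2∤n (divides (suc q) (≡.cong (2 ℕ.+_) n≡q*2)) })

-- Two sizes of which at most one is rounded up add to at most `t`. Two rounded-up sizes may add to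
-- `suc t`, but such supports share coordinate `zero`; this is the reason for the condition
-- `zero ∈ I`.
Small-∪ : ∀ {n} t (I J : Subset (suc n)) → Small t I → Small t J → ∣ I ∪ J ∣ ℕ.≤ t
Small-∪ t I J (inj₁ I≤) (inj₁ J≤) = begin
  ∣ I ∪ J ∣            ≤⟨ ∣p∪q∣≤∣p∣+∣q∣ I J ⟩
  ∣ I ∣ ℕ.+ ∣ J ∣        ≤⟨ ℕ.+-mono-≤ I≤ (ℕ.≤-trans J≤ (ℕ.⌊n/2⌋≤⌈n/2⌉ t)) ⟩
  ⌊ t /2⌋ ℕ.+ ⌈ t /2⌉    ≡⟨ ℕ.⌊n/2⌋+⌈n/2⌉≡n t ⟩
  t                    ∎
  where open ℕ.≤-Reasoning
Small-∪ t I J (inj₁ I≤) (inj₂ (_ , J≡ , _)) = begin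
  ∣ I ∪ J ∣            ≤⟨ ∣p∪q∣≤∣p∣+∣q∣ I J ⟩
  ∣ I ∣ ℕ.+ ∣ J ∣        ≤⟨ ℕ.+-mono-≤ I≤ (ℕ.≤-reflexive J≡) ⟩
  ⌊ t /2⌋ ℕ.+ ⌈ t /2⌉    ≡⟨ ℕ.⌊n/2⌋+⌈n/2⌉≡n t ⟩
  t                    ∎
  where open ℕ.≤-Reasoning
Small-∪ t I J (inj₂ (_ , I≡ , _)) (inj₁ J≤) = begin
  ∣ I ∪ J ∣            ≤⟨ ∣p∪q∣≤∣p∣+∣q∣ I J ⟩
  ∣ I ∣ ℕ.+ ∣ J ∣        ≤⟨ ℕ.+-mono-≤ (ℕ.≤-reflexive I≡) J≤ ⟩
  ⌈ t /2⌉ ℕ.+ ⌊ t /2⌋    ≡⟨ ℕ.+-comm ⌈ t /2⌉ ⌊ t /2⌋ ⟩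
  ⌊ t /2⌋ ℕ.+ ⌈ t /2⌉    ≡⟨ ℕ.⌊n/2⌋+⌈n/2⌉≡n t ⟩
  t                    ∎
  where open ℕ.≤-Reasoning
Small-∪ t I J (inj₂ (_ , I≡ , 0∈I)) (inj₂ (_ , J≡ , 0∈J)) = ℕ.≤-pred (begin
  suc ∣ I ∪ J ∣              ≤⟨ ∣p∪q∣<∣p∣+∣q∣ I J 0∈I 0∈J ⟩
  ∣ I ∣ ℕ.+ ∣ J ∣              ≡⟨ ≡.cong₂ ℕ._+_ I≡ J≡ ⟩
  ⌈ t /2⌉ ℕ.+ ⌈ t /2⌉          ≤⟨ ℕ.+-monoˡ-≤ ⌈ t /2⌉ (⌈n/2⌉≤1+⌊n/2⌋ t) ⟩
  suc (⌊ t /2⌋ ℕ.+ ⌈ t /2⌉)    ≡⟨ ≡.cong suc (ℕ.⌊n/2⌋+⌈n/2⌉≡n t) ⟩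
  suc t                      ∎)
  where open ℕ.≤-Reasoning

-- `AllPairs` relates earlier entries to later ones only; symmetry supplies the other order.
lookup-AllPairs : ∀ {a ℓ} {A : Set a} {R : Rel A ℓ} → Symmetric R → ∀ {xs} → AllPairs R xs →
                  ∀ i j → i ≢ j → R (lookup xs i) (lookup xs j)
lookup-AllPairs sym (x ∷ _)  zero    zero    i≢j = ⊥-elim (i≢j ≡.refl)
lookup-AllPairs sym (x ∷ _)  zero    (suc j) i≢j = All.lookup x (List∈.∈-lookup j)
lookup-AllPairs sym (x ∷ _)  (suc i) zero    i≢j = sym (All.lookup x (List∈.∈-lookup i))
lookup-AllPairs sym (_ ∷ xs) (suc i) (suc j) i≢j = lookup-AllPairs sym xs i j (i≢j ∘ ≡.cong suc)

subsets-unique : ∀ k → Unique.Unique (subsets k)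
subsets-unique zero    = All.[] ∷ []
subsets-unique (suc k) = Unique.++⁺
  (Unique.map⁺ Vec.∷-injectiveʳ (subsets-unique k))
  (Unique.map⁺ Vec.∷-injectiveʳ (subsets-unique k))
  λ (v∈out , v∈in) → let _ , _ , v≡out = List∈.∈-map⁻ (outside ∷_) v∈out
                         _ , _ , v≡in  = List∈.∈-map⁻ (inside ∷_) v∈in
                     in out≢in (Vec.∷-injectiveˡ (≡.trans (≡.sym v≡out) v≡in))
  where
  out≢in : outside ≢ inside
  out≢in ()

-- Rows are functions, so they are compared pointwise and distinctness is stated in this setoid.
Row-setoid : ∀ {k} → (Fin k → ℕ) → Setoid 0ℓ 0ℓ
Row-setoid s = record
  { Carrier = Row s ; _≈_ = λ a b → ∀ j → a j ≡ b j
  ; isEquivalence = record { refl = λ _ → ≡.refl ; sym = λ a≡b j → ≡.sym (a≡b j)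
                           ; trans = λ a≡b b≡c j → ≡.trans (a≡b j) (b≡c j) } }

rows-unique : ∀ {k} (s : Fin k → ℕ) → Uniqueₛ.Unique (Row-setoid s) (rows s)
rows-unique {zero}  s = All.[] ∷ []
rows-unique {suc k} s = Uniqueₛ.cartesianProductWith⁺ (≡.setoid (Fin (s zero))) (Row-setoid (s ∘ suc)) (Row-setoid s)
  Fin.∀-cons (λ a≡b → a≡b zero , a≡b ∘ suc) (Unique.allFin⁺ (s zero)) (rows-unique (s ∘ suc))

-- A coordinate of difference is what makes a factor vanish in `column-orthogonal`. It is found by
-- search, since levels have decidable equality.
ℱ-distinct : ∀ {n} t (s : Fin (suc n) → ℕ) (c d : Fin (length (ℱ t s))) → c ≢ d →
             ∃ λ j → lookup (ℱ t s) c j ≢ lookup (ℱ t s) d j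
ℱ-distinct t s c d c≢d = Fin.¬∀⟶∃¬ _ _ (λ j → lookup (ℱ t s) c j Fin.≟ lookup (ℱ t s) d j)
  (lookup-AllPairs (λ a≢b b≡a → a≢b (λ j → ≡.sym (b≡a j)))
    (Uniqueₛ.filter⁺ (Row-setoid s) (InF? t) (rows-unique s)) c d c≢d)

-- The size bound

module ListSums {c ℓ : Level} (R : CommutativeRing c ℓ) where
  open CommutativeRing R hiding (zero)
  open SetoidReasoning setoid
  open FiniteSums R
  open IntegerSolver R

  private variable
    k n : ℕ
    p : Level
    X Y : Set

  -- At `ℚ` this sum, and `∏ˡ∈` and `∑∏ˡ` below, are definitionally the `∑`, `∏∈` and `∑∏` of the
  -- bounds to be proved.
  ∑ˡ : List X → (X → Carrier) → Carrier
  ∑ˡ xs f = foldr _+_ 0# (map f xs)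

  ∑ˡ-cong : ∀ (xs : List X) {f g : X → Carrier} → (∀ x → f x ≈ g x) → ∑ˡ xs f ≈ ∑ˡ xs g
  ∑ˡ-cong []       f≈g = refl
  ∑ˡ-cong (x ∷ xs) f≈g = +-cong (f≈g x) (∑ˡ-cong xs f≈g)

  ∑ˡ-zero : ∀ (xs : List X) {f : X → Carrier} → (∀ x → f x ≈ 0#) → ∑ˡ xs f ≈ 0#
  ∑ˡ-zero []       f≈0 = refl
  ∑ˡ-zero (x ∷ xs) f≈0 = trans (+-cong (f≈0 x) (∑ˡ-zero xs f≈0)) (+-identityˡ 0#)

  ∑ˡ-distrib-+ : ∀ (xs : List X) (f g : X → Carrier) → ∑ˡ xs (λ x → f x + g x) ≈ ∑ˡ xs f + ∑ˡ xs g
  ∑ˡ-distrib-+ []       f g = sym (+-identityˡ 0#)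
  ∑ˡ-distrib-+ (x ∷ xs) f g = begin
    f x + g x + ∑ˡ xs (λ x → f x + g x)   ≈⟨ +-congˡ (∑ˡ-distrib-+ xs f g) ⟩
    f x + g x + (∑ˡ xs f + ∑ˡ xs g)       ≈⟨ solve 4 (λ a b c d → a :+ b :+ (c :+ d) := a :+ c :+ (b :+ d)) refl _ _ _ _ ⟩
    f x + ∑ˡ xs f + (g x + ∑ˡ xs g)       ∎

  ∑ˡ-*ˡ : ∀ (xs : List X) y (f : X → Carrier) → ∑ˡ xs (λ x → y * f x) ≈ y * ∑ˡ xs f
  ∑ˡ-*ˡ []       y f = sym (zeroʳ y)
  ∑ˡ-*ˡ (x ∷ xs) y f = trans (+-congˡ (∑ˡ-*ˡ xs y f)) (sym (distribˡ y _ _))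

  ∑ˡ-++ : ∀ (xs ys : List X) (f : X → Carrier) → ∑ˡ (xs ++ ys) f ≈ ∑ˡ xs f + ∑ˡ ys f
  ∑ˡ-++ []       ys f = sym (+-identityˡ _)
  ∑ˡ-++ (x ∷ xs) ys f = trans (+-congˡ (∑ˡ-++ xs ys f)) (sym (+-assoc _ _ _))

  ∑ˡ-map : ∀ (g : X → Y) xs (f : Y → Carrier) → ∑ˡ (map g xs) f ≡ ∑ˡ xs (f ∘ g)
  ∑ˡ-map g xs f = ≡.cong (foldr _+_ 0#) (≡.sym (List.map-∘ xs))

  ∑ˡ-filter : ∀ {P : Pred X p} (P? : Decidable P) xs (f : X → Carrier) →
    ∑ˡ (filter P? xs) f ≈ ∑ˡ xs λ x → ⟪ P? x ⟫ * f x
  ∑ˡ-filter P? []       f = refl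
  ∑ˡ-filter P? (x ∷ xs) f with does (P? x)
  ... | true  = +-cong (sym (*-identityˡ _)) (∑ˡ-filter P? xs f)
  ... | false = trans (∑ˡ-filter P? xs f) (sym (trans (+-congʳ (zeroˡ _)) (+-identityˡ _)))

  ∑ˡ-lookup : ∀ (xs : List X) (f : X → Carrier) → ∑ˡ xs f ≈ sum λ i → f (lookup xs i)
  ∑ˡ-lookup []       f = refl
  ∑ˡ-lookup (x ∷ xs) f = +-congˡ (∑ˡ-lookup xs f)

  ∏ˡ∈ : Subset k → (Fin k → Carrier) → Carrier
  ∏ˡ∈ {k} I f = foldr _*_ 1# (map f (filter (_∈? I) (allFin k)))

  -- Padding with 1 turns a product over `I` into one over all coordinates, the form that `average`
  -- handles.
  onSubset : Subset k → (Fin k → Carrier) → Fin k → Carrier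
  onSubset I f j = if does (j ∈? I) then f j else 1#

  ∏ˡ-filter-tabulate : ∀ {P : Pred X p} (P? : Decidable P) (g : Fin n → X) (f : X → Carrier) →
    foldr _*_ 1# (map f (filter P? (tabulate g))) ≈ product λ i → if does (P? (g i)) then f (g i) else 1#
  ∏ˡ-filter-tabulate {n = zero}  P? g f = refl
  ∏ˡ-filter-tabulate {n = suc n} P? g f with does (P? (g zero))
  ... | true  = *-congˡ (∏ˡ-filter-tabulate P? (g ∘ suc) f)
  ... | false = trans (∏ˡ-filter-tabulate P? (g ∘ suc) f) (sym (*-identityˡ _))

  ∏ˡ∈-product : ∀ (I : Subset k) f → ∏ˡ∈ I f ≈ product (onSubset I f)
  ∏ˡ∈-product I f = ∏ˡ-filter-tabulate (_∈? I) id f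

  ∑∏ˡ : ℕ → (Fin k → Carrier) → Carrier
  ∑∏ˡ {k} i f = ∑ˡ (filter (λ I → ∣ I ∣ ℕ.≟ i) (subsets k)) λ I → ∏ˡ∈ I f

  ⟪≤0⟫ : ∀ m → ⟪ m ℕ.≤? 0 ⟫ ≈ ⟪ m ℕ.≟ 0 ⟫
  ⟪≤0⟫ m = ⟪⟫-cong (m ℕ.≤? 0) (m ℕ.≟ 0) ℕ.n≤0⇒n≡0 ℕ.≤-reflexive

  ⟪≤1+⟫ : ∀ m n → ⟪ m ℕ.≤? suc n ⟫ ≈ ⟪ m ℕ.≤? n ⟫ + ⟪ m ℕ.≟ suc n ⟫
  ⟪≤1+⟫ m n = go (m ℕ.≤? n)
    where
    go : (d : Dec (m ℕ.≤ n)) → ⟪ m ℕ.≤? suc n ⟫ ≈ ⟪ d ⟫ + ⟪ m ℕ.≟ suc n ⟫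
    go (yes m≤n) = begin
      ⟪ m ℕ.≤? suc n ⟫          ≈⟨ ⟪⟫-yes (m ℕ.≤? suc n) (ℕ.m≤n⇒m≤1+n m≤n) ⟩
      1#                        ≈⟨ +-identityʳ 1# ⟨
      1# + 0#                   ≈⟨ +-congˡ (⟪⟫-no (m ℕ.≟ suc n) λ m≡1+n → ℕ.1+n≰n (≡.subst (ℕ._≤ n) m≡1+n m≤n)) ⟨
      1# + ⟪ m ℕ.≟ suc n ⟫      ∎
    go (no m≰n) = begin
      ⟪ m ℕ.≤? suc n ⟫          ≈⟨ ⟪⟫-cong (m ℕ.≤? suc n) (m ℕ.≟ suc n) (λ m≤1+n → ℕ.≤-antisym m≤1+n (ℕ.≰⇒> m≰n)) ℕ.≤-reflexive ⟩
      ⟪ m ℕ.≟ suc n ⟫           ≈⟨ +-identityˡ _ ⟨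
      0# + ⟪ m ℕ.≟ suc n ⟫      ∎

  -- Each subset of size at most `m` is picked up once, at its own size. The induction splits off
  -- the last size.
  ∑ˡ-upTo-sizes : ∀ (xs : List (Subset k)) (f : Subset k → Carrier) m →
    ∑ˡ (upTo (suc m)) (λ i → ∑ˡ (filter (λ I → ∣ I ∣ ℕ.≟ i) xs) f) ≈ ∑ˡ xs λ I → ⟪ ∣ I ∣ ℕ.≤? m ⟫ * f I
  ∑ˡ-upTo-sizes xs f zero = begin
    ∑ˡ (filter (λ I → ∣ I ∣ ℕ.≟ 0) xs) f + 0#   ≈⟨ +-identityʳ _ ⟩
    ∑ˡ (filter (λ I → ∣ I ∣ ℕ.≟ 0) xs) f        ≈⟨ ∑ˡ-filter (λ I → ∣ I ∣ ℕ.≟ 0) xs f ⟩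
    ∑ˡ xs (λ I → ⟪ ∣ I ∣ ℕ.≟ 0 ⟫ * f I)         ≈⟨ ∑ˡ-cong xs (λ I → *-congʳ (⟪≤0⟫ ∣ I ∣)) ⟨
    ∑ˡ xs (λ I → ⟪ ∣ I ∣ ℕ.≤? 0 ⟫ * f I)        ∎
  ∑ˡ-upTo-sizes xs f (suc m) = begin
    ∑ˡ (upTo (suc (suc m))) φ
      ≡⟨ ≡.cong (λ is → ∑ˡ is φ) (List.upTo-∷ʳ (suc m)) ⟨
    ∑ˡ (upTo (suc m) ++ suc m ∷ []) φ
      ≈⟨ ∑ˡ-++ (upTo (suc m)) _ φ ⟩
    ∑ˡ (upTo (suc m)) φ + (φ (suc m) + 0#)
      ≈⟨ +-cong (∑ˡ-upTo-sizes xs f m) (trans (+-identityʳ _) (∑ˡ-filter (λ I → ∣ I ∣ ℕ.≟ suc m) xs f)) ⟩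
    ∑ˡ xs (λ I → ⟪ ∣ I ∣ ℕ.≤? m ⟫ * f I) + ∑ˡ xs (λ I → ⟪ ∣ I ∣ ℕ.≟ suc m ⟫ * f I)
      ≈⟨ ∑ˡ-distrib-+ xs _ _ ⟨
    ∑ˡ xs (λ I → ⟪ ∣ I ∣ ℕ.≤? m ⟫ * f I + ⟪ ∣ I ∣ ℕ.≟ suc m ⟫ * f I)
      ≈⟨ ∑ˡ-cong xs (λ I → trans (*-congʳ (⟪≤1+⟫ ∣ I ∣ m)) (distribʳ _ _ _)) ⟨
    ∑ˡ xs (λ I → ⟪ ∣ I ∣ ℕ.≤? suc m ⟫ * f I) ∎
    where φ = λ i → ∑ˡ (filter (λ I → ∣ I ∣ ℕ.≟ i) xs) f

  ∑-Small-even : ∀ t → 2 ∣ t → (f : Fin (suc n) → Carrier) →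
    ∑ˡ (filter (Small? t) (subsets (suc n))) (λ I → ∏ˡ∈ I f) ≈ ∑ˡ (upTo (suc ⌊ t /2⌋)) (λ i → ∑∏ˡ i f)
  ∑-Small-even {n} t 2∣t f = begin
    ∑ˡ (filter (Small? t) (subsets (suc n))) F
      ≈⟨ ∑ˡ-filter (Small? t) (subsets (suc n)) F ⟩
    ∑ˡ (subsets (suc n)) (λ I → ⟪ Small? t I ⟫ * F I)
      ≈⟨ ∑ˡ-cong (subsets (suc n)) (λ I → *-congʳ (⟪⟫-cong (Small? t I) (∣ I ∣ ℕ.≤? ⌊ t /2⌋)
           (λ { (inj₁ I≤) → I≤ ; (inj₂ (2∤t , _)) → ⊥-elim (2∤t 2∣t) }) inj₁)) ⟩
    ∑ˡ (subsets (suc n)) (λ I → ⟪ ∣ I ∣ ℕ.≤? ⌊ t /2⌋ ⟫ * F I)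
      ≈⟨ ∑ˡ-upTo-sizes (subsets (suc n)) F ⌊ t /2⌋ ⟨
    ∑ˡ (upTo (suc ⌊ t /2⌋)) (λ i → ∑∏ˡ i f) ∎
    where F = λ I → ∏ˡ∈ I f

  -- The two alternatives exclude each other because the sizes differ, so the bracket of their
  -- disjunction is a sum.
  ⟪Small⟫-odd : ∀ t → 2 ∤ t → (I : Subset (suc n)) →
    ⟪ Small? t I ⟫ ≈ ⟪ ∣ I ∣ ℕ.≤? ⌊ t /2⌋ ⟫ + ⟪ ∣ I ∣ ℕ.≟ suc ⌊ t /2⌋ ⟫ * ⟪ zero ∈? I ⟫
  ⟪Small⟫-odd t 2∤t I = go (∣ I ∣ ℕ.≤? ⌊ t /2⌋) (∣ I ∣ ℕ.≟ suc ⌊ t /2⌋) (zero ∈? I)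
    where
    ⌈t/2⌉≡ = odd⇒⌈n/2⌉≡1+⌊n/2⌋ t 2∤t
    go : (d : Dec (∣ I ∣ ℕ.≤ ⌊ t /2⌋)) (e : Dec (∣ I ∣ ≡ suc ⌊ t /2⌋)) (z : Dec (zero ∈ I)) →
         ⟪ Small? t I ⟫ ≈ ⟪ d ⟫ + ⟪ e ⟫ * ⟪ z ⟫
    go (yes I≤) (yes I≡) z = ⊥-elim (ℕ.1+n≰n (≡.subst (ℕ._≤ ⌊ t /2⌋) I≡ I≤))
    go (yes I≤) (no _)   z = trans (⟪⟫-yes (Small? t I) (inj₁ I≤)) (sym (trans (+-congˡ (zeroˡ _)) (+-identityʳ _)))
    go (no I≰)  (yes I≡) z = trans
      (⟪⟫-cong (Small? t I) z
        (λ { (inj₁ I≤) → ⊥-elim (I≰ I≤) ; (inj₂ (_ , _ , 0∈I)) → 0∈I })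
        (λ 0∈I → inj₂ (2∤t , ≡.trans I≡ (≡.sym ⌈t/2⌉≡) , 0∈I)))
      (sym (trans (+-identityˡ _) (*-identityˡ _)))
    go (no I≰)  (no I≢)  z = trans
      (⟪⟫-no (Small? t I) λ { (inj₁ I≤) → I≰ I≤ ; (inj₂ (_ , I≡ , _)) → I≢ (≡.trans I≡ ⌈t/2⌉≡) })
      (sym (trans (+-identityˡ _) (zeroˡ _)))

  ∑-Small-odd : ∀ t → 2 ∤ t → (f : Fin (suc n) → Carrier) →
    ∑ˡ (filter (Small? t) (subsets (suc n))) (λ I → ∏ˡ∈ I f) ≈
    ∑ˡ (upTo (suc ⌊ t /2⌋)) (λ i → ∑∏ˡ i f) + f zero * ∑∏ˡ ⌊ t /2⌋ (f ∘ suc)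
  ∑-Small-odd {n} t 2∤t f = begin
    ∑ˡ (filter (Small? t) (subsets (suc n))) F
      ≈⟨ ∑ˡ-filter (Small? t) (subsets (suc n)) F ⟩
    ∑ˡ (subsets (suc n)) (λ I → ⟪ Small? t I ⟫ * F I)
      ≈⟨ ∑ˡ-cong (subsets (suc n)) (λ I → trans (*-congʳ (⟪Small⟫-odd t 2∤t I)) (distribʳ _ _ _)) ⟩
    ∑ˡ (subsets (suc n)) (λ I → ⟪ ∣ I ∣ ℕ.≤? m ⟫ * F I + G I)
      ≈⟨ ∑ˡ-distrib-+ (subsets (suc n)) _ _ ⟩
    ∑ˡ (subsets (suc n)) (λ I → ⟪ ∣ I ∣ ℕ.≤? m ⟫ * F I) + ∑ˡ (subsets (suc n)) G
      ≈⟨ +-cong (sym (∑ˡ-upTo-sizes (subsets (suc n)) F m)) ∑G ⟩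
    ∑ˡ (upTo (suc m)) (λ i → ∑∏ˡ i f) + f zero * ∑∏ˡ m (f ∘ suc) ∎
    where
    m = ⌊ t /2⌋
    F : Subset (suc n) → Carrier
    F I = ∏ˡ∈ I f
    G : Subset (suc n) → Carrier
    G I = ⟪ ∣ I ∣ ℕ.≟ suc m ⟫ * ⟪ zero ∈? I ⟫ * F I

    -- Removing `zero` matches the sets of size `suc m` containing it with the sets of size `m` of
    -- other coordinates. The factor that splits off is the coefficient of the extra term for odd
    -- `t`.
    G-inside : ∀ I → G (inside ∷ I) ≈ f zero * (⟪ ∣ I ∣ ℕ.≟ m ⟫ * ∏ˡ∈ I (f ∘ suc))
    G-inside I = begin
      ⟪ suc ∣ I ∣ ℕ.≟ suc m ⟫ * 1# * F (inside ∷ I)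
        ≈⟨ *-cong (*-congʳ (⟪⟫-cong (suc ∣ I ∣ ℕ.≟ suc m) (∣ I ∣ ℕ.≟ m) ℕ.suc-injective (≡.cong suc)))
                  (∏ˡ∈-product (inside ∷ I) f) ⟩
      ⟪ ∣ I ∣ ℕ.≟ m ⟫ * 1# * (f zero * product (onSubset I (f ∘ suc)))
        ≈⟨ *-congˡ (*-congˡ (∏ˡ∈-product I (f ∘ suc))) ⟨
      ⟪ ∣ I ∣ ℕ.≟ m ⟫ * 1# * (f zero * ∏ˡ∈ I (f ∘ suc))
        ≈⟨ solve 3 (λ a b c → a :* con 𝟙 :* (b :* c) := b :* (a :* c)) refl _ _ _ ⟩
      f zero * (⟪ ∣ I ∣ ℕ.≟ m ⟫ * ∏ˡ∈ I (f ∘ suc)) ∎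

    ∑G : ∑ˡ (subsets (suc n)) G ≈ f zero * ∑∏ˡ m (f ∘ suc)
    ∑G = begin
      ∑ˡ (map (outside ∷_) (subsets n) ++ map (inside ∷_) (subsets n)) G
        ≈⟨ ∑ˡ-++ (map (outside ∷_) (subsets n)) _ G ⟩
      ∑ˡ (map (outside ∷_) (subsets n)) G + ∑ˡ (map (inside ∷_) (subsets n)) G
        ≡⟨ ≡.cong₂ _+_ (∑ˡ-map (outside ∷_) (subsets n) G) (∑ˡ-map (inside ∷_) (subsets n) G) ⟩
      ∑ˡ (subsets n) (G ∘ (outside ∷_)) + ∑ˡ (subsets n) (G ∘ (inside ∷_))
        ≈⟨ +-cong (∑ˡ-zero (subsets n) λ I → trans (*-congʳ (zeroʳ _)) (zeroˡ _)) (∑ˡ-cong (subsets n) G-inside) ⟩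
      0# + ∑ˡ (subsets n) (λ I → f zero * (⟪ ∣ I ∣ ℕ.≟ m ⟫ * ∏ˡ∈ I (f ∘ suc)))
        ≈⟨ +-identityˡ _ ⟩
      ∑ˡ (subsets n) (λ I → f zero * (⟪ ∣ I ∣ ℕ.≟ m ⟫ * ∏ˡ∈ I (f ∘ suc)))
        ≈⟨ ∑ˡ-*ˡ (subsets n) (f zero) _ ⟩
      f zero * ∑ˡ (subsets n) (λ I → ⟪ ∣ I ∣ ℕ.≟ m ⟫ * ∏ˡ∈ I (f ∘ suc))
        ≈⟨ *-congˡ (∑ˡ-filter (λ I → ∣ I ∣ ℕ.≟ m) (subsets n) _) ⟨
      f zero * ∑∏ˡ m (f ∘ suc) ∎

≢⇒membership-differs : ∀ {k} {I J : Subset k} → I ≢ J → ∃ λ j → does (j ∈? I) ≢ does (j ∈? J)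
≢⇒membership-differs {k} {I} {J} I≢J =
  Fin.¬∀⟶∃¬ k _ (λ j → does (j ∈? I) Bool.≟ does (j ∈? J)) λ same →
    I≢J (⊆-antisym (λ {j} → transfer j (same j)) (λ {j} → transfer j (≡.sym (same j))))
  where
  transfer : ∀ {I J : Subset k} j → does (j ∈? I) ≡ does (j ∈? J) → j ∈ I → j ∈ J
  transfer {I} {J} j same j∈I with j ∈? I | j ∈? J
  ... | yes _   | yes j∈J = j∈J
  ... | no j∉I  | _       = ⊥-elim (j∉I j∈I)

-- Kernels and the Bessel defect

module Bessel {c ℓ : Level} (R : CommutativeRing c ℓ) where
  open CommutativeRing R hiding (zero)
  open SetoidReasoning setoid
  open FiniteSums R
  open ListSums R
  open IntegerSolver R

  sum-*-sum : ∀ {m n} (f : Fin m → Carrier) (g : Fin n → Carrier) →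
              sum f * sum g ≈ sum λ i → sum λ j → f i * g j
  sum-*-sum f g = trans (*-distribʳ-sum (sum g) f) (sum-cong-≋ λ i → *-distribˡ-sum (f i) g)

  module _ {k : ℕ} (s : Fin k → ℕ) where

    private
      S : Fin k → Carrier
      S j = s j · 1#

    -- The reproducing kernel of the functions on ℤ_{s_j} with sum 0.
    κ : ∀ j → Fin (s j) → Fin (s j) → Carrier
    κ j u v = S j * ⟪ u Fin.≟ v ⟫ - 1#

    sum-κ : ∀ j v → (sum λ u → κ j u v) ≈ 0#
    sum-κ j v = begin
      (sum λ u → S j * ⟪ u Fin.≟ v ⟫ - 1#)
        ≈⟨ ∑-distrib-+ {s j} (λ u → S j * ⟪ u Fin.≟ v ⟫) (λ _ → - 1#) ⟩
      (sum λ u → S j * ⟪ u Fin.≟ v ⟫) + sum {s j} (λ _ → - 1#)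
        ≈⟨ +-cong (sum-single _ v λ u u≢v → trans (*-congˡ (⟪⟫-no (u Fin.≟ v) u≢v)) (zeroʳ _)) (sum-const (s j) (- 1#)) ⟩
      S j * ⟪ v Fin.≟ v ⟫ + S j * - 1#
        ≈⟨ +-congʳ (*-congˡ (⟪⟫-yes (v Fin.≟ v) ≡.refl)) ⟩
      S j * 1# + S j * - 1#
        ≈⟨ solve 1 (λ a → a :* con 𝟙 :+ a :* :- con 𝟙 := con 𝟘) refl (S j) ⟩
      0# ∎

    -- The factor `κ j u v` is evaluation at `v`, scaled by `S j`, minus plain summation; the
    -- summation contributes 0 by `sum-κ`.
    sum-κ-κ : ∀ j v w → (sum λ u → κ j u v * κ j u w) ≈ S j * κ j v w
    sum-κ-κ j v w = begin
      (sum λ u → κ j u v * κ j u w)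
        ≈⟨ sum-cong-≋ (λ u → solve 2 (λ a b → (a :- con 𝟙) :* b := a :* b :+ :- con 𝟙 :* b) refl
             (S j * ⟪ u Fin.≟ v ⟫) (κ j u w)) ⟩
      (sum λ u → S j * ⟪ u Fin.≟ v ⟫ * κ j u w + - 1# * κ j u w)
        ≈⟨ ∑-distrib-+ (λ u → S j * ⟪ u Fin.≟ v ⟫ * κ j u w) (λ u → - 1# * κ j u w) ⟩
      (sum λ u → S j * ⟪ u Fin.≟ v ⟫ * κ j u w) + (sum λ u → - 1# * κ j u w)
        ≈⟨ +-cong
             (sum-single _ v λ u u≢v → trans (*-congʳ (trans (*-congˡ (⟪⟫-no (u Fin.≟ v) u≢v)) (zeroʳ _))) (zeroˡ _))
             (trans (sym (*-distribˡ-sum (- 1#) (λ u → κ j u w))) (trans (*-congˡ (sum-κ j w)) (zeroʳ _))) ⟩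
      S j * ⟪ v Fin.≟ v ⟫ * κ j v w + 0#
        ≈⟨ +-identityʳ _ ⟩
      S j * ⟪ v Fin.≟ v ⟫ * κ j v w
        ≈⟨ *-congʳ (trans (*-congˡ (⟪⟫-yes (v Fin.≟ v) ≡.refl)) (*-identityʳ _)) ⟩
      S j * κ j v w ∎

    K : Subset k → Row s → Row s → Carrier
    K I x y = product (onSubset I λ j → κ j (x j) (y j))

    module _ {t N : ℕ} .⦃ s≢0 : ∀ {i} → NonZero (s i) ⦄ (t≤k : t ℕ.≤ k)
             (A : Array N s) (A-OA : IsOA t A) where

      private
        -- Mean of the factor at `j` of the product of two kernels: `κ` again if `j` lies in both
        -- supports, 0 if in exactly one, 1 if in neither.
        mixed : (I J : Subset k) → Row s → Row s → Fin k → Carrier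
        mixed I J y z j = if does (j ∈? I)
          then (if does (j ∈? J) then κ j (y j) (z j) else 0#)
          else (if does (j ∈? J) then 0# else 1#)

        sum-K-K : ∀ I J → ∣ I ∪ J ∣ ℕ.≤ t → ∀ y z →
          (sum λ x → K I (A x) y * K J (A x) z) ≈ N · 1# * product (mixed I J y z)
        sum-K-K I J I∪J≤t y z = begin
          (sum λ x → K I (A x) y * K J (A x) z)
            ≈⟨ sum-cong-≋ (λ x → product-distrib-* (onSubset I λ j → κ j (A x j) (y j)) (onSubset J λ j → κ j (A x j) (z j))) ⟨
          (sum λ x → product λ j → h j (A x j))
            ≈⟨ average A A-OA t≤k (I ∪ J) I∪J≤t h (mixed I J y z) h≈1 mixed≈1 sum-h ⟩
          N · 1# * product (mixed I J y z) ∎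
          where
          h : ∀ j → Fin (s j) → Carrier
          h j u = (if does (j ∈? I) then κ j u (y j) else 1#) * (if does (j ∈? J) then κ j u (z j) else 1#)

          h≈1 : ∀ j → j ∉ I ∪ J → ∀ u → h j u ≈ 1#
          h≈1 j j∉ u with j ∈? I | j ∈? J
          ... | yes j∈I | _       = ⊥-elim (j∉ (p⊆p∪q J j∈I))
          ... | no _    | yes j∈J = ⊥-elim (j∉ (q⊆p∪q I J j∈J))
          ... | no _    | no _    = *-identityˡ 1#

          mixed≈1 : ∀ j → j ∉ I ∪ J → mixed I J y z j ≈ 1#
          mixed≈1 j j∉ with j ∈? I | j ∈? J
          ... | yes j∈I | _       = ⊥-elim (j∉ (p⊆p∪q J j∈I))
          ... | no _    | yes j∈J = ⊥-elim (j∉ (q⊆p∪q I J j∈J))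
          ... | no _    | no _    = refl

          sum-h : ∀ j → sum (h j) ≈ S j * mixed I J y z j
          sum-h j with does (j ∈? I) | does (j ∈? J)
          ... | true  | true  = sum-κ-κ j (y j) (z j)
          ... | true  | false = trans (sum-cong-≋ λ u → *-identityʳ (κ j u (y j))) (trans (sum-κ j (y j)) (sym (zeroʳ _)))
          ... | false | true  = trans (sum-cong-≋ λ u → *-identityˡ (κ j u (z j))) (trans (sum-κ j (z j)) (sym (zeroʳ _)))
          ... | false | false = trans (sum-cong-≋ {s j} λ u → *-identityˡ 1#) (sum-const (s j) 1#)

      K-reproducing : ∀ I → ∣ I ∪ I ∣ ℕ.≤ t → ∀ y z → (sum λ x → K I (A x) y * K I (A x) z) ≈ N · 1# * K I y z
      K-reproducing I I∪I≤t y z = trans (sum-K-K I I I∪I≤t y z) (*-congˡ (product-cong mixed≈κ))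
        where
        mixed≈κ : ∀ j → mixed I I y z j ≈ onSubset I (λ j → κ j (y j) (z j)) j
        mixed≈κ j with does (j ∈? I)
        ... | true  = refl
        ... | false = refl

      -- Distinct supports differ at some coordinate, where a single `κ` is averaged and gives 0.
      K-orthogonal : ∀ I J → ∣ I ∪ J ∣ ℕ.≤ t → I ≢ J → ∀ y z → (sum λ x → K I (A x) y * K J (A x) z) ≈ 0#
      K-orthogonal I J I∪J≤t I≢J y z with ≢⇒membership-differs I≢J
      ... | j , differ = trans (sum-K-K I J I∪J≤t y z) (trans (*-congˡ (product-zero (mixed I J y z) j mixed≈0)) (zeroʳ _))
        where
        mixed≈0 : mixed I J y z j ≈ 0#
        mixed≈0 with does (j ∈? I) | does (j ∈? J)
        ... | true  | true  = ⊥-elim (differ ≡.refl)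
        ... | true  | false = refl
        ... | false | true  = refl
        ... | false | false = ⊥-elim (differ ≡.refl)

    module _ {r : Fin k → ℕ} {t M : ℕ} .⦃ r≢0 : ∀ {i} → NonZero (r i) ⦄ (t≤k : t ℕ.≤ k)
             (r≤s : ∀ i → r i ℕ.≤ s i) (B : Array M r) (B-OA : IsOA t B)
             (e : Fin k → Carrier) (r*e : ∀ j → r j · 1# * e j ≈ S j - r j · 1#) where

      -- For fixed `z` exactly one of the `r j` levels matches `z j`, so the factor sums to
      -- `S j - r j · 1#` and its mean is `e j`, that is s_j / r_j - 1. The result does not depend
      -- on `z`.
      sum-K-embed : ∀ I → ∣ I ∣ ℕ.≤ t → ∀ (z : Row r) →
        (sum λ y → K I (embed r≤s (B y)) (embed r≤s z)) ≈ M · 1# * product (onSubset I e)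
      sum-K-embed I I≤t z = average B B-OA t≤k I I≤t h (onSubset I e) h≈1 e≈1 sum-h
        where
        h : ∀ j → Fin (r j) → Carrier
        h j v = if does (j ∈? I) then κ j (inject≤ v (r≤s j)) (inject≤ (z j) (r≤s j)) else 1#

        h≈1 : ∀ j → j ∉ I → ∀ v → h j v ≈ 1#
        h≈1 j j∉I v with j ∈? I
        ... | yes j∈I = ⊥-elim (j∉I j∈I)
        ... | no _    = refl

        e≈1 : ∀ j → j ∉ I → onSubset I e j ≈ 1#
        e≈1 j j∉I with j ∈? I
        ... | yes j∈I = ⊥-elim (j∉I j∈I)
        ... | no _    = refl

        sum-h : ∀ j → sum (h j) ≈ r j · 1# * onSubset I e j
        sum-h j with does (j ∈? I)
        ... | false = sum-const (r j) 1#
        ... | true  = begin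
          (sum λ v → S j * ⟪ ι v Fin.≟ ι (z j) ⟫ - 1#)
            ≈⟨ ∑-distrib-+ {r j} (λ v → S j * ⟪ ι v Fin.≟ ι (z j) ⟫) (λ _ → - 1#) ⟩
          (sum λ v → S j * ⟪ ι v Fin.≟ ι (z j) ⟫) + sum {r j} (λ _ → - 1#)
            ≈⟨ +-cong
                 (sum-single _ (z j) λ v v≢z → trans (*-congˡ (⟪⟫-no (ι v Fin.≟ ι (z j))
                    (v≢z ∘ Fin.inject≤-injective (r≤s j) (r≤s j) v (z j)))) (zeroʳ _))
                 (sum-const (r j) (- 1#)) ⟩
          S j * ⟪ ι (z j) Fin.≟ ι (z j) ⟫ + r j · 1# * - 1#
            ≈⟨ +-congʳ (*-congˡ (⟪⟫-yes (ι (z j) Fin.≟ ι (z j)) ≡.refl)) ⟩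
          S j * 1# + r j · 1# * - 1#
            ≈⟨ solve 2 (λ a b → a :* con 𝟙 :+ b :* :- con 𝟙 := a :- b) refl (S j) (r j · 1#) ⟩
          S j - r j · 1#
            ≈⟨ r*e j ⟨
          r j · 1# * e j ∎
          where
          ι : Fin (r j) → Fin (s j)
          ι v = inject≤ v (r≤s j)

  module _ {n t : ℕ} (t≤k : t ℕ.≤ suc n) {s r : Fin (suc n) → ℕ}
           .⦃ s≢0 : ∀ {i} → NonZero (s i) ⦄ .⦃ r≢0 : ∀ {i} → NonZero (r i) ⦄
           (r≤s : ∀ i → r i ℕ.≤ s i) {N M : ℕ} (A : Array N s) (B : Array M r)
           (A-OA : IsOA t A) (B-OA : IsOA t B) (B⊆A : Subarray r≤s B A)
           (e : Fin (suc n) → Carrier) (r*e : ∀ j → r j · 1# * e j ≈ s j · 1# - r j · 1#)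
           {L : ℕ} (I : Fin L → Subset (suc n)) (I-small : ∀ c → Small t (I c))
           (I-distinct : ∀ c d → c ≢ d → I c ≢ I d) where

    private
      f : Fin M → Fin N
      f = Injection.to (proj₁ B⊆A)

      b : Fin M → Row s
      b y = embed r≤s (B y)

      E : Fin L → Carrier
      E c = product (onSubset (I c) e)

      ∣I∪I∣≤t : ∀ c d → ∣ I c ∪ I d ∣ ℕ.≤ t
      ∣I∪I∣≤t c d = Small-∪ t (I c) (I d) (I-small c) (I-small d)

      ν μ : Carrier
      ν = N · 1#
      μ = M · 1#

      sum-sum-K : ∀ c → (sum λ y → sum λ z → K s (I c) (b y) (b z)) ≈ μ * μ * E c
      sum-sum-K c = begin
        (sum λ y → sum λ z → K s (I c) (b y) (b z))
          ≈⟨ ∑-comm (λ y z → K s (I c) (b y) (b z)) ⟩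
        (sum λ z → sum λ y → K s (I c) (b y) (b z))
          ≈⟨ sum-cong-≋ (λ z → sum-K-embed s t≤k r≤s B B-OA e r*e (I c) (ℕ.≤-trans (∣p∣≤∣p∪q∣ (I c) (I c)) (∣I∪I∣≤t c c)) (B z)) ⟩
        sum {M} (λ z → μ * E c)
          ≈⟨ sum-const M _ ⟩
        μ * (μ * E c)
          ≈⟨ *-assoc _ _ _ ⟨
        μ * μ * E c ∎

      -- Over ℂ this is |A| times the projection of the indicator of `B` onto the span of the
      -- characters with support `I c`.
      u : Fin L → Fin N → Carrier
      u c x = sum λ y → K s (I c) (A x) (b y)

      sum-u-u : ∀ c d → (sum λ x → u c x * u d x) ≈
                (sum λ y → sum λ z → sum λ x → K s (I c) (A x) (b y) * K s (I d) (A x) (b z))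
      sum-u-u c d = begin
        (sum λ x → u c x * u d x)
          ≈⟨ sum-cong-≋ (λ x → sum-*-sum (λ y → K s (I c) (A x) (b y)) (λ z → K s (I d) (A x) (b z))) ⟩
        (sum λ x → sum λ y → sum λ z → K s (I c) (A x) (b y) * K s (I d) (A x) (b z))
          ≈⟨ ∑-comm (λ x y → sum λ z → K s (I c) (A x) (b y) * K s (I d) (A x) (b z)) ⟩
        (sum λ y → sum λ x → sum λ z → K s (I c) (A x) (b y) * K s (I d) (A x) (b z))
          ≈⟨ sum-cong-≋ (λ y → ∑-comm (λ x z → K s (I c) (A x) (b y) * K s (I d) (A x) (b z))) ⟩
        (sum λ y → sum λ z → sum λ x → K s (I c) (A x) (b y) * K s (I d) (A x) (b z)) ∎

      sum-u² : ∀ c → (sum λ x → u c x * u c x) ≈ ν * (μ * μ) * E c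
      sum-u² c = begin
        (sum λ x → u c x * u c x)
          ≈⟨ sum-u-u c c ⟩
        (sum λ y → sum λ z → sum λ x → K s (I c) (A x) (b y) * K s (I c) (A x) (b z))
          ≈⟨ sum-cong-≋ (λ y → sum-cong-≋ (λ z → K-reproducing s t≤k A A-OA (I c) (∣I∪I∣≤t c c) (b y) (b z))) ⟩
        (sum λ y → sum λ z → ν * K s (I c) (b y) (b z))
          ≈⟨ sum-cong-≋ (λ y → *-distribˡ-sum ν (λ z → K s (I c) (b y) (b z))) ⟨
        (sum λ y → ν * sum λ z → K s (I c) (b y) (b z))
          ≈⟨ *-distribˡ-sum ν (λ y → sum λ z → K s (I c) (b y) (b z)) ⟨
        ν * (sum λ y → sum λ z → K s (I c) (b y) (b z))
          ≈⟨ *-congˡ (sum-sum-K c) ⟩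
        ν * (μ * μ * E c)
          ≈⟨ *-assoc _ _ _ ⟨
        ν * (μ * μ) * E c ∎

      sum-u-u-distinct : ∀ c d → d ≢ c → (sum λ x → u c x * u d x) ≈ 0#
      sum-u-u-distinct c d d≢c = trans (sum-u-u c d) (sum-zero λ y → sum-zero λ z →
        K-orthogonal s t≤k A A-OA (I c) (I d) (∣I∪I∣≤t c d) (I-distinct c d (d≢c ∘ ≡.sym)) (b y) (b z))

      -- `w` marks the rows of `A` matched with rows of `B`, by index and not by value, so copies of
      -- a row stay separate. `g` is |A| times the projection of `w`.
      w g : Fin N → Carrier
      w x = sum λ y → ⟪ f y Fin.≟ x ⟫
      g x = sum λ c → u c x

      sum-w : ∀ φ → (sum λ x → w x * φ x) ≈ sum (φ ∘ f)
      sum-w φ = begin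
        (sum λ x → w x * φ x)
          ≈⟨ sum-cong-≋ (λ x → *-distribʳ-sum (φ x) (λ y → ⟪ f y Fin.≟ x ⟫)) ⟩
        (sum λ x → sum λ y → ⟪ f y Fin.≟ x ⟫ * φ x)
          ≈⟨ ∑-comm (λ x y → ⟪ f y Fin.≟ x ⟫ * φ x) ⟩
        (sum λ y → sum λ x → ⟪ f y Fin.≟ x ⟫ * φ x)
          ≈⟨ sum-cong-≋ (λ y → sum-single (λ x → ⟪ f y Fin.≟ x ⟫ * φ x) (f y)
               λ x x≢ → trans (*-congʳ (⟪⟫-no (f y Fin.≟ x) (x≢ ∘ ≡.sym))) (zeroˡ _)) ⟩
        (sum λ y → ⟪ f y Fin.≟ f y ⟫ * φ (f y))
          ≈⟨ sum-cong-≋ (λ y → trans (*-congʳ (⟪⟫-yes (f y Fin.≟ f y) ≡.refl)) (*-identityˡ _)) ⟩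
        sum (φ ∘ f) ∎

      -- The sum counts pairs with `f z ≡ f y`; injectivity of the matching leaves only the
      -- diagonal.
      sum-w² : (sum λ x → w x * w x) ≈ μ
      sum-w² = begin
        (sum λ x → w x * w x)
          ≈⟨ sum-w w ⟩
        (sum λ y → sum λ z → ⟪ f z Fin.≟ f y ⟫)
          ≈⟨ sum-cong-≋ (λ y → trans
               (sum-single (λ z → ⟪ f z Fin.≟ f y ⟫) y λ z z≢y →
                  ⟪⟫-no (f z Fin.≟ f y) (z≢y ∘ Injection.injective (proj₁ B⊆A)))
               (⟪⟫-yes (f y Fin.≟ f y) ≡.refl)) ⟩
        sum {M} (λ _ → 1#)
          ≈⟨ sum-replicate M ⟩
        μ ∎

      T : Carrier
      T = sum E

      sum-w-g : (sum λ x → w x * g x) ≈ μ * μ * T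
      sum-w-g = begin
        (sum λ x → w x * g x)
          ≈⟨ sum-w g ⟩
        (sum λ y → sum λ c → u c (f y))
          ≈⟨ ∑-comm (λ y c → u c (f y)) ⟩
        (sum λ c → sum λ y → sum λ z → K s (I c) (A (f y)) (b z))
          ≈⟨ sum-cong-≋ (λ c → sum-cong-≋ λ y → sum-cong-≋ λ z → product-cong λ j →
               reflexive (≡.cong (λ v → if does (j ∈? I c) then κ s j v (b z j) else 1#) (proj₂ B⊆A y j))) ⟩
        (sum λ c → sum λ y → sum λ z → K s (I c) (b y) (b z))
          ≈⟨ sum-cong-≋ sum-sum-K ⟩
        (sum λ c → μ * μ * E c)
          ≈⟨ *-distribˡ-sum (μ * μ) E ⟨
        μ * μ * T ∎

      sum-g² : (sum λ x → g x * g x) ≈ ν * (μ * μ) * T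
      sum-g² = begin
        (sum λ x → g x * g x)
          ≈⟨ sum-cong-≋ (λ x → sum-*-sum (λ c → u c x) (λ d → u d x)) ⟩
        (sum λ x → sum λ c → sum λ d → u c x * u d x)
          ≈⟨ ∑-comm (λ x c → sum λ d → u c x * u d x) ⟩
        (sum λ c → sum λ x → sum λ d → u c x * u d x)
          ≈⟨ sum-cong-≋ (λ c → ∑-comm (λ x d → u c x * u d x)) ⟩
        (sum λ c → sum λ d → sum λ x → u c x * u d x)
          ≈⟨ sum-cong-≋ (λ c → sum-single _ c (λ d → sum-u-u-distinct c d)) ⟩
        (sum λ c → sum λ x → u c x * u c x)
          ≈⟨ sum-cong-≋ sum-u² ⟩
        (sum λ c → ν * (μ * μ) * E c)
          ≈⟨ *-distribˡ-sum (ν * (μ * μ)) E ⟨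
        ν * (μ * μ) * T ∎

    -- |A| times the part of `w` orthogonal to the span; the scaling avoids a division.
    defect : Fin N → Carrier
    defect x = ν * w x - g x

    -- With the three sums `μ`, `μ * μ * T` and `ν * (μ * μ) * T` at hand, the last one cancels half
    -- of the cross term.
    sum-defect² : (sum λ x → defect x * defect x) ≈ ν * μ * (N · 1# - M · 1# * sum λ c → product (onSubset (I c) e))
    sum-defect² = begin
      (sum λ x → defect x * defect x)
        ≈⟨ sum-cong-≋ (λ x → solve 3 (λ ν w g → (ν :* w :- g) :* (ν :* w :- g) :=
             ν :* ν :* (w :* w) :+ (:- (con 𝟙 :+ con 𝟙) :* ν :* (w :* g) :+ g :* g)) refl ν (w x) (g x)) ⟩
      (sum λ x → ν * ν * (w x * w x) + (- (1# + 1#) * ν * (w x * g x) + g x * g x))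
        ≈⟨ trans (∑-distrib-+ (λ x → ν * ν * (w x * w x)) _) (+-congˡ (∑-distrib-+ (λ x → - (1# + 1#) * ν * (w x * g x)) (λ x → g x * g x))) ⟩
      (sum λ x → ν * ν * (w x * w x)) + ((sum λ x → - (1# + 1#) * ν * (w x * g x)) + (sum λ x → g x * g x))
        ≈⟨ +-cong (*-distribˡ-sum (ν * ν) (λ x → w x * w x)) (+-congʳ (*-distribˡ-sum (- (1# + 1#) * ν) (λ x → w x * g x))) ⟨
      ν * ν * (sum λ x → w x * w x) + (- (1# + 1#) * ν * (sum λ x → w x * g x) + (sum λ x → g x * g x))
        ≈⟨ +-cong (*-congˡ sum-w²) (+-cong (*-congˡ sum-w-g) sum-g²) ⟩
      ν * ν * μ + (- (1# + 1#) * ν * (μ * μ * T) + ν * (μ * μ) * T)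
        ≈⟨ solve 3 (λ ν μ T → ν :* ν :* μ :+ (:- (con 𝟙 :+ con 𝟙) :* ν :* (μ :* μ :* T) :+ ν :* (μ :* μ) :* T)
             := ν :* μ :* (ν :- μ :* T)) refl ν μ T ⟩
      ν * μ * (ν - μ * T) ∎

-- The size bound over the rationals

private
  module FS = FiniteSums ℚ.+-*-commutativeRing
  module LS = ListSums ℚ.+-*-commutativeRing
  module Be = Bessel ℚ.+-*-commutativeRing

-- Rational fractions are normalised when built, so the equation is checked on unnormalised ones.
fromℕℚ-suc : ∀ n → fromℕℚ (suc n) ≡ 1ℚ ℚ.+ fromℕℚ n
fromℕℚ-suc n = ℚ.toℚᵘ-injective (begin-equality
  ℚ.toℚᵘ (fromℕℚ (suc n))                 ≃⟨ ℚ.toℚᵘ-fromℚᵘ (mkℚᵘ (+ suc n) 0) ⟩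
  mkℚᵘ (+ suc n) 0                        ≃⟨ ℚᵘ.*≡* (≡.cong (ℤ._* + 1) (≡.sym (≡.cong (λ x → + 1 ℤ.+ x) (ℤ.*-identityʳ (+ n))))) ⟩
  ℚ.toℚᵘ 1ℚ ℚᵘ.+ mkℚᵘ (+ n) 0             ≃⟨ ℚᵘ.+-congʳ (ℚ.toℚᵘ 1ℚ) (ℚᵘ.≃-sym (ℚ.toℚᵘ-fromℚᵘ (mkℚᵘ (+ n) 0))) ⟩
  ℚ.toℚᵘ 1ℚ ℚᵘ.+ ℚ.toℚᵘ (fromℕℚ n)        ≃⟨ ℚ.toℚᵘ-homo-+ 1ℚ (fromℕℚ n) ⟨
  ℚ.toℚᵘ (1ℚ ℚ.+ fromℕℚ n)                ∎)
  where open ℚᵘ.≤-Reasoning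

·1≡fromℕℚ : ∀ n → n FS.· 1ℚ ≡ fromℕℚ n
·1≡fromℕℚ zero    = ≡.refl
·1≡fromℕℚ (suc n) = ≡.trans (≡.cong (1ℚ ℚ.+_) (·1≡fromℕℚ n)) (≡.sym (fromℕℚ-suc n))

fromℕℚ-positive : ∀ n .⦃ _ : NonZero n ⦄ → ℚ.Positive (fromℕℚ n)
fromℕℚ-positive n = ℚ.normalize-pos n 1

denominator*ratio : ∀ m n .⦃ _ : NonZero n ⦄ → fromℕℚ n ℚ.* (+ m ℚ./ n) ≡ fromℕℚ m
denominator*ratio m (suc n-1) = ℚ.toℚᵘ-injective (begin-equality
  ℚ.toℚᵘ (fromℕℚ n ℚ.* (+ m ℚ./ n))             ≃⟨ ℚ.toℚᵘ-homo-* (fromℕℚ n) (+ m ℚ./ n) ⟩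
  ℚ.toℚᵘ (fromℕℚ n) ℚᵘ.* ℚ.toℚᵘ (+ m ℚ./ n)     ≃⟨ ℚᵘ.*-cong (ℚ.toℚᵘ-fromℚᵘ (mkℚᵘ (+ n) 0)) (ℚ.toℚᵘ-fromℚᵘ (mkℚᵘ (+ m) n-1)) ⟩
  mkℚᵘ (+ n) 0 ℚᵘ.* mkℚᵘ (+ m) n-1              ≃⟨ ℚᵘ.*≡* (≡.trans (ℤ.*-identityʳ _)
       (≡.trans (ℤ.*-comm (+ n) (+ m)) (≡.cong (λ d → + m ℤ.* (+ d)) (≡.sym (ℕ.*-identityˡ n))))) ⟩
  mkℚᵘ (+ m) 0                                  ≃⟨ ℚ.toℚᵘ-fromℚᵘ (mkℚᵘ (+ m) 0) ⟨
  ℚ.toℚᵘ (fromℕℚ m)                             ∎)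
  where
  open ℚᵘ.≤-Reasoning
  n = suc n-1

-- This is the hypothesis `r*e` on `e`, for `e = excess s r`.
denominator*excess : ∀ {k} (s r : Fin k → ℕ) .⦃ _ : ∀ {i} → NonZero (r i) ⦄ j →
  r j FS.· 1ℚ ℚ.* excess s r j ≡ s j FS.· 1ℚ ℚ.- r j FS.· 1ℚ
denominator*excess s r j = begin
  r j FS.· 1ℚ ℚ.* (ratio s r j ℚ.- 1ℚ)            ≡⟨ ≡.cong (ℚ._* excess s r j) (·1≡fromℕℚ (r j)) ⟩
  fromℕℚ (r j) ℚ.* (ratio s r j ℚ.- 1ℚ)           ≡⟨ ℚ.*-distribˡ-+ (fromℕℚ (r j)) (ratio s r j) (ℚ.- 1ℚ) ⟩
  fromℕℚ (r j) ℚ.* ratio s r j ℚ.+ fromℕℚ (r j) ℚ.* (ℚ.- 1ℚ)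
    ≡⟨ ≡.cong₂ ℚ._+_ (denominator*ratio (s j) (r j))
        (≡.trans (≡.sym (ℚ.neg-distribʳ-* (fromℕℚ (r j)) 1ℚ)) (≡.cong ℚ.-_ (ℚ.*-identityʳ (fromℕℚ (r j))))) ⟩
  fromℕℚ (s j) ℚ.- fromℕℚ (r j)                   ≡⟨ ≡.cong₂ ℚ._-_ (·1≡fromℕℚ (s j)) (·1≡fromℕℚ (r j)) ⟨
  s j FS.· 1ℚ ℚ.- r j FS.· 1ℚ                     ∎
  where open ≡.≡-Reasoning

0≤p*p : ∀ p → 0ℚ ℚ.≤ p ℚ.* p
0≤p*p p with ℚ.≤-total 0ℚ p
... | inj₁ 0≤p = ≡.subst (ℚ._≤ p ℚ.* p) (ℚ.*-zeroʳ p) (ℚ.*-monoˡ-≤-nonNeg p ⦃ ℚ.nonNegative 0≤p ⦄ 0≤p)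
... | inj₂ p≤0 = ≡.subst (ℚ._≤ p ℚ.* p) (ℚ.*-zeroʳ p) (ℚ.*-monoˡ-≤-nonPos p ⦃ ℚ.nonPositive p≤0 ⦄ p≤0)

0≤sum-squares : ∀ {n} (f : Fin n → ℚ) → 0ℚ ℚ.≤ FS.sum λ i → f i ℚ.* f i
0≤sum-squares {zero}  f = ℚ.≤-refl
0≤sum-squares {suc n} f = ℚ.+-mono-≤ (0≤p*p (f zero)) (0≤sum-squares (f ∘ suc))

0≤p-q⇒q≤p : ∀ p q → 0ℚ ℚ.≤ p ℚ.- q → q ℚ.≤ p
0≤p-q⇒q≤p p q 0≤p-q = begin
  q                     ≡⟨ ℚ.+-identityˡ q ⟨
  0ℚ ℚ.+ q              ≤⟨ ℚ.+-monoˡ-≤ q 0≤p-q ⟩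
  p ℚ.- q ℚ.+ q         ≡⟨ ℚ.+-assoc p (ℚ.- q) q ⟩
  p ℚ.+ (ℚ.- q ℚ.+ q)   ≡⟨ ≡.cong (p ℚ.+_) (ℚ.+-inverseˡ q) ⟩
  p ℚ.+ 0ℚ              ≡⟨ ℚ.+-identityʳ p ⟩
  p                     ∎
  where open ℚ.≤-Reasoning

module _ {n t : ℕ} (t≤k : t ℕ.≤ suc n) (s r : Fin (suc n) → ℕ)
         .⦃ s≢0 : ∀ {i} → NonZero (s i) ⦄ .⦃ r≢0 : ∀ {i} → NonZero (r i) ⦄
         (r≤s : ∀ i → r i ℕ.≤ s i) (N M : ℕ) .⦃ N≢0 : NonZero N ⦄ .⦃ M≢0 : NonZero M ⦄
         (A : Array N s) (B : Array M r)
         (A-OA : IsOA t A) (B-OA : IsOA t B) (B⊆A : Subarray r≤s B A) where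

  private
    family : List (Subset (suc n))
    family = filter (Small? t) (subsets (suc n))

    small : ∀ c → Small t (lookup family c)
    small c = proj₂ (List∈.∈-filter⁻ (Small? t) {xs = subsets (suc n)} (List∈.∈-lookup c))

    distinct : ∀ c d → c ≢ d → lookup family c ≢ lookup family d
    distinct = lookup-AllPairs (λ I≢J J≡I → I≢J (≡.sym J≡I)) (Unique.filter⁺ (Small? t) (subsets-unique (suc n)))

    F : Subset (suc n) → ℚ
    F I = FS.product (LS.onSubset I (excess s r))

    total : ℚ
    total = FS.sum λ c → F (lookup family c)

    defect² : ℚ
    defect² = fromℕℚ N ℚ.* fromℕℚ M ℚ.* (fromℕℚ N ℚ.- fromℕℚ M ℚ.* total)

    0≤defect² : 0ℚ ℚ.≤ defect²
    0≤defect² = ≡.subst (0ℚ ℚ.≤_)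
      (≡.trans (Be.sum-defect² t≤k r≤s A B A-OA B-OA B⊆A (excess s r) (denominator*excess s r)
                  (lookup family) small distinct)
               (≡.cong₂ (λ ν μ → ν ℚ.* μ ℚ.* (ν ℚ.- μ ℚ.* total)) (·1≡fromℕℚ N) (·1≡fromℕℚ M)))
      (0≤sum-squares (Be.defect t≤k r≤s A B A-OA B-OA B⊆A (excess s r) (denominator*excess s r)
                  (lookup family) small distinct))

  -- `defect²` equals a sum of squares and carries the positive factor |A||B|; cancelling it leaves
  -- the bound.
  size-bound : fromℕℚ M ℚ.* ∑ family (λ I → ∏∈ I (excess s r)) ℚ.≤ fromℕℚ N
  size-bound = ≡.subst (λ T → fromℕℚ M ℚ.* T ℚ.≤ fromℕℚ N) (≡.sym ∑≡total)
    (0≤p-q⇒q≤p (fromℕℚ N) (fromℕℚ M ℚ.* total)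
      (ℚ.*-cancelˡ-≤-pos (fromℕℚ N ℚ.* fromℕℚ M) (≡.subst (ℚ._≤ defect²) (≡.sym (ℚ.*-zeroʳ (fromℕℚ N ℚ.* fromℕℚ M))) 0≤defect²)))
    where
    instance
      NM-positive : ℚ.Positive (fromℕℚ N ℚ.* fromℕℚ M)
      NM-positive = ℚ.pos*pos⇒pos (fromℕℚ N) ⦃ fromℕℚ-positive N ⦄ (fromℕℚ M) ⦃ fromℕℚ-positive M ⦄

    ∑≡total : ∑ family (λ I → ∏∈ I (excess s r)) ≡ total
    ∑≡total = ≡.trans (LS.∑ˡ-cong family λ I → LS.∏ˡ∈-product I (excess s r)) (LS.∑ˡ-lookup family F)

  size-bound-even : 2 ∣ t → fromℕℚ N ℚ.≥ fromℕℚ M ℚ.* ∑ (upTo (suc ⌊ t /2⌋)) (λ i → ∑∏ i (excess s r))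
  size-bound-even 2∣t = ≡.subst (λ T → fromℕℚ M ℚ.* T ℚ.≤ fromℕℚ N) (LS.∑-Small-even t 2∣t (excess s r)) size-bound

  size-bound-odd : 2 ∤ t → fromℕℚ N ℚ.≥ fromℕℚ M ℚ.*
    (∑ (upTo (suc ⌊ t /2⌋)) (λ i → ∑∏ i (excess s r)) ℚ.+ excess s r zero ℚ.* ∑∏ ⌊ t /2⌋ (excess s r ∘ suc))
  size-bound-odd 2∤t = ≡.subst (λ T → fromℕℚ M ℚ.* T ℚ.≤ fromℕℚ N) (LS.∑-Small-odd t 2∤t (excess s r)) size-bound

-- Ordered fields and null sequences

module OrderedField {c ℓ₁ ℓ₂ ℓ₃ : Level} (ℝ : RealNumbers c ℓ₁ ℓ₂ ℓ₃) where
  private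
    module ℝ = RealNumbers ℝ

  ℝ-ring : CommutativeRing c ℓ₁
  ℝ-ring = HeytingCommutativeRing.commutativeRing ℝ.heytingCommutativeRing

  open CommutativeRing ℝ-ring hiding (zero)
  open SemiringMult semiring using (×-homo-+; ×1-homo-*)
  open IntegerSolver ℝ-ring
  open ℝ using (_<_; fromℕ; 1/_; #⇒invertible; invertible⇒#; #⇔<⊎>; 0<1; 0<fromℕ;
                +-monoˡ-<; *-positive; archimedean; _⟶_)
  open IsStrictPartialOrder ℝ.isStrictPartialOrder
    using (<-respˡ-≈; <-respʳ-≈) renaming (irrefl to <-irrefl; trans to <-trans; asym to <-asym)

  -- The order is not decidable, but its negation and ≈ are stable, so proofs of ⊥ may split cases classically.
  infix 4 _≤_
  _≤_ : Carrier → Carrier → Set ℓ₃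
  x ≤ y = ¬ (y < x)

  -- Tightness of apartness: elements that are not apart are equal, and apart elements are strictly
  -- ordered one way or the other.
  ≤-antisym : ∀ {x y} → x ≤ y → y ≤ x → x ≈ y
  ≤-antisym x≤y y≤x = proj₁ (ℝ.tight _ _) λ x#y → case (Equivalence.to #⇔<⊎> x#y)
    where
    case : _ → ⊥
    case (inj₁ x<y) = y≤x x<y
    case (inj₂ y<x) = x≤y y<x

  ≤-refl : ∀ {x} → x ≤ x
  ≤-refl = <-irrefl refl

  ≤-reflexive : ∀ {x y} → x ≈ y → x ≤ y
  ≤-reflexive x≈y = <-irrefl (sym x≈y)

  <⇒≤ : ∀ {x y} → x < y → x ≤ y
  <⇒≤ = <-asym

  -- Under the assumption `z < x`, a strict inequality `y < z` or `x < y` would contradict the other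
  -- hypothesis. Both hypotheses thus become equalities, and `z < x` is absurd.
  ≤-trans : ∀ {x y z} → x ≤ y → y ≤ z → x ≤ z
  ≤-trans x≤y y≤z z<x = <-irrefl refl (<-respˡ-≈ (sym y≈z) (<-respʳ-≈ x≈y z<x))
    where
    y≈z = ≤-antisym y≤z λ y<z → x≤y (<-trans y<z z<x)
    x≈y = ≤-antisym x≤y λ x<y → y≤z (<-trans z<x x<y)

  ≤-poset : Poset c ℓ₁ ℓ₃
  ≤-poset = record { _≤_ = _≤_ ; isPartialOrder = record
    { isPreorder = record { isEquivalence = isEquivalence ; reflexive = ≤-reflexive ; trans = ≤-trans }
    ; antisym = ≤-antisym } }

  open PartialOrderReasoning ≤-poset

  ≈-stable : ∀ {x y} → ¬ ¬ (x ≈ y) → x ≈ y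
  ≈-stable ¬¬x≈y = ≤-antisym (λ y<x → ¬¬x≈y λ x≈y → <-irrefl (sym x≈y) y<x) (λ x<y → ¬¬x≈y λ x≈y → <-irrefl x≈y x<y)

  +-monoˡ-≤ : ∀ {x y} z → x ≤ y → x + z ≤ y + z
  +-monoˡ-≤ {x} {y} z x≤y y+z<x+z = x≤y (<-respˡ-≈ (cancel y z) (<-respʳ-≈ (cancel x z) (+-monoˡ-< (- z) y+z<x+z)))
    where
    cancel : ∀ a b → a + b + - b ≈ a
    cancel = solve 2 (λ a b → a :+ b :+ :- b := a) refl

  +-monoʳ-≤ : ∀ {x y} z → x ≤ y → z + x ≤ z + y
  +-monoʳ-≤ {x} {y} z x≤y = begin
    z + x  ≈⟨ +-comm z x ⟩
    x + z  ≤⟨ +-monoˡ-≤ z x≤y ⟩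
    y + z  ≈⟨ +-comm y z ⟩
    z + y  ∎

  +-mono-≤ : ∀ {x y u v} → x ≤ y → u ≤ v → x + u ≤ y + v
  +-mono-≤ {x} {y} {u} {v} x≤y u≤v = ≤-trans (+-monoˡ-≤ u x≤y) (+-monoʳ-≤ y u≤v)

  0≤y-x⇒x≤y : ∀ {x y} → 0# ≤ y - x → x ≤ y
  0≤y-x⇒x≤y {x} {y} 0≤ = begin
    x          ≈⟨ +-identityˡ x ⟨
    0# + x     ≤⟨ +-monoˡ-≤ x 0≤ ⟩
    y - x + x  ≈⟨ solve 2 (λ x y → y :- x :+ x := y) refl x y ⟩
    y          ∎

  x≤y⇒0≤y-x : ∀ {x y} → x ≤ y → 0# ≤ y - x
  x≤y⇒0≤y-x {x} {y} x≤y = begin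
    0#     ≈⟨ -‿inverseʳ x ⟨
    x - x  ≤⟨ +-monoˡ-≤ (- x) x≤y ⟩
    y - x  ∎

  -- The goal is a negation, so cases may be split classically: a negative product has no zero
  -- factor, and a nonnegative nonzero factor cannot fail to be positive.
  0≤* : ∀ {x y} → 0# ≤ x → 0# ≤ y → 0# ≤ x * y
  0≤* {x} {y} 0≤x 0≤y xy<0 = x≉0 (≤-antisym (λ 0<x → y≉0 (≤-antisym (λ 0<y → <-asym xy<0 (*-positive 0<x 0<y)) 0≤y)) 0≤x)
    where
    x≉0 : ¬ (x ≈ 0#)
    x≉0 x≈0 = <-irrefl (trans (*-congʳ x≈0) (zeroˡ y)) xy<0
    y≉0 : ¬ (y ≈ 0#)
    y≉0 y≈0 = <-irrefl (trans (*-congˡ y≈0) (zeroʳ x)) xy<0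

  *-monoˡ-≤ : ∀ {x y z} → 0# ≤ z → x ≤ y → z * x ≤ z * y
  *-monoˡ-≤ {x} {y} {z} 0≤z x≤y = 0≤y-x⇒x≤y (begin
    0#             ≤⟨ 0≤* 0≤z (x≤y⇒0≤y-x x≤y) ⟩
    z * (y - x)    ≈⟨ solve 3 (λ x y z → z :* (y :- x) := z :* y :- z :* x) refl x y z ⟩
    z * y - z * x  ∎)

  0≤x+x⇒0≤x : ∀ {x} → 0# ≤ x + x → 0# ≤ x
  0≤x+x⇒0≤x {x} 0≤x+x x<0 = 0≤x+x (<-trans (+-monoˡ-< x x<0) (<-respˡ-≈ (sym (+-identityˡ x)) x<0))

  x+x≈0⇒x≈0 : ∀ {x} → x + x ≈ 0# → x ≈ 0#
  x+x≈0⇒x≈0 {x} x+x≈0 = ≤-antisym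
    (0≤y-x⇒x≤y (0≤x+x⇒0≤x (≤-reflexive (sym (trans (solve 1 (λ x → (con 𝟘 :- x) :+ (con 𝟘 :- x) := :- (x :+ x)) refl x)
      (trans (-‿cong x+x≈0) (solve 0 (:- con 𝟘 := con 𝟘) refl)))))))
    (0≤x+x⇒0≤x (≤-reflexive (sym x+x≈0)))

  0<-x : ∀ {x} → x < 0# → 0# < - x
  0<-x {x} x<0 = <-respˡ-≈ (-‿inverseʳ x) (<-respʳ-≈ (+-identityˡ (- x)) (+-monoˡ-< (- x) x<0))

  0≤x*x : ∀ x → 0# ≤ x * x
  0≤x*x x x²<0 = x≉0 (≤-antisym
    (λ 0<x → <-asym x²<0 (*-positive 0<x 0<x))
    (λ x<0 → <-asym x²<0 (<-respʳ-≈ (solve 1 (λ x → :- x :* :- x := x :* x) refl x) (*-positive (0<-x x<0) (0<-x x<0)))))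
    where
    x≉0 : ¬ (x ≈ 0#)
    x≉0 x≈0 = <-irrefl (trans (*-congʳ x≈0) (zeroˡ x)) x²<0

  x+y≈0⇒x≈0 : ∀ {x y} → 0# ≤ x → 0# ≤ y → x + y ≈ 0# → x ≈ 0#
  x+y≈0⇒x≈0 {x} {y} 0≤x 0≤y x+y≈0 = ≤-antisym (begin
    x       ≈⟨ +-identityʳ x ⟨
    x + 0#  ≤⟨ +-monoʳ-≤ x 0≤y ⟩
    x + y   ≈⟨ x+y≈0 ⟩
    0#      ∎) 0≤x

  -- A negated equality does not yield apartness constructively, so `x` cannot be inverted. Instead
  -- `y # 0#` would make `y` invertible and force `x ≈ 0#`.
  x*y≈0⇒y≈0 : ∀ {x y} → ¬ (x ≈ 0#) → x * y ≈ 0# → y ≈ 0#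
  x*y≈0⇒y≈0 {x} {y} x≉0 xy≈0 = proj₁ (ℝ.tight y 0#) λ y#0 →
    let y⁻¹ , _ , y*y⁻¹≈1 = #⇒invertible y#0 in x≉0 (begin-equality
      x                      ≈⟨ *-identityʳ x ⟨
      x * 1#                 ≈⟨ *-congˡ y*y⁻¹≈1 ⟨
      x * ((y - 0#) * y⁻¹)   ≈⟨ solve 3 (λ x y z → x :* ((y :- con 𝟘) :* z) := x :* y :* z) refl x y y⁻¹ ⟩
      x * y * y⁻¹            ≈⟨ *-congʳ xy≈0 ⟩
      0# * y⁻¹               ≈⟨ zeroˡ y⁻¹ ⟩
      0#                     ∎)

  x*x≈0⇒x≈0 : ∀ {x} → x * x ≈ 0# → x ≈ 0#
  x*x≈0⇒x≈0 x²≈0 = ≈-stable λ x≉0 → x≉0 (x*y≈0⇒y≈0 x≉0 x²≈0)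

  fromℕ-+ : ∀ m n → fromℕ (m ℕ.+ n) ≈ fromℕ m + fromℕ n
  fromℕ-+ = ×-homo-+ 1#

  fromℕ-* : ∀ m n → fromℕ (m ℕ.* n) ≈ fromℕ m * fromℕ n
  fromℕ-* = ×1-homo-*

  0≤fromℕ : ∀ n → 0# ≤ fromℕ n
  0≤fromℕ zero    = ≤-refl
  0≤fromℕ (suc n) = <⇒≤ (0<fromℕ (suc n))

  n*1/n : ∀ n .⦃ _ : NonZero n ⦄ → fromℕ n * 1/ n ≈ 1#
  n*1/n n = begin-equality
    fromℕ n * 1/ n            ≈⟨ *-congʳ (solve 1 (λ a → a := a :- con 𝟘) refl (fromℕ n)) ⟩
    (fromℕ n - 0#) * 1/ n     ≈⟨ proj₂ (proj₂ (#⇒invertible (Equivalence.from #⇔<⊎> (inj₂ (0<fromℕ n))))) ⟩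
    1#                        ∎

  0<1/n : ∀ n .⦃ _ : NonZero n ⦄ → 0# < 1/ n
  0<1/n n = positive (Equivalence.to #⇔<⊎> (invertible⇒# ((fromℕ n) , inverse₁ , inverse₂)))
    where
    inverse₁ : fromℕ n * (1/ n - 0#) ≈ 1#
    inverse₁ = trans (*-congˡ (solve 1 (λ a → a :- con 𝟘 := a) refl (1/ n))) (n*1/n n)
    inverse₂ : (1/ n - 0#) * fromℕ n ≈ 1#
    inverse₂ = trans (*-comm _ _) inverse₁
    positive : 1/ n < 0# ⊎ 0# < 1/ n → 0# < 1/ n
    positive (inj₂ 0<1/n) = 0<1/n
    positive (inj₁ 1/n<0) = ⊥-elim (<-asym 0<1 1<0)
      where
      0<-1 : 0# < - 1#
      0<-1 = <-respʳ-≈ (trans (solve 2 (λ a b → a :* :- b := :- (a :* b)) refl (fromℕ n) (1/ n)) (-‿cong (n*1/n n)))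
               (*-positive (0<fromℕ n) (0<-x 1/n<0))
      1<0 : 1# < 0#
      1<0 = <-respˡ-≈ (+-identityˡ 1#) (<-respʳ-≈ (-‿inverseˡ 1#) (+-monoˡ-< 1# 0<-1))

  infix 4 ∣_∣≤_
  -- An absolute value by cases would require a decidable order; the two one-sided bounds replace
  -- it.
  ∣_∣≤_ : Carrier → Carrier → Set ℓ₃
  ∣ x ∣≤ b = x ≤ b × - x ≤ b

  ∣∣≤-resp : ∀ {x y b d} → x ≈ y → b ≈ d → ∣ x ∣≤ b → ∣ y ∣≤ d
  ∣∣≤-resp x≈y b≈d (x≤b , -x≤b) =
    ≤-trans (≤-reflexive (sym x≈y)) (≤-trans x≤b (≤-reflexive b≈d)) ,
    ≤-trans (≤-reflexive (-‿cong (sym x≈y))) (≤-trans -x≤b (≤-reflexive b≈d))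

  ∣∣≤-weaken : ∀ {x b d} → b ≤ d → ∣ x ∣≤ b → ∣ x ∣≤ d
  ∣∣≤-weaken b≤d (x≤b , -x≤b) = ≤-trans x≤b b≤d , ≤-trans -x≤b b≤d

  ∣∣≤-+ : ∀ {x y b d} → ∣ x ∣≤ b → ∣ y ∣≤ d → ∣ x + y ∣≤ b + d
  ∣∣≤-+ {x} {y} (x≤b , -x≤b) (y≤d , -y≤d) =
    +-mono-≤ x≤b y≤d ,
    ≤-trans (≤-reflexive (solve 2 (λ x y → :- (x :+ y) := :- x :+ :- y) refl x y)) (+-mono-≤ -x≤b -y≤d)

  ∣∣≤-neg : ∀ {x b} → ∣ x ∣≤ b → ∣ - x ∣≤ b
  ∣∣≤-neg {x} (x≤b , -x≤b) = -x≤b , ≤-trans (≤-reflexive (solve 1 (λ x → :- :- x := x) refl x)) x≤b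

  0≤x⇒∣x∣≤x : ∀ {x} → 0# ≤ x → ∣ x ∣≤ x
  0≤x⇒∣x∣≤x {x} 0≤x = ≤-refl , 0≤y-x⇒x≤y (begin
    0#        ≤⟨ 0≤x ⟩
    x         ≈⟨ +-identityʳ x ⟨
    x + 0#    ≤⟨ +-monoʳ-≤ x 0≤x ⟩
    x + x     ≈⟨ solve 1 (λ x → x :+ x := x :- :- x) refl x ⟩
    x - - x   ∎)

  ∣0∣≤ : ∀ {b} → 0# ≤ b → ∣ 0# ∣≤ b
  ∣0∣≤ 0≤b = ∣∣≤-weaken 0≤b (0≤x⇒∣x∣≤x ≤-refl)

  ∣∣≤-* : ∀ {x y b d} → ∣ x ∣≤ b → ∣ y ∣≤ d → ∣ x * y ∣≤ b * d
  ∣∣≤-* {x} {y} {b} {d} ∣x∣≤b ∣y∣≤d =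
    x*y≤ ∣x∣≤b ∣y∣≤d ,
    ≤-trans (≤-reflexive (solve 2 (λ x y → :- (x :* y) := :- x :* y) refl x y)) (x*y≤ (∣∣≤-neg ∣x∣≤b) ∣y∣≤d)
    where
    -- 2 (b d - x y) = (b - x) (d + y) + (b + x) (d - y)
    x*y≤ : ∀ {x} → ∣ x ∣≤ b → ∣ y ∣≤ d → x * y ≤ b * d
    x*y≤ {x} (x≤b , -x≤b) (y≤d , -y≤d) = 0≤y-x⇒x≤y (0≤x+x⇒0≤x (begin
      0#                                            ≈⟨ +-identityˡ 0# ⟨
      0# + 0#                                       ≤⟨ +-mono-≤ (0≤* (x≤y⇒0≤y-x x≤b) (x≤y⇒0≤y-x -y≤d))
                                                                (0≤* (x≤y⇒0≤y-x -x≤b) (x≤y⇒0≤y-x y≤d)) ⟩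
      (b - x) * (d - - y) + (b - - x) * (d - y)     ≈⟨ solve 4 (λ x y b d →
           (b :- x) :* (d :- :- y) :+ (b :- :- x) :* (d :- y) := (b :* d :- x :* y) :+ (b :* d :- x :* y)) refl x y b d ⟩
      (b * d - x * y) + (b * d - x * y)             ∎))

  -- The bound is a successor so that `Null-scale` can divide ε by it.
  bounded : ∀ x → ∃ λ m → ∣ x ∣≤ fromℕ (suc m)
  bounded x =
    let m , x<m = archimedean x
        n , -x<n = archimedean (- x)
    in m ℕ.+ n ,
       ≤-trans (<⇒≤ x<m) (≤-trans (fromℕ-mono-≤ (ℕ.m≤m+n m n)) (fromℕ-mono-≤ (ℕ.n≤1+n (m ℕ.+ n)))) ,
       ≤-trans (<⇒≤ -x<n) (≤-trans (fromℕ-mono-≤ (ℕ.m≤n+m n m)) (fromℕ-mono-≤ (ℕ.n≤1+n (m ℕ.+ n))))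
    where
    fromℕ-mono-≤ : ∀ {m n} → m ℕ.≤ n → fromℕ m ≤ fromℕ n
    fromℕ-mono-≤ {n = n} ℕ.z≤n = 0≤fromℕ n
    fromℕ-mono-≤ (ℕ.s≤s m≤n) = +-monoʳ-≤ 1# (fromℕ-mono-≤ m≤n)

  Null : (ℕ → Carrier) → Set (c ⊔ ℓ₃)
  Null u = ∀ ε → 0# < ε → ∃ λ K → ∀ n → K ℕ.≤ n → ∣ u n ∣≤ ε

  0<ε/n : ∀ {ε} n .⦃ _ : NonZero n ⦄ → 0# < ε → 0# < ε * 1/ n
  0<ε/n n 0<ε = *-positive 0<ε (0<1/n n)

  n*ε/n : ∀ ε n .⦃ _ : NonZero n ⦄ → fromℕ n * (ε * 1/ n) ≈ ε
  n*ε/n ε n = begin-equality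
    fromℕ n * (ε * 1/ n)    ≈⟨ solve 3 (λ a b c → a :* (b :* c) := b :* (a :* c)) refl (fromℕ n) ε (1/ n) ⟩
    ε * (fromℕ n * 1/ n)    ≈⟨ *-congˡ (n*1/n n) ⟩
    ε * 1#                  ≈⟨ *-identityʳ ε ⟩
    ε                       ∎

  ε/2+ε/2 : ∀ ε → ε * 1/ 2 + ε * 1/ 2 ≈ ε
  ε/2+ε/2 ε = trans (solve 1 (λ a → a :+ a := (con 𝟙 :+ (con 𝟙 :+ con 𝟘)) :* a) refl (ε * 1/ 2)) (n*ε/n ε 2)

  ⟶⇒Null : ∀ {u l} → u ⟶ l → Null (λ n → u n - l)
  ⟶⇒Null {u} {l} u⟶l ε 0<ε =
    let K , close = u⟶l ε 0<ε
    in K , λ n K≤n → <⇒≤ (proj₁ (close n K≤n)) ,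
         ≤-trans (≤-reflexive (solve 2 (λ u l → :- (u :- l) := l :- u) refl (u n) l)) (<⇒≤ (proj₂ (close n K≤n)))

  Null-resp : ∀ {u v} → (∀ n → u n ≈ v n) → Null u → Null v
  Null-resp u≈v Nu ε 0<ε = let K , small = Nu ε 0<ε in K , λ n K≤n → ∣∣≤-resp (u≈v n) refl (small n K≤n)

  Null-+ : ∀ {u v} → Null u → Null v → Null (λ n → u n + v n)
  Null-+ Nu Nv ε 0<ε =
    let K , u-small = Nu (ε * 1/ 2) (0<ε/n 2 0<ε)
        L , v-small = Nv (ε * 1/ 2) (0<ε/n 2 0<ε)
    in K ℕ.⊔ L , λ n K⊔L≤n → ∣∣≤-resp refl (ε/2+ε/2 ε)
         (∣∣≤-+ (u-small n (ℕ.≤-trans (ℕ.m≤m⊔n K L) K⊔L≤n)) (v-small n (ℕ.≤-trans (ℕ.m≤n⊔m K L) K⊔L≤n)))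

  Null-neg : ∀ {u} → Null u → Null (λ n → - u n)
  Null-neg Nu ε 0<ε = let K , small = Nu ε 0<ε in K , λ n K≤n → ∣∣≤-neg (small n K≤n)

  Null-scale : ∀ x {u} → Null u → Null (λ n → x * u n)
  Null-scale x Nu ε 0<ε =
    let m , ∣x∣≤m = bounded x
        K , small = Nu (ε * 1/ suc m) (0<ε/n (suc m) 0<ε)
    in K , λ n K≤n → ∣∣≤-resp refl (n*ε/n ε (suc m)) (∣∣≤-* ∣x∣≤m (small n K≤n))

  Null-* : ∀ {u v} → Null u → Null v → Null (λ n → u n * v n)
  Null-* Nu Nv ε 0<ε =
    let K , u-small = Nu ε 0<ε
        L , v-small = Nv 1# 0<1
    in K ℕ.⊔ L , λ n K⊔L≤n → ∣∣≤-resp refl (*-identityʳ ε)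
         (∣∣≤-* (u-small n (ℕ.≤-trans (ℕ.m≤m⊔n K L) K⊔L≤n)) (v-small n (ℕ.≤-trans (ℕ.m≤n⊔m K L) K⊔L≤n)))

  Null-subsequence : ∀ {u} (φ : ℕ → ℕ) → (∀ n → n ℕ.≤ φ n) → Null u → Null (u ∘ φ)
  Null-subsequence φ n≤φn Nu ε 0<ε = let K , small = Nu ε 0<ε in K , λ n K≤n → small (φ n) (ℕ.≤-trans K≤n (n≤φn n))

  Null-dominated : ∀ {u v} → (∀ n → ∣ u n ∣≤ v n) → Null v → Null u
  Null-dominated ∣u∣≤v Nv ε 0<ε =
    let K , small = Nv ε 0<ε in K , λ n K≤n → ∣∣≤-weaken (proj₁ (small n K≤n)) (∣u∣≤v n)

  -- If `x` were positive, ε = x/2 would give x ≤ x/2; if negative, the same applies to `- x`.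
  Null-const : ∀ {x} → Null (λ _ → x) → x ≈ 0#
  Null-const {x} Nx = ≤-antisym
    (λ 0<x → x≰x/2 0<x (proj₁ (x-small 0<x)))
    (λ x<0 → x≰x/2 (0<-x x<0) (proj₂ (-x-small x<0)))
    where
    x-small : 0# < x → ∣ x ∣≤ x * 1/ 2
    x-small 0<x = let K , small = Nx (x * 1/ 2) (0<ε/n 2 0<x) in small K ℕ.≤-refl
    -x-small : x < 0# → ∣ x ∣≤ - x * 1/ 2
    -x-small x<0 = let K , small = Nx (- x * 1/ 2) (0<ε/n 2 (0<-x x<0)) in small K ℕ.≤-refl
    x≰x/2 : ∀ {y} → 0# < y → ¬ (y ≤ y * 1/ 2)
    x≰x/2 {y} 0<y y≤y/2 = y≤y/2 (<-respˡ-≈ (+-identityˡ _) (<-respʳ-≈ (ε/2+ε/2 y) (+-monoˡ-< (y * 1/ 2) (0<ε/n 2 0<y))))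

-- The exponential function on the imaginary axis

module PrefixSums {c ℓ : Level} (R : CommutativeRing c ℓ) where
  open CommutativeRing R hiding (zero)
  open FiniteSums R
  open SetoidReasoning setoid

  ∑< : ℕ → (ℕ → Carrier) → Carrier
  ∑< n F = sum {n} λ i → F (toℕ i)

  ∑<-cong : ∀ n {F G : ℕ → Carrier} → (∀ i → i ℕ.< n → F i ≈ G i) → ∑< n F ≈ ∑< n G
  ∑<-cong n F≈G = sum-cong-≋ {n} λ i → F≈G (toℕ i) (Fin.toℕ<n i)

  ∑<-last : ∀ n F → ∑< (suc n) F ≈ ∑< n F + F n
  ∑<-last zero    F = trans (+-identityʳ (F 0)) (sym (+-identityˡ (F 0)))
  ∑<-last (suc n) F = trans (+-congˡ (∑<-last n (F ∘ suc))) (sym (+-assoc _ _ _))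

  ∑<-+ : ∀ n F G → ∑< n (λ i → F i + G i) ≈ ∑< n F + ∑< n G
  ∑<-+ n F G = ∑-distrib-+ {n} (F ∘ toℕ) (G ∘ toℕ)

  ∑<-*ˡ : ∀ n x F → ∑< n (λ i → x * F i) ≈ x * ∑< n F
  ∑<-*ˡ n x F = sym (*-distribˡ-sum {n} x (F ∘ toℕ))

  ∑<-*ʳ : ∀ n x F → ∑< n (λ i → F i * x) ≈ ∑< n F * x
  ∑<-*ʳ n x F = sym (*-distribʳ-sum {n} x (F ∘ toℕ))

-- The algebra of the Cauchy product is needed twice, for the complex series and for the real series
-- that dominates it. This interface lets it be proved once.
record ReciprocalFactorials {c ℓ : Level} (R : CommutativeRing c ℓ) : Set (c ⊔ ℓ) where
  open CommutativeRing R hiding (zero)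
  open FiniteSums R using (_·_)
  field
    1/!            : ℕ → Carrier
    1/!-zero       : 1/! 0 ≈ 1#
    1/!-suc        : ∀ n → suc n · 1# * 1/! (suc n) ≈ 1/! n
    1/suc          : ℕ → Carrier
    1/suc-inverse  : ∀ n → 1/suc n * (suc n · 1#) ≈ 1#

module ExponentialSeries {c ℓ : Level} (R : CommutativeRing c ℓ) (F : ReciprocalFactorials R) where
  open CommutativeRing R hiding (zero)
  open RawSemiringDefs (Semiring.rawSemiring semiring) using (_^_)
  open FiniteSums R
  open PrefixSums R
  open ReciprocalFactorials F
  open IntegerSolver R
  open SemiringMult semiring using (×-homo-+)
  open SetoidReasoning setoid

  term : Carrier → ℕ → Carrier
  term z n = 1/! n * z ^ n

  partialSum : Carrier → ℕ → Carrier
  partialSum z n = ∑< n (term z)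

  term-suc : ∀ z n → suc n · 1# * term z (suc n) ≈ z * term z n
  term-suc z n = begin
    suc n · 1# * (1/! (suc n) * (z * z ^ n))   ≈⟨ solve 4 (λ a b z y → a :* (b :* (z :* y)) := z :* (a :* b :* y)) refl _ _ z (z ^ n) ⟩
    z * (suc n · 1# * 1/! (suc n) * z ^ n)     ≈⟨ *-congˡ (*-congʳ (1/!-suc n)) ⟩
    z * (1/! n * z ^ n)                        ∎

  convolution : Carrier → Carrier → ℕ → Carrier
  convolution z w n = ∑< (suc n) λ i → term z i * term w (n ∸ i)

  -- Leibniz rule: the weight `suc n` splits as `i` plus `suc n ∸ i`, and each part lowers the index
  -- of one factor. The convolution thus obeys the recurrence of `term (z + w)`, and no binomial
  -- coefficients occur.
  convolution-suc : ∀ z w n → suc n · 1# * convolution z w (suc n) ≈ (z + w) * convolution z w n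
  convolution-suc z w n = begin
    suc n · 1# * convolution z w (suc n)
      ≈⟨ ∑<-*ˡ (suc (suc n)) (suc n · 1#) (λ i → term z i * term w (suc n ∸ i)) ⟨
    ∑< (suc (suc n)) (λ i → suc n · 1# * (term z i * term w (suc n ∸ i)))
      ≈⟨ ∑<-cong (suc (suc n)) (λ i i<2+n → leibniz i (ℕ.≤-pred i<2+n)) ⟩
    ∑< (suc (suc n)) (λ i → left i + right i)
      ≈⟨ ∑<-+ (suc (suc n)) left right ⟩
    ∑< (suc (suc n)) left + ∑< (suc (suc n)) right
      ≈⟨ +-cong ∑left ∑right ⟩
    z * convolution z w n + w * convolution z w n
      ≈⟨ distribʳ _ z w ⟨
    (z + w) * convolution z w n ∎
    where
    left right : ℕ → Carrier
    left i  = i · 1# * term z i * term w (suc n ∸ i)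
    right i = term z i * ((suc n ∸ i) · 1# * term w (suc n ∸ i))

    leibniz : ∀ i → i ℕ.≤ suc n → suc n · 1# * (term z i * term w (suc n ∸ i)) ≈ left i + right i
    leibniz i i≤1+n = begin
      suc n · 1# * (term z i * term w (suc n ∸ i))
        ≡⟨ ≡.cong (λ m → m · 1# * (term z i * term w (suc n ∸ i))) (ℕ.m+[n∸m]≡n i≤1+n) ⟨
      (i ℕ.+ (suc n ∸ i)) · 1# * (term z i * term w (suc n ∸ i))
        ≈⟨ *-congʳ (×-homo-+ 1# i (suc n ∸ i)) ⟩
      (i · 1# + (suc n ∸ i) · 1#) * (term z i * term w (suc n ∸ i))
        ≈⟨ solve 4 (λ a b x y → (a :+ b) :* (x :* y) := a :* x :* y :+ x :* (b :* y)) refl _ _ _ _ ⟩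
      left i + right i ∎

    ∑left : ∑< (suc (suc n)) left ≈ z * convolution z w n
    ∑left = begin
      0# * term z 0 * term w (suc n) + ∑< (suc n) (left ∘ suc)
        ≈⟨ +-cong (trans (*-congʳ (zeroˡ _)) (zeroˡ _))
             (∑<-cong (suc n) λ i _ → trans (*-congʳ (term-suc z i)) (*-assoc z (term z i) (term w (n ∸ i)))) ⟩
      0# + ∑< (suc n) (λ i → z * (term z i * term w (n ∸ i)))
        ≈⟨ +-identityˡ _ ⟩
      ∑< (suc n) (λ i → z * (term z i * term w (n ∸ i)))
        ≈⟨ ∑<-*ˡ (suc n) z (λ i → term z i * term w (n ∸ i)) ⟩
      z * convolution z w n ∎

    right-suc : ∀ i → i ℕ.< suc n → right i ≈ w * (term z i * term w (n ∸ i))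
    right-suc i i<1+n = begin
      term z i * ((suc n ∸ i) · 1# * term w (suc n ∸ i))
        ≡⟨ ≡.cong (λ m → term z i * (m · 1# * term w m)) (ℕ.+-∸-assoc 1 (ℕ.≤-pred i<1+n)) ⟩
      term z i * (suc (n ∸ i) · 1# * term w (suc (n ∸ i)))
        ≈⟨ *-congˡ (term-suc w (n ∸ i)) ⟩
      term z i * (w * term w (n ∸ i))
        ≈⟨ solve 3 (λ a b c → a :* (b :* c) := b :* (a :* c)) refl _ _ _ ⟩
      w * (term z i * term w (n ∸ i)) ∎

    ∑right : ∑< (suc (suc n)) right ≈ w * convolution z w n
    ∑right = begin
      ∑< (suc (suc n)) right
        ≈⟨ ∑<-last (suc n) right ⟩
      ∑< (suc n) right + right (suc n)
        ≈⟨ +-cong (∑<-cong (suc n) right-suc) (begin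
             right (suc n)                  ≡⟨ ≡.cong (λ m → term z (suc n) * (m · 1# * term w m)) (ℕ.n∸n≡0 n) ⟩
             term z (suc n) * (0# * term w 0)   ≈⟨ trans (*-congˡ (zeroˡ _)) (zeroʳ _) ⟩
             0#                             ∎) ⟩
      ∑< (suc n) (λ i → w * (term z i * term w (n ∸ i))) + 0#
        ≈⟨ +-identityʳ _ ⟩
      ∑< (suc n) (λ i → w * (term z i * term w (n ∸ i)))
        ≈⟨ ∑<-*ˡ (suc n) w (λ i → term z i * term w (n ∸ i)) ⟩
      w * convolution z w n ∎

  term-+ : ∀ z w n → term (z + w) n ≈ convolution z w n
  term-+ z w zero = begin
    1/! 0 * 1#                         ≈⟨ *-cong 1/!-zero refl ⟩
    1# * 1#                            ≈⟨ solve 0 (con 𝟙 :* con 𝟙 := con 𝟙 :* con 𝟙 :* (con 𝟙 :* con 𝟙) :+ con 𝟘) refl ⟩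
    1# * 1# * (1# * 1#) + 0#           ≈⟨ +-congʳ (*-cong (*-congʳ 1/!-zero) (*-congʳ 1/!-zero)) ⟨
    1/! 0 * 1# * (1/! 0 * 1#) + 0#     ∎
  term-+ z w (suc n) = begin
    term (z + w) (suc n)                               ≈⟨ cancel _ ⟨
    1/suc n * (suc n · 1# * term (z + w) (suc n))      ≈⟨ *-congˡ (term-suc (z + w) n) ⟩
    1/suc n * ((z + w) * term (z + w) n)               ≈⟨ *-congˡ (*-congˡ (term-+ z w n)) ⟩
    1/suc n * ((z + w) * convolution z w n)            ≈⟨ *-congˡ (convolution-suc z w n) ⟨
    1/suc n * (suc n · 1# * convolution z w (suc n))   ≈⟨ cancel _ ⟩
    convolution z w (suc n)                            ∎
    where
    cancel : ∀ x → 1/suc n * (suc n · 1# * x) ≈ x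
    cancel x = trans (sym (*-assoc _ _ x)) (trans (*-congʳ (1/suc-inverse n)) (*-identityˡ x))

  -- The right side is the sum over the triangle i + j < n, arranged by `i`; each induction step
  -- adds one diagonal.
  partialSum-+ : ∀ z w n → partialSum (z + w) n ≈ ∑< n λ i → term z i * partialSum w (n ∸ i)
  partialSum-+ z w zero    = refl
  partialSum-+ z w (suc n) = begin
    partialSum (z + w) (suc n)
      ≈⟨ ∑<-last n (term (z + w)) ⟩
    partialSum (z + w) n + term (z + w) n
      ≈⟨ +-cong (partialSum-+ z w n) (term-+ z w n) ⟩
    ∑< n (triangle n) + ∑< (suc n) (λ i → term z i * term w (n ∸ i))
      -- `triangle n n` contains an empty partial sum. Adding it gives both sums the range i < suc
      -- n.
      ≈⟨ +-congʳ (begin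
           ∑< n (triangle n) + triangle n n   ≈⟨ +-congˡ (begin
             term z n * partialSum w (n ∸ n)    ≡⟨ ≡.cong (λ m → term z n * partialSum w m) (ℕ.n∸n≡0 n) ⟩
             term z n * 0#                      ≈⟨ zeroʳ _ ⟩
             0#                                 ∎) ⟩
           ∑< n (triangle n) + 0#             ≈⟨ +-identityʳ _ ⟩
           ∑< n (triangle n)                  ∎) ⟨
    ∑< n (triangle n) + triangle n n + ∑< (suc n) (λ i → term z i * term w (n ∸ i))
      ≈⟨ +-congʳ (∑<-last n (triangle n)) ⟨
    ∑< (suc n) (triangle n) + ∑< (suc n) (λ i → term z i * term w (n ∸ i))
      ≈⟨ ∑<-+ (suc n) (triangle n) (λ i → term z i * term w (n ∸ i)) ⟨
    ∑< (suc n) (λ i → triangle n i + term z i * term w (n ∸ i))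
      ≈⟨ ∑<-cong (suc n) (λ i i<1+n → begin
           triangle n i + term z i * term w (n ∸ i)
             ≈⟨ distribˡ _ _ _ ⟨
           term z i * (partialSum w (n ∸ i) + term w (n ∸ i))
             ≈⟨ *-congˡ (∑<-last (n ∸ i) (term w)) ⟨
           term z i * partialSum w (suc (n ∸ i))
             ≡⟨ ≡.cong (λ m → term z i * partialSum w m) (ℕ.+-∸-assoc 1 (ℕ.≤-pred i<1+n)) ⟨
           triangle (suc n) i ∎) ⟩
    ∑< (suc n) (triangle (suc n)) ∎
    where
    triangle : ℕ → ℕ → Carrier
    triangle n i = term z i * partialSum w (n ∸ i)

  -- Removing the triangle i + j < n from the square i, j < n leaves, for each `i`, a tail block of
  -- the series of `w`.
  square-triangle : ∀ z w n → partialSum z n * partialSum w n - partialSum (z + w) n ≈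
                    ∑< n λ i → term z i * (partialSum w n - partialSum w (n ∸ i))
  square-triangle z w n = begin
    partialSum z n * partialSum w n - partialSum (z + w) n
      ≈⟨ +-cong (sym (∑<-*ʳ n (partialSum w n) (term z))) (-‿cong (partialSum-+ z w n)) ⟩
    ∑< n (λ i → term z i * partialSum w n) - ∑< n triangle
      ≈⟨ +-congˡ (solve 1 (λ x → :- x := :- con 𝟙 :* x) refl _) ⟩
    ∑< n (λ i → term z i * partialSum w n) + - 1# * ∑< n triangle
      ≈⟨ +-congˡ (∑<-*ˡ n (- 1#) triangle) ⟨
    ∑< n (λ i → term z i * partialSum w n) + ∑< n (λ i → - 1# * triangle i)
      ≈⟨ ∑<-+ n (λ i → term z i * partialSum w n) (λ i → - 1# * triangle i) ⟨
    ∑< n (λ i → term z i * partialSum w n + - 1# * triangle i)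
      ≈⟨ ∑<-cong n (λ i _ → solve 3 (λ a b c → a :* b :+ :- con 𝟙 :* (a :* c) := a :* (b :- c)) refl
           (term z i) (partialSum w n) (partialSum w (n ∸ i))) ⟩
    ∑< n (λ i → term z i * (partialSum w n - partialSum w (n ∸ i))) ∎
    where
    triangle : ℕ → Carrier
    triangle i = term z i * partialSum w (n ∸ i)

-- Complex arithmetic, conjugation and cancellation

module ComplexField {c ℓ₁ ℓ₂ ℓ₃ : Level} (ℝ : RealNumbers c ℓ₁ ℓ₂ ℓ₃) where
  open OrderedField ℝ using (ℝ-ring; x*x≈0⇒x≈0; x+y≈0⇒x≈0; 0≤x*x; x*y≈0⇒y≈0; ≈-stable)
  open Complex ℝ
  private
    module ℝ = RealNumbers ℝ
    module R = CommutativeRing ℝ-ring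
    module S = IntegerSolver ℝ-ring
    open S using (solve; _:=_; _:+_; _:*_; :-_; _:-_; con; 𝟘; 𝟙)

  ℂ-ring : CommutativeRing c ℓ₁
  ℂ-ring = record
    { RawRing ℂ-rawRing
    ; isCommutativeRing = record
      { isRing = record
        { +-isAbelianGroup = record
          { isGroup = record
            { isMonoid = record
              { isSemigroup = record
                { isMagma = record
                  { isEquivalence = record
                    { refl = R.refl , R.refl
                    ; sym = λ (p , q) → R.sym p , R.sym q
                    ; trans = λ (p , q) (p′ , q′) → R.trans p p′ , R.trans q q′ }
                  ; ∙-cong = λ (p , q) (p′ , q′) → R.+-cong p p′ , R.+-cong q q′ }
                ; assoc = λ z w v → R.+-assoc _ _ _ , R.+-assoc _ _ _ }
              ; identity = (λ z → R.+-identityˡ _ , R.+-identityˡ _) , (λ z → R.+-identityʳ _ , R.+-identityʳ _) }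
            ; inverse = (λ z → R.-‿inverseˡ _ , R.-‿inverseˡ _) , (λ z → R.-‿inverseʳ _ , R.-‿inverseʳ _)
            ; ⁻¹-cong = λ (p , q) → R.-‿cong p , R.-‿cong q }
          ; comm = λ z w → R.+-comm _ _ , R.+-comm _ _ }
        ; *-cong = λ (p , q) (p′ , q′) →
            R.+-cong (R.*-cong p p′) (R.-‿cong (R.*-cong q q′)) , R.+-cong (R.*-cong p q′) (R.*-cong q p′)
        ; *-assoc = λ z w v →
            solve 6 (λ a b c d e f → (a :* c :- b :* d) :* e :- (a :* d :+ b :* c) :* f :=
                                     a :* (c :* e :- d :* f) :- b :* (c :* f :+ d :* e)) R.refl
              (re z) (im z) (re w) (im w) (re v) (im v) ,
            solve 6 (λ a b c d e f → (a :* c :- b :* d) :* f :+ (a :* d :+ b :* c) :* e :=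
                                     a :* (c :* f :+ d :* e) :+ b :* (c :* e :- d :* f)) R.refl
              (re z) (im z) (re w) (im w) (re v) (im v)
        ; *-identity =
            (λ z → solve 2 (λ a b → con 𝟙 :* a :- con 𝟘 :* b := a) R.refl (re z) (im z) ,
                   solve 2 (λ a b → con 𝟙 :* b :+ con 𝟘 :* a := b) R.refl (re z) (im z)) ,
            (λ z → solve 2 (λ a b → a :* con 𝟙 :- b :* con 𝟘 := a) R.refl (re z) (im z) ,
                   solve 2 (λ a b → a :* con 𝟘 :+ b :* con 𝟙 := b) R.refl (re z) (im z))
        ; distrib =
            (λ z w v →
              solve 6 (λ a b c d e f → a :* (c :+ e) :- b :* (d :+ f) := (a :* c :- b :* d) :+ (a :* e :- b :* f)) R.refl
                (re z) (im z) (re w) (im w) (re v) (im v) ,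
              solve 6 (λ a b c d e f → a :* (d :+ f) :+ b :* (c :+ e) := (a :* d :+ b :* c) :+ (a :* f :+ b :* e)) R.refl
                (re z) (im z) (re w) (im w) (re v) (im v)) ,
            (λ z w v →
              solve 6 (λ a b c d e f → (c :+ e) :* a :- (d :+ f) :* b := (c :* a :- d :* b) :+ (e :* a :- f :* b)) R.refl
                (re z) (im z) (re w) (im w) (re v) (im v) ,
              solve 6 (λ a b c d e f → (c :+ e) :* b :+ (d :+ f) :* a := (c :* b :+ d :* a) :+ (e :* b :+ f :* a)) R.refl
                (re z) (im z) (re w) (im w) (re v) (im v)) }
      ; *-comm = λ z w →
          solve 4 (λ a b c d → a :* c :- b :* d := c :* a :- d :* b) R.refl (re z) (im z) (re w) (im w) ,
          solve 4 (λ a b c d → a :* d :+ b :* c := c :* b :+ d :* a) R.refl (re z) (im z) (re w) (im w) } }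

  private
    module C = CommutativeRing ℂ-ring
  open FiniteSums ℂ-ring using () renaming (_·_ to _·ℂ_)

  ofReal-+ : ∀ x y → ofReal (x R.+ y) ≈ ofReal x + ofReal y
  ofReal-+ x y = R.refl , R.sym (R.+-identityʳ R.0#)

  ofReal-* : ∀ x y → ofReal (x R.* y) ≈ ofReal x * ofReal y
  ofReal-* x y = solve 2 (λ x y → x :* y := x :* y :- con 𝟘 :* con 𝟘) R.refl x y ,
                 solve 2 (λ x y → con 𝟘 := x :* con 𝟘 :+ con 𝟘 :* y) R.refl x y

  ·1≈ofℕ : ∀ n → n ·ℂ 1# ≈ ofℕ n
  ·1≈ofℕ zero    = C.refl
  ·1≈ofℕ (suc n) = C.trans (C.+-congˡ (·1≈ofℕ n)) (C.sym (ofReal-+ R.1# (ℝ.fromℕ n)))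

  conj-cong : ∀ {z w} → z ≈ w → conj z ≈ conj w
  conj-cong (p , q) = p , R.-‿cong q

  conj-+ : ∀ z w → conj (z + w) ≈ conj z + conj w
  conj-+ z w = R.refl , solve 2 (λ b d → :- (b :+ d) := :- b :+ :- d) R.refl (im z) (im w)

  conj-* : ∀ z w → conj (z * w) ≈ conj z * conj w
  conj-* z w =
    solve 4 (λ a b c d → a :* c :- b :* d := a :* c :- :- b :* :- d) R.refl (re z) (im z) (re w) (im w) ,
    solve 4 (λ a b c d → :- (a :* d :+ b :* c) := a :* :- d :+ :- b :* c) R.refl (re z) (im z) (re w) (im w)

  conj-ofReal : ∀ x → conj (ofReal x) ≈ ofReal x
  conj-ofReal x = R.refl , solve 0 (:- con 𝟘 := con 𝟘) R.refl

  conj-sum : ∀ {n} (f : Fin n → ℂ) → conj (sum f) ≈ sum λ i → conj (f i)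
  conj-sum {zero}  f = conj-ofReal R.0#
  conj-sum {suc n} f = C.trans (conj-+ _ _) (C.+-congˡ (conj-sum (f ∘ suc)))

  conj-product : ∀ {n} (f : Fin n → ℂ) → conj (product f) ≈ product λ i → conj (f i)
  conj-product {zero}  f = conj-ofReal R.1#
  conj-product {suc n} f = C.trans (conj-* _ _) (C.*-congˡ (conj-product (f ∘ suc)))

  conj-^ : ∀ z n → conj (z ^ n) ≈ conj z ^ n
  conj-^ z zero    = conj-ofReal R.1#
  conj-^ z (suc n) = C.trans (conj-* _ _) (C.*-congˡ (conj-^ z n))

  ^-cong : ∀ {z w} n → z ≈ w → z ^ n ≈ w ^ n
  ^-cong zero    z≈w = C.refl
  ^-cong (suc n) z≈w = C.*-cong z≈w (^-cong n z≈w)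

  ℂ-≈-stable : ∀ {z w : ℂ} → ¬ ¬ (z ≈ w) → z ≈ w
  ℂ-≈-stable ¬¬z≈w = ≈-stable (λ ¬p → ¬¬z≈w (¬p ∘ proj₁)) , ≈-stable (λ ¬q → ¬¬z≈w (¬q ∘ proj₂))

  -- Multiplying by `conj z` replaces `z` by the real number |z|², which is nonzero because a sum of
  -- two squares vanishes only when both do. Real cancellation then works in each coordinate.
  z*w≈0⇒w≈0 : ∀ {z w} → z ≉ 0# → z * w ≈ 0# → w ≈ 0#
  z*w≈0⇒w≈0 {z} {w} z≉0 zw≈0 = x*y≈0⇒y≈0 ∣z∣²≉0 (proj₁ ∣z∣²w≈0) , x*y≈0⇒y≈0 ∣z∣²≉0 (proj₂ ∣z∣²w≈0)
    where
    ∣z∣² : R.Carrier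
    ∣z∣² = re z R.* re z R.+ im z R.* im z

    ∣z∣²≉0 : ¬ (∣z∣² R.≈ R.0#)
    ∣z∣²≉0 ∣z∣²≈0 = z≉0
      ( x*x≈0⇒x≈0 (x+y≈0⇒x≈0 (0≤x*x (re z)) (0≤x*x (im z)) ∣z∣²≈0)
      , x*x≈0⇒x≈0 (x+y≈0⇒x≈0 (0≤x*x (im z)) (0≤x*x (re z)) (R.trans (R.+-comm _ _) ∣z∣²≈0)))

    ∣z∣²w≈0 : (∣z∣² R.* re w) +i (∣z∣² R.* im w) ≈ 0#
    ∣z∣²w≈0 = C.trans
      ( solve 4 (λ a b c d → (a :* a :+ b :* b) :* c := a :* (a :* c :- b :* d) :- :- b :* (a :* d :+ b :* c)) R.refl
          (re z) (im z) (re w) (im w)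
      , solve 4 (λ a b c d → (a :* a :+ b :* b) :* d := a :* (a :* d :+ b :* c) :+ :- b :* (a :* c :- b :* d)) R.refl
          (re z) (im z) (re w) (im w))
      (C.trans (C.*-congˡ {conj z} zw≈0) (C.zeroʳ (conj z)))

module ComplexExponential {c ℓ₁ ℓ₂ ℓ₃ : Level} (ℝ : RealNumbers c ℓ₁ ℓ₂ ℓ₃) (Ex : Exponential ℝ) where
  open OrderedField ℝ
  open ComplexField ℝ
  open Complex ℝ
  open Exponential Ex
  private
    module ℝ = RealNumbers ℝ
    module R = CommutativeRing ℝ-ring
    module C = CommutativeRing ℂ-ring
    module RS = IntegerSolver ℝ-ring
    module CS = IntegerSolver ℂ-ring
    module ∑R = PrefixSums ℝ-ring
    module ∑C = PrefixSums ℂ-ring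
    open PartialOrderReasoning ≤-poset

  1/!_ : ℕ → R.Carrier
  1/! n = (ℝ.1/ (n !)) ⦃ n ℕ.!≢0 ⦄

  1/!-recurrence : ∀ n → ℝ.fromℕ (suc n) R.* 1/! (suc n) R.≈ 1/! n
  1/!-recurrence n = begin-equality
    ℝ.fromℕ (suc n) R.* 1/! (suc n)
      ≈⟨ R.*-identityʳ _ ⟨
    ℝ.fromℕ (suc n) R.* 1/! (suc n) R.* R.1#
      ≈⟨ R.*-congˡ (n*1/n (n !) ⦃ n ℕ.!≢0 ⦄) ⟨
    ℝ.fromℕ (suc n) R.* 1/! (suc n) R.* (ℝ.fromℕ (n !) R.* 1/! n)
      ≈⟨ RS.solve 4 (λ a b c d → a :* b :* (c :* d) := a :* c :* b :* d) R.refl _ _ _ _ ⟩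
    ℝ.fromℕ (suc n) R.* ℝ.fromℕ (n !) R.* 1/! (suc n) R.* 1/! n
      ≈⟨ R.*-congʳ (R.*-congʳ (fromℕ-* (suc n) (n !))) ⟨
    ℝ.fromℕ (suc n !) R.* 1/! (suc n) R.* 1/! n
      ≈⟨ R.*-congʳ (n*1/n (suc n !) ⦃ suc n ℕ.!≢0 ⦄) ⟩
    R.1# R.* 1/! n
      ≈⟨ R.*-identityˡ _ ⟩
    1/! n ∎
    where open RS using (_:=_; _:*_)

  0≤1/! : ∀ n → R.0# ≤ 1/! n
  0≤1/! n = <⇒≤ (0<1/n (n !) ⦃ n ℕ.!≢0 ⦄)

  1/1≈1 : 1/! 0 R.≈ R.1#
  1/1≈1 = R.trans (R.sym (R.trans (R.*-congʳ (R.+-identityʳ R.1#)) (R.*-identityˡ _))) (n*1/n 1)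

  ℝ-factorials : ReciprocalFactorials ℝ-ring
  ℝ-factorials = record
    { 1/! = 1/!_
    ; 1/!-zero = 1/1≈1
    ; 1/!-suc = 1/!-recurrence
    ; 1/suc = λ n → ℝ.1/ suc n
    ; 1/suc-inverse = λ n → R.trans (R.*-comm _ _) (n*1/n (suc n)) }

  ℂ-factorials : ReciprocalFactorials ℂ-ring
  ℂ-factorials = record
    { 1/! = λ n → ofReal (1/! n)
    ; 1/!-zero = 1/1≈1 , R.refl
    ; 1/!-suc = λ n → C.trans (C.*-congʳ (·1≈ofℕ (suc n)))
        (C.trans (C.sym (ofReal-* (ℝ.fromℕ (suc n)) (1/! (suc n)))) (1/!-recurrence n , R.refl))
    ; 1/suc = λ n → ofReal (ℝ.1/ suc n)
    ; 1/suc-inverse = λ n → C.trans (C.*-congˡ (·1≈ofℕ (suc n)))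
        (C.trans (C.sym (ofReal-* (ℝ.1/ suc n) (ℝ.fromℕ (suc n)))) (R.trans (R.*-comm _ _) (n*1/n (suc n)) , R.refl)) }

  module ℝ-series = ExponentialSeries ℝ-ring ℝ-factorials
  module ℂ-series = ExponentialSeries ℂ-ring ℂ-factorials

  Nullℂ : (ℕ → ℂ) → Set (c ⊔ ℓ₃)
  Nullℂ u = Null (re ∘ u) × Null (im ∘ u)

  Nullℂ-resp : ∀ {u v} → (∀ n → u n ≈ v n) → Nullℂ u → Nullℂ v
  Nullℂ-resp u≈v (p , q) = Null-resp (proj₁ ∘ u≈v) p , Null-resp (proj₂ ∘ u≈v) q

  Nullℂ-+ : ∀ {u v} → Nullℂ u → Nullℂ v → Nullℂ (λ n → u n + v n)
  Nullℂ-+ (p , q) (p′ , q′) = Null-+ p p′ , Null-+ q q′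

  Nullℂ-neg : ∀ {u} → Nullℂ u → Nullℂ (λ n → - u n)
  Nullℂ-neg (p , q) = Null-neg p , Null-neg q

  Nullℂ-scale : ∀ z {u} → Nullℂ u → Nullℂ (λ n → z * u n)
  Nullℂ-scale z (p , q) =
    Null-+ (Null-scale (re z) p) (Null-neg (Null-scale (im z) q)) ,
    Null-+ (Null-scale (re z) q) (Null-scale (im z) p)

  Nullℂ-* : ∀ {u v} → Nullℂ u → Nullℂ v → Nullℂ (λ n → u n * v n)
  Nullℂ-* (p , q) (p′ , q′) =
    Null-+ (Null-* p p′) (Null-neg (Null-* q q′)) , Null-+ (Null-* p q′) (Null-* q p′)

  exp-limit : ∀ z → Nullℂ (λ n → expPartialSum z n + - exp z)
  exp-limit z = ⟶⇒Null (proj₁ (exp-series z)) , ⟶⇒Null (proj₂ (exp-series z))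

  -- Uniqueness of limits. Since `exp` is known only as a limit, `exp-cong`, `E-+`, `E-conj` and
  -- `E-0` all pass through this.
  exp-unique : ∀ z a → Nullℂ (λ n → expPartialSum z n + - a) → exp z ≈ a
  exp-unique z a lim = C.trans (CS.solve 2 (λ e a → e := (e :- a) :+ a) C.refl (exp z) a)
    (C.trans (C.+-congʳ (Null-const (proj₁ diff) , Null-const (proj₂ diff))) (C.+-identityˡ a))
    where
    open CS using (_:=_; _:+_; _:*_; :-_; _:-_)
    diff : Nullℂ (λ _ → exp z + - a)
    diff = Nullℂ-resp
      (λ n → CS.solve 3 (λ s e a → s :- a :+ :- (s :- e) := e :- a) C.refl (expPartialSum z n) (exp z) a)
      (Nullℂ-+ lim (Nullℂ-neg (exp-limit z)))

  expPartialSum-cong : ∀ {z w} → z ≈ w → ∀ n → expPartialSum z n ≈ expPartialSum w n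
  expPartialSum-cong {z} {w} z≈w n = ∑C.∑<-cong n {ℂ-series.term z} {ℂ-series.term w} λ i _ →
    C.*-congˡ {ofReal (1/! i)} (^-cong i z≈w)

  -- `exp` is given merely as a function on representatives; that it respects `≈` has to come from
  -- the series.
  exp-cong : ∀ {z w} → z ≈ w → exp z ≈ exp w
  exp-cong {z} {w} z≈w = exp-unique z (exp w)
    (Nullℂ-resp (λ n → C.+-congʳ (C.sym (expPartialSum-cong z≈w n))) (exp-limit w))

-- Addition law and period on the imaginary axis

module ExponentialAddition {c ℓ₁ ℓ₂ ℓ₃ : Level} (ℝ : RealNumbers c ℓ₁ ℓ₂ ℓ₃) (Ex : Exponential ℝ) where
  open OrderedField ℝ
  open ComplexField ℝ
  open Complex ℝ
  open Exponential Ex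
  open ComplexExponential ℝ Ex
  private
    module ℝ = RealNumbers ℝ
    module R = CommutativeRing ℝ-ring
    module C = CommutativeRing ℂ-ring
    module RS = IntegerSolver ℝ-ring
    module CS = IntegerSolver ℂ-ring
    module ∑R = PrefixSums ℝ-ring
    module ∑C = PrefixSums ℂ-ring
    open PartialOrderReasoning ≤-poset
    open ℝ-series using () renaming (term to termR; partialSum to PR)
    open RawSemiringDefs (Semiring.rawSemiring R.semiring) using () renaming (_^_ to _^ᴿ_)
    open ℂ-series using () renaming (term to termC; partialSum to PC)

  infix 4 _⊑_
  _⊑_ : ℂ → R.Carrier → Set ℓ₃
  z ⊑ b = ∣ re z ∣≤ b × ∣ im z ∣≤ b

  ⊑-resp : ∀ {z w b} → z ≈ w → z ⊑ b → w ⊑ b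
  ⊑-resp (p , q) (r , s) = ∣∣≤-resp p R.refl r , ∣∣≤-resp q R.refl s

  ⊑-respʳ : ∀ {z b d} → b R.≈ d → z ⊑ b → z ⊑ d
  ⊑-respʳ b≈d (r , s) = ∣∣≤-resp R.refl b≈d r , ∣∣≤-resp R.refl b≈d s

  ⊑-+ : ∀ {z w b d} → z ⊑ b → w ⊑ d → z + w ⊑ b R.+ d
  ⊑-+ (p , q) (r , s) = ∣∣≤-+ p r , ∣∣≤-+ q s

  0⊑0 : 0# ⊑ R.0#
  0⊑0 = ∣0∣≤ ≤-refl , ∣0∣≤ ≤-refl

  1⊑1 : 1# ⊑ R.1#
  1⊑1 = 0≤x⇒∣x∣≤x (<⇒≤ ℝ.0<1) , ∣0∣≤ (<⇒≤ ℝ.0<1)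

  ⊑-scale : ∀ {x z b} → R.0# ≤ x → z ⊑ b → ofReal x * z ⊑ x R.* b
  ⊑-scale {x} {z} 0≤x (p , q) =
    ∣∣≤-resp (RS.solve 3 (λ x a b → x :* a := x :* a :- con 𝟘 :* b) R.refl x (re z) (im z)) R.refl
      (∣∣≤-* (0≤x⇒∣x∣≤x 0≤x) p) ,
    ∣∣≤-resp (RS.solve 3 (λ x a b → x :* b := x :* b :+ con 𝟘 :* a) R.refl x (re z) (im z)) R.refl
      (∣∣≤-* (0≤x⇒∣x∣≤x 0≤x) q)
    where open RS using (_:=_; _:+_; _:*_; _:-_; con; 𝟘)

  -- The bound z ⊑ b is on the two coordinates, so it survives multiplication by an imaginary number but not by an arbitrary one.
  ⊑-imaginary : ∀ {x m z b} → ∣ x ∣≤ m → z ⊑ b → (R.0# +i x) * z ⊑ m R.* b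
  ⊑-imaginary {x} {m} {z} ∣x∣≤m (p , q) =
    ∣∣≤-resp (RS.solve 3 (λ x a b → :- (x :* b) := con 𝟘 :* a :- x :* b) R.refl x (re z) (im z)) R.refl
      (∣∣≤-neg (∣∣≤-* ∣x∣≤m q)) ,
    ∣∣≤-resp (RS.solve 3 (λ x a b → x :* a := con 𝟘 :* b :+ x :* a) R.refl x (re z) (im z)) R.refl
      (∣∣≤-* ∣x∣≤m p)
    where open RS using (_:=_; _:+_; _:*_; :-_; _:-_; con; 𝟘)

  ⊑-imaginary-^ : ∀ {x m z b} n → ∣ x ∣≤ m → z ⊑ b → (R.0# +i x) ^ n * z ⊑ (m ^ᴿ n) R.* b
  ⊑-imaginary-^ {z = z} zero ∣x∣≤m z⊑b =
    ⊑-resp (C.sym (C.*-identityˡ z)) (⊑-respʳ (R.sym (R.*-identityˡ _)) z⊑b)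
  ⊑-imaginary-^ {x} {m} {z} (suc n) ∣x∣≤m z⊑b =
    ⊑-resp (C.sym (C.*-assoc (R.0# +i x) ((R.0# +i x) ^ n) z)) (⊑-respʳ (R.sym (R.*-assoc m _ _))
      (⊑-imaginary ∣x∣≤m (⊑-imaginary-^ n ∣x∣≤m z⊑b)))

  -- The factor `z` is carried along so that the bound can pass through the powers of the imaginary
  -- number one at a time. It will be a tail of the other series, or 1.
  ⊑-term : ∀ {x m z b} n → ∣ x ∣≤ m → z ⊑ b → termC (R.0# +i x) n * z ⊑ termR m n R.* b
  ⊑-term {x} {m} {z} n ∣x∣≤m z⊑b =
    ⊑-resp (C.sym (C.*-assoc (ofReal (1/! n)) ((R.0# +i x) ^ n) z)) (⊑-respʳ (R.sym (R.*-assoc (1/! n) _ _))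
      (⊑-scale (0≤1/! n) (⊑-imaginary-^ n ∣x∣≤m z⊑b)))

  ⊑-∑< : ∀ n {F : ℕ → ℂ} {G : ℕ → R.Carrier} → (∀ i → i ℕ.< n → F i ⊑ G i) → ∑C.∑< n F ⊑ ∑R.∑< n G
  ⊑-∑< zero    F⊑G = 0⊑0
  ⊑-∑< (suc n) F⊑G = ⊑-+ (F⊑G 0 ℕ.z<s) (⊑-∑< n λ i i<n → F⊑G (suc i) (ℕ.s<s i<n))

  ⊑-tail : ∀ {x m} d n → ∣ x ∣≤ m → PC (R.0# +i x) (d ℕ.+ n) + - PC (R.0# +i x) n ⊑ PR m (d ℕ.+ n) R.- PR m n
  ⊑-tail {x} {m} zero n ∣x∣≤m =
    ⊑-resp (C.sym (C.-‿inverseʳ (PC (R.0# +i x) n))) (⊑-respʳ (R.sym (R.-‿inverseʳ (PR m n))) 0⊑0)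
  ⊑-tail {x} {m} (suc d) n ∣x∣≤m =
    ⊑-resp
      (C.trans (CS.solve 3 (λ a b e → a :- b :+ e := a :+ e :- b) C.refl (PC z (d ℕ.+ n)) (PC z n) (termC z (d ℕ.+ n)))
               (C.+-congʳ (C.sym (∑C.∑<-last (d ℕ.+ n) (termC z)))))
      (⊑-respʳ
        (R.trans (RS.solve 3 (λ a b e → a RS.:- b RS.:+ e RS.:= a RS.:+ e RS.:- b) R.refl (PR m (d ℕ.+ n)) (PR m n) (termR m (d ℕ.+ n)))
                 (R.+-congʳ (R.sym (∑R.∑<-last (d ℕ.+ n) (termR m)))))
        (⊑-+ (⊑-tail d n ∣x∣≤m)
          (⊑-resp (C.*-identityʳ (termC z (d ℕ.+ n))) (⊑-respʳ (R.*-identityʳ (termR m (d ℕ.+ n)))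
            (⊑-term (d ℕ.+ n) ∣x∣≤m 1⊑1)))))
    where
    open CS using (_:=_; _:+_; _:-_)
    z = R.0# +i x

  ⊑-tail-∸ : ∀ {x m} i n → i ℕ.≤ n → ∣ x ∣≤ m →
             PC (R.0# +i x) n + - PC (R.0# +i x) (n ∸ i) ⊑ PR m n R.- PR m (n ∸ i)
  ⊑-tail-∸ {x} {m} i n i≤n ∣x∣≤m = ≡.subst
    (λ l → PC (R.0# +i x) l + - PC (R.0# +i x) (n ∸ i) ⊑ PR m l R.- PR m (n ∸ i))
    (ℕ.m+[n∸m]≡n i≤n) (⊑-tail i (n ∸ i) ∣x∣≤m)

  ⊑-square-triangle : ∀ {x y m} n → ∣ x ∣≤ m → ∣ y ∣≤ m →
    PC (R.0# +i x) n * PC (R.0# +i y) n + - PC ((R.0# +i x) + (R.0# +i y)) n ⊑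
    PR m n R.* PR m n R.- PR (m R.+ m) n
  ⊑-square-triangle {x} {y} {m} n ∣x∣≤m ∣y∣≤m =
    ⊑-resp (C.sym (ℂ-series.square-triangle (R.0# +i x) (R.0# +i y) n))
      (⊑-respʳ (R.sym (ℝ-series.square-triangle m m n))
        (⊑-∑< n {F = λ i → termC (R.0# +i x) i * (PC (R.0# +i y) n + - PC (R.0# +i y) (n ∸ i))} λ i i<n →
          ⊑-term i ∣x∣≤m (⊑-tail-∸ i n (ℕ.<⇒≤ i<n) ∣y∣≤m)))

  0≤termR : ∀ {m} n → R.0# ≤ m → R.0# ≤ termR m n
  0≤termR {m} n 0≤m = 0≤* (0≤1/! n) (0≤^ n)
    where
    0≤^ : ∀ n → R.0# ≤ m ^ᴿ n
    0≤^ zero    = <⇒≤ ℝ.0<1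
    0≤^ (suc n) = 0≤* 0≤m (0≤^ n)

  ∑<-mono-≤ : ∀ n {F G} → (∀ i → i ℕ.< n → F i ≤ G i) → ∑R.∑< n F ≤ ∑R.∑< n G
  ∑<-mono-≤ zero    F≤G = ≤-refl
  ∑<-mono-≤ (suc n) F≤G = +-mono-≤ (F≤G 0 ℕ.z<s) (∑<-mono-≤ n λ i i<n → F≤G (suc i) (ℕ.s<s i<n))

  ∑<-extend-≤ : ∀ d n {F} → (∀ i → R.0# ≤ F i) → ∑R.∑< n F ≤ ∑R.∑< (d ℕ.+ n) F
  ∑<-extend-≤ zero    n     0≤F = ≤-refl
  ∑<-extend-≤ (suc d) n {F} 0≤F = begin
    ∑R.∑< n F                          ≤⟨ ∑<-extend-≤ d n 0≤F ⟩
    ∑R.∑< (d ℕ.+ n) F                  ≈⟨ R.+-identityʳ _ ⟨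
    ∑R.∑< (d ℕ.+ n) F R.+ R.0#         ≤⟨ +-monoʳ-≤ _ (0≤F (d ℕ.+ n)) ⟩
    ∑R.∑< (d ℕ.+ n) F R.+ F (d ℕ.+ n)  ≈⟨ ∑R.∑<-last (d ℕ.+ n) F ⟨
    ∑R.∑< (suc (d ℕ.+ n)) F            ∎

  PR-mono-≤ : ∀ {m i n} → R.0# ≤ m → i ℕ.≤ n → PR m i ≤ PR m n
  PR-mono-≤ {m} {i} {n} 0≤m i≤n = ≡.subst (λ l → PR m i ≤ PR m l) (ℕ.m∸n+n≡m i≤n)
    (∑<-extend-≤ (n ∸ i) i λ j → 0≤termR j 0≤m)

  0≤PR : ∀ {m} n → R.0# ≤ m → R.0# ≤ PR m n
  0≤PR n 0≤m = PR-mono-≤ {i = 0} {n = n} 0≤m ℕ.z≤n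

  -- All terms are nonnegative, and the square i, j < n lies inside the triangle i + j < 2n.
  square≤double : ∀ {m} n → R.0# ≤ m → PR m n R.* PR m n ≤ PR (m R.+ m) (n ℕ.+ n)
  square≤double {m} n 0≤m = begin
    PR m n R.* PR m n
      ≈⟨ ∑R.∑<-*ʳ n (PR m n) (termR m) ⟨
    ∑R.∑< n (λ i → termR m i R.* PR m n)
      ≤⟨ ∑<-mono-≤ n (λ i i<n → *-monoˡ-≤ (0≤termR i 0≤m) (PR-mono-≤ 0≤m (n≤2n∸i i (ℕ.<⇒≤ i<n)))) ⟩
    ∑R.∑< n (λ i → termR m i R.* PR m (n ℕ.+ n ∸ i))
      ≤⟨ ∑<-extend-≤ n n (λ i → 0≤* (0≤termR i 0≤m) (0≤PR (n ℕ.+ n ∸ i) 0≤m)) ⟩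
    ∑R.∑< (n ℕ.+ n) (λ i → termR m i R.* PR m (n ℕ.+ n ∸ i))
      ≈⟨ ℝ-series.partialSum-+ m m (n ℕ.+ n) ⟨
    PR (m R.+ m) (n ℕ.+ n) ∎
    where
    n≤2n∸i : ∀ i → i ℕ.≤ n → n ℕ.≤ n ℕ.+ n ∸ i
    n≤2n∸i i i≤n = ≡.subst (n ℕ.≤_) (≡.sym (ℕ.+-∸-assoc n i≤n)) (ℕ.m≤m+n n (n ∸ i))

  re-PC-ofReal : ∀ x n → re (PC (ofReal x) n) R.≈ PR x n
  re-PC-ofReal x n = proj₁ (PC≈ofReal (λ i → termC-ofReal i) n)
    where
    ofReal-^ : ∀ n → ofReal x ^ n ≈ ofReal (x ^ᴿ n)
    ofReal-^ zero    = C.refl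
    ofReal-^ (suc n) = C.trans (C.*-congˡ {ofReal x} (ofReal-^ n)) (C.sym (ofReal-* x (x ^ᴿ n)))

    termC-ofReal : ∀ i → termC (ofReal x) i ≈ ofReal (termR x i)
    termC-ofReal i = C.trans (C.*-congˡ {ofReal (1/! i)} (ofReal-^ i)) (C.sym (ofReal-* (1/! i) (x ^ᴿ i)))

    PC≈ofReal : ∀ {F G} → (∀ i → F i ≈ ofReal (G i)) → ∀ n → ∑C.∑< n F ≈ ofReal (∑R.∑< n G)
    PC≈ofReal F≈G zero    = C.refl
    PC≈ofReal {G = G} F≈G (suc n) =
      C.trans (C.+-cong (F≈G 0) (PC≈ofReal (F≈G ∘ suc) n)) (C.sym (ofReal-+ (G 0) (∑R.∑< n (G ∘ suc))))

  -- The real series converges because `exp-series` applies at the point `ofReal x`; its block from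
  -- n to 2n is therefore null.
  PR-double-Null : ∀ x → Null (λ n → PR x (n ℕ.+ n) R.- PR x n)
  PR-double-Null x = Null-resp
    (λ n → RS.solve 3 (λ a b l → a :- l :+ :- (b :- l) := a :- b) R.refl (PR x (n ℕ.+ n)) (PR x n) l)
    (Null-+ (Null-subsequence (λ n → n ℕ.+ n) (λ n → ℕ.m≤m+n n n) PR→l) (Null-neg PR→l))
    where
    open RS using (_:=_; _:+_; :-_; _:-_)
    l = re (exp (ofReal x))
    PR→l : Null (λ n → PR x n R.- l)
    PR→l = Null-resp (λ n → R.+-congʳ (re-PC-ofReal x n)) (proj₁ (exp-limit (ofReal x)))

  -- The Cauchy product of the two partial sums differs from the partial sum at ix + iy by terms which a real m ≥ |x|, |y|
  -- dominates; for m itself the difference is at most a block of the series at m + m, which converges by exp-series.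
  square-triangle-Null : ∀ x y →
    Nullℂ (λ n → PC (R.0# +i x) n * PC (R.0# +i y) n + - PC ((R.0# +i x) + (R.0# +i y)) n)
  square-triangle-Null x y =
    Null-dominated (λ n → ∣∣≤-weaken (bound n) (proj₁ (close n))) (PR-double-Null (m R.+ m)) ,
    Null-dominated (λ n → ∣∣≤-weaken (bound n) (proj₂ (close n))) (PR-double-Null (m R.+ m))
    where
    p = proj₁ (bounded x)
    q = proj₁ (bounded y)
    m = ℝ.fromℕ (suc p) R.+ ℝ.fromℕ (suc q)

    0≤m : R.0# ≤ m
    0≤m = begin
      R.0#            ≈⟨ R.+-identityˡ R.0# ⟨
      R.0# R.+ R.0#   ≤⟨ +-mono-≤ (0≤fromℕ (suc p)) (0≤fromℕ (suc q)) ⟩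
      m               ∎

    ∣x∣≤m : ∣ x ∣≤ m
    ∣x∣≤m = ∣∣≤-weaken (begin
      ℝ.fromℕ (suc p)            ≈⟨ R.+-identityʳ _ ⟨
      ℝ.fromℕ (suc p) R.+ R.0#   ≤⟨ +-monoʳ-≤ _ (0≤fromℕ (suc q)) ⟩
      m                          ∎) (proj₂ (bounded x))

    ∣y∣≤m : ∣ y ∣≤ m
    ∣y∣≤m = ∣∣≤-weaken (begin
      ℝ.fromℕ (suc q)            ≈⟨ R.+-identityˡ _ ⟨
      R.0# R.+ ℝ.fromℕ (suc q)   ≤⟨ +-monoˡ-≤ _ (0≤fromℕ (suc p)) ⟩
      m                          ∎) (proj₂ (bounded y))

    close : ∀ n → PC (R.0# +i x) n * PC (R.0# +i y) n + - PC ((R.0# +i x) + (R.0# +i y)) n ⊑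
                  PR m n R.* PR m n R.- PR (m R.+ m) n
    close n = ⊑-square-triangle n ∣x∣≤m ∣y∣≤m

    bound : ∀ n → PR m n R.* PR m n R.- PR (m R.+ m) n ≤ PR (m R.+ m) (n ℕ.+ n) R.- PR (m R.+ m) n
    bound n = +-monoˡ-≤ (R.- PR (m R.+ m) n) (square≤double n 0≤m)

  E : R.Carrier → ℂ
  E x = exp (R.0# +i x)

  E-cong : ∀ {x y} → x R.≈ y → E x ≈ E y
  E-cong x≈y = exp-cong (R.refl , x≈y)

  E-+ : ∀ x y → E (x R.+ y) ≈ E x * E y
  E-+ x y = C.trans (exp-cong (R.sym (R.+-identityʳ R.0#) , R.refl)) (exp-unique (X + Y) (exp X * exp Y)
    -- The error s - ab is written through the null sequences p - a, q - b and pq - s, where p, q, s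
    -- are the partial sums at `X`, `Y`, `X + Y`.
    (Nullℂ-resp (λ n → CS.solve 5 (λ s p q a b →
         (p :- a) :* (q :- b) :+ (a :* (q :- b) :+ b :* (p :- a)) :+ :- (p :* q :- s) := s :- a :* b) C.refl
         (PC (X + Y) n) (PC X n) (PC Y n) (exp X) (exp Y))
      (Nullℂ-+ (Nullℂ-+ (Nullℂ-* (exp-limit X) (exp-limit Y))
                        (Nullℂ-+ (Nullℂ-scale (exp X) (exp-limit Y)) (Nullℂ-scale (exp Y) (exp-limit X))))
               (Nullℂ-neg (square-triangle-Null x y)))))
    where
    open CS using (_:=_; _:+_; _:*_; :-_; _:-_)
    X = R.0# +i x
    Y = R.0# +i y

  -- The series has real coefficients, so conjugation passes to its argument.
  E-conj : ∀ x → conj (E x) ≈ E (R.- x)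
  E-conj x = C.sym (exp-unique (R.0# +i (R.- x)) (conj (E x))
    (Nullℂ-resp (λ n → C.trans (conj-+ (PC X n) (- exp X)) (C.+-cong (conj-PC n) C.refl))
      (proj₁ (exp-limit X) , Null-neg (proj₂ (exp-limit X)))))
    where
    X = R.0# +i x
    conj-PC : ∀ n → conj (PC X n) ≈ PC (conj X) n
    conj-PC n = C.trans (conj-sum {n} (λ i → termC X (toℕ i))) (∑C.∑<-cong n {λ i → conj (termC X i)} {termC (conj X)} λ i _ →
      C.trans (conj-* (ofReal (1/! i)) (X ^ i)) (C.*-cong (conj-ofReal (1/! i)) (conj-^ X i)))

  E-0 : E R.0# ≈ 1#
  E-0 = exp-unique 0# 1# (null (λ n → proj₁ (vanish n)) , null (λ n → proj₂ (vanish n)))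
    where
    null : ∀ {u : ℕ → R.Carrier} → (∀ n → u (suc n) R.≈ R.0#) → Null u
    -- The threshold is 1: the empty partial sum is 0, and every later one is exactly 1.
    null u≈0 ε 0<ε = 1 , λ { (suc n) _ → ∣∣≤-resp (R.sym (u≈0 n)) R.refl (∣0∣≤ (<⇒≤ 0<ε)) }
    0^suc : ∀ i → termC 0# (suc i) ≈ 0#
    0^suc i = C.trans (C.*-congˡ {ofReal (1/! (suc i))} (C.zeroˡ (0# ^ i))) (C.zeroʳ (ofReal (1/! (suc i))))
    vanish : ∀ n → PC 0# (suc n) + - 1# ≈ 0#
    vanish n = C.trans
      (C.+-congʳ {x = - 1#} (C.+-cong
         (C.trans (C.*-identityʳ (ofReal (1/! 0))) (1/1≈1 , R.refl))
         (FiniteSums.sum-zero ℂ-ring {n} {λ i → termC 0# (suc (toℕ i))} (λ i → 0^suc (toℕ i)))))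
      (CS.solve 0 (CS.con CS.𝟙 CS.:+ CS.con CS.𝟘 CS.:- CS.con CS.𝟙 CS.:= CS.con CS.𝟘) C.refl)

  E-conj-inverse : ∀ x → E x * conj (E x) ≈ 1#
  E-conj-inverse x = C.trans (C.*-congˡ {E x} (E-conj x)) (C.trans (C.sym (E-+ x (R.- x)))
    (C.trans (E-cong (R.-‿inverseʳ x)) E-0))

  -- Since `sin-pi` makes `E pi` real, its square is `E pi` times its conjugate, which is 1. The
  -- sign of `E pi` does not have to be found.
  E-2π : E (pi R.+ pi) ≈ 1#
  E-2π = C.trans (E-+ pi pi) (C.trans (C.*-congˡ {E pi} E-pi-real) (E-conj-inverse pi))
    where
    E-pi-real : E pi ≈ conj (E pi)
    E-pi-real = R.refl , R.trans sin-pi (R.trans (RS.solve 0 (RS.con RS.𝟘 RS.:= RS.:- RS.con RS.𝟘) R.refl) (R.-‿cong (R.sym sin-pi)))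

  -- If E (x + x) = E(x)² is 1 = E(x) E(x)*, then comparing real parts gives sin² x = 0.
  E-double≉1 : ∀ x → R.0# ℝ.< x → x ℝ.< pi → E (x R.+ x) ≉ 1#
  E-double≉1 x 0<x x<pi E2x≈1 = pi-least x 0<x x<pi (x*x≈0⇒x≈0 (x+x≈0⇒x≈0 (R.trans
    (RS.solve 2 (λ a b → b :* b :+ b :* b := (a :* a :- b :* :- b) :- (a :* a :- b :* b)) R.refl (re (E x)) (im (E x)))
    (R.trans (R.+-cong (proj₁ (E-conj-inverse x)) (R.-‿cong (proj₁ (C.trans (C.sym (E-+ x x)) E2x≈1)))) (R.-‿inverseʳ R.1#)))))
    where open RS using (_:=_; _:+_; _:*_; :-_; _:-_)

-- Characters

∉supp⇒≡0 : ∀ {k} {s : Fin k → ℕ} (a : Row s) j → j ∉ supp a → toℕ (a j) ≡ 0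
∉supp⇒≡0 a j j∉ with toℕ (a j) ℕ.≟ 0 in eq
... | yes a≡0 = a≡0
... | no _    = ⊥-elim (j∉ (Vec.lookup⇒[]= j (supp a) (≡.trans
        (Vec.lookup∘tabulate (λ j → does (¬? (toℕ (a j) ℕ.≟ 0))) j) (≡.cong (does ∘ ¬?) eq))))

module CharacterMatrix {c ℓ₁ ℓ₂ ℓ₃ : Level} (ℝ : RealNumbers c ℓ₁ ℓ₂ ℓ₃) (Ex : Exponential ℝ) where
  open OrderedField ℝ
  open ComplexField ℝ
  open Complex ℝ hiding (sum; product)
  open Exponential Ex using (pi; 0<pi)
  open ExponentialAddition ℝ Ex
  open Characters Ex
  open FiniteSums ℂ-ring
  private
    module ℝ = RealNumbers ℝ
    module < = IsStrictPartialOrder ℝ.isStrictPartialOrder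
    module R = CommutativeRing ℝ-ring
    module C = CommutativeRing ℂ-ring
    module RS = IntegerSolver ℝ-ring
    module CS = IntegerSolver ℂ-ring
    open PrefixSums ℂ-ring
    open SetoidReasoning C.setoid

  z-w≈0⇒z≈w : ∀ {z w : ℂ} → z + - w ≈ 0# → z ≈ w
  z-w≈0⇒z≈w {z} {w} z-w≈0 = C.trans (CS.solve 2 (λ z w → z CS.:= z CS.:- w CS.:+ w) C.refl z w)
    (C.trans (C.+-congʳ {w} z-w≈0) (C.+-identityˡ w))

  module _ (s : ℕ) .⦃ s≢0 : NonZero s ⦄ where

    angle : ℕ → R.Carrier
    angle m = ℝ.fromℕ 2 R.* pi R.* ℝ.fromℕ m R.* ℝ.1/ s

    phase : ℕ → ℂ
    phase m = E (angle m)

    phase-+ : ∀ m n → phase (m ℕ.+ n) ≈ phase m * phase n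
    phase-+ m n = C.trans (E-cong (R.trans (R.*-congʳ (R.*-congˡ (fromℕ-+ m n)))
      (RS.solve 4 (λ t a b r → t :* (a :+ b) :* r := t :* a :* r :+ t :* b :* r) R.refl _ (ℝ.fromℕ m) (ℝ.fromℕ n) (ℝ.1/ s))))
      (E-+ (angle m) (angle n))
      where open RS using (_:=_; _:+_; _:*_)

    phase-0 : phase 0 ≈ 1#
    phase-0 = C.trans (E-cong (RS.solve 2 (λ t r → t :* con 𝟘 :* r := con 𝟘) R.refl _ (ℝ.1/ s))) E-0
      where open RS using (_:=_; _:*_; con; 𝟘)

    phase-s : phase s ≈ 1#
    phase-s = C.trans (E-cong (R.trans (R.*-assoc _ (ℝ.fromℕ s) (ℝ.1/ s)) (R.trans (R.*-congˡ (n*1/n s))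
      (RS.solve 1 (λ p → (con 𝟙 :+ (con 𝟙 :+ con 𝟘)) :* p :* con 𝟙 := p :+ p) R.refl pi)))) E-2π
      where open RS using (_:=_; _:+_; _:*_; con; 𝟘; 𝟙)

    phase-*s : ∀ m → phase (m ℕ.* s) ≈ 1#
    phase-*s zero    = phase-0
    phase-*s (suc m) = C.trans (phase-+ s (m ℕ.* s)) (C.trans (C.*-cong phase-s (phase-*s m)) (C.*-identityˡ 1#))

    -- With θ = πd/s the phase is E(θ + θ), so `E-double≉1` applies once 0 < θ < π. The upper bound
    -- holds because the complementary part π(s - d)/s is positive.
    phase≉1 : ∀ {d} → 0 ℕ.< d → d ℕ.< s → phase d ≉ 1#
    phase≉1 {d} 0<d d<s phase≈1 = E-double≉1 θ 0<θ θ<pi (C.trans (E-cong (R.sym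
        (RS.solve 3 (λ p a r → (con 𝟙 :+ (con 𝟙 :+ con 𝟘)) :* p :* a :* r := p :* (a :* r) :+ p :* (a :* r)) R.refl
          pi (ℝ.fromℕ d) (ℝ.1/ s)))) phase≈1)
      where
      open RS using (_:=_; _:+_; _:*_; con; 𝟘; 𝟙)
      part : ℕ → R.Carrier
      part m = pi R.* (ℝ.fromℕ m R.* ℝ.1/ s)

      θ : R.Carrier
      θ = part d

      0<part : ∀ m → 0 ℕ.< m → R.0# ℝ.< part m
      0<part m 0<m = ℝ.*-positive 0<pi (ℝ.*-positive (ℝ.0<fromℕ m ⦃ ℕ.>-nonZero 0<m ⦄) (0<1/n s))

      0<θ : R.0# ℝ.< θ
      0<θ = 0<part d 0<d

      parts : part (s ∸ d) R.+ θ R.≈ pi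
      parts = R.trans
        (RS.solve 4 (λ p a b r → p :* (b :* r) :+ p :* (a :* r) := p :* ((b :+ a) :* r)) R.refl
          pi (ℝ.fromℕ d) (ℝ.fromℕ (s ∸ d)) (ℝ.1/ s))
        (R.trans (R.*-congˡ (R.trans (R.*-congʳ (R.trans (R.sym (fromℕ-+ (s ∸ d) d))
          (R.reflexive (≡.cong ℝ.fromℕ (ℕ.m∸n+n≡m (ℕ.<⇒≤ d<s)))))) (n*1/n s))) (R.*-identityʳ pi))

      θ<pi : θ ℝ.< pi
      θ<pi = <.<-respˡ-≈ (R.+-identityˡ θ) (<.<-respʳ-≈ parts (ℝ.+-monoˡ-< θ (0<part (s ∸ d) (ℕ.m<n⇒0<n∸m d<s))))

    module _ (a b : ℕ) where

      ω : ℂ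
      ω = conj (phase a) * phase b

      wave : ℕ → ℂ
      wave m = conj (phase (a ℕ.* m)) * phase (b ℕ.* m)

      wave-suc : ∀ m → wave (suc m) ≈ ω * wave m
      wave-suc m = begin
        conj (phase (a ℕ.* suc m)) * phase (b ℕ.* suc m)
          ≡⟨ ≡.cong₂ (λ x y → conj (phase x) * phase y) (ℕ.*-suc a m) (ℕ.*-suc b m) ⟩
        conj (phase (a ℕ.+ a ℕ.* m)) * phase (b ℕ.+ b ℕ.* m)
          ≈⟨ C.*-cong (C.trans (conj-cong (phase-+ a (a ℕ.* m))) (conj-* (phase a) (phase (a ℕ.* m))))
                      (phase-+ b (b ℕ.* m)) ⟩
        conj (phase a) * conj (phase (a ℕ.* m)) * (phase b * phase (b ℕ.* m))
          ≈⟨ CS.solve 4 (λ x y z w → x CS.:* y CS.:* (z CS.:* w) CS.:= x CS.:* z CS.:* (y CS.:* w)) C.refl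
               (conj (phase a)) (conj (phase (a ℕ.* m))) (phase b) (phase (b ℕ.* m)) ⟩
        ω * wave m ∎

      conj-phase*phase : ∀ m n → phase m ≈ 1# → phase n ≈ 1# → conj (phase m) * phase n ≈ 1#
      conj-phase*phase m n p q = C.trans (C.*-cong (C.trans (conj-cong p) (conj-ofReal R.1#)) q) (C.*-identityˡ 1#)

      wave-0 : wave 0 ≈ 1#
      wave-0 = C.trans (C.reflexive (≡.cong₂ (λ x y → conj (phase x) * phase y) (ℕ.*-zeroʳ a) (ℕ.*-zeroʳ b)))
        (conj-phase*phase 0 0 phase-0 phase-0)

      wave-s : wave s ≈ 1#
      wave-s = conj-phase*phase (a ℕ.* s) (b ℕ.* s) (phase-*s a) (phase-*s b)

      -- The geometric sum stays in multiplied form; `sum-wave` later cancels `ω + - 1#`, which is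
      -- known only to be nonzero.
      geometric : ∀ n → (ω + - 1#) * ∑< n wave ≈ wave n + - 1#
      geometric zero = C.trans (C.zeroʳ (ω + - 1#)) (C.sym (C.trans (C.+-congʳ { - 1# } wave-0) (C.-‿inverseʳ 1#)))
      geometric (suc n) = begin
        (ω + - 1#) * ∑< (suc n) wave
          ≈⟨ C.*-congˡ {ω + - 1#} (∑<-last n wave) ⟩
        (ω + - 1#) * (∑< n wave + wave n)
          ≈⟨ C.distribˡ (ω + - 1#) (∑< n wave) (wave n) ⟩
        (ω + - 1#) * ∑< n wave + (ω + - 1#) * wave n
          ≈⟨ C.+-congʳ {(ω + - 1#) * wave n} (geometric n) ⟩
        wave n + - 1# + (ω + - 1#) * wave n
          ≈⟨ CS.solve 2 (λ w o → w :- con 𝟙 :+ (o :- con 𝟙) :* w := o :* w :- con 𝟙) C.refl (wave n) ω ⟩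
        ω * wave n + - 1#
          ≈⟨ C.+-congʳ { - 1# } (wave-suc n) ⟨
        wave (suc n) + - 1# ∎
        where open CS using (_:=_; _:+_; _:*_; _:-_; con; 𝟙)

      sum-wave : ω ≉ 1# → ∑< s wave ≈ 0#
      sum-wave ω≉1 = z*w≈0⇒w≈0 (ω≉1 ∘ z-w≈0⇒z≈w)
        (C.trans (geometric s) (C.trans (C.+-congʳ { - 1# } wave-s) (C.-‿inverseʳ 1#)))

    conj-phase-inverse : ∀ m → conj (phase m) * phase m ≈ 1#
    conj-phase-inverse m = C.trans (C.*-comm (conj (phase m)) (phase m)) (E-conj-inverse (angle m))

    wave-diagonal : ∀ a m → wave a a m ≈ 1#
    wave-diagonal a m = conj-phase-inverse (a ℕ.* m)

    ω-shift : ∀ a d → ω a (a ℕ.+ d) ≈ phase d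
    ω-shift a d = begin
      conj (phase a) * phase (a ℕ.+ d)        ≈⟨ C.*-congˡ {conj (phase a)} (phase-+ a d) ⟩
      conj (phase a) * (phase a * phase d)    ≈⟨ C.*-assoc (conj (phase a)) (phase a) (phase d) ⟨
      conj (phase a) * phase a * phase d      ≈⟨ C.*-congʳ {phase d} (conj-phase-inverse a) ⟩
      1# * phase d                            ≈⟨ C.*-identityˡ (phase d) ⟩
      phase d                                 ∎

    ω-swap : ∀ a b → ω a b ≈ conj (ω b a)
    ω-swap a b = C.trans (C.*-comm (conj (phase a)) (phase b)) (C.sym (C.trans (conj-* (conj (phase b)) (phase a))
      (C.*-congʳ {conj (phase a)} (R.refl , RS.solve 1 (λ x → RS.:- RS.:- x RS.:= x) R.refl (im (phase b))))))

    <⇒ω≉1 : ∀ {a b} → a ℕ.< b → b ℕ.< s → ω a b ≉ 1#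
    <⇒ω≉1 {a} {b} a<b b<s ω≈1 = phase≉1 (ℕ.m<n⇒0<n∸m a<b) (ℕ.≤-<-trans (ℕ.m∸n≤m b a) b<s)
      (C.trans (C.sym (ω-shift a (b ∸ a)))
        (C.trans (C.reflexive (≡.cong (ω a) (ℕ.m+[n∸m]≡n (ℕ.<⇒≤ a<b)))) ω≈1))

    -- For a < b, `ω a b` is the phase of `b ∸ a`, a number strictly between 0 and `s`; conjugation
    -- handles the other order.
    ω≉1 : ∀ {a b} → a ℕ.< s → b ℕ.< s → a ≢ b → ω a b ≉ 1#
    ω≉1 {a} {b} a<s b<s a≢b with ℕ.<-cmp a b
    ... | tri< a<b _ _ = <⇒ω≉1 a<b b<s
    ... | tri≈ _ a≡b _ = ⊥-elim (a≢b a≡b)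
    ... | tri> _ _ b<a = λ ω≈1 → <⇒ω≉1 b<a a<s (C.trans (ω-swap b a) (C.trans (conj-cong ω≈1) (conj-ofReal R.1#)))

    sum-wave-Fin : ∀ (a b : Fin s) → (sum {s} λ u → wave (toℕ a) (toℕ b) (toℕ u)) ≈ s · 1# * ⟪ a Fin.≟ b ⟫
    sum-wave-Fin a b = go (a Fin.≟ b)
      where
      go : (d : Dec (a ≡ b)) → (sum {s} λ u → wave (toℕ a) (toℕ b) (toℕ u)) ≈ s · 1# * ⟪ d ⟫
      go (yes ≡.refl) = C.trans (sum-cong-≋ {s} λ u → wave-diagonal (toℕ a) (toℕ u)) (sum-const s 1#)
      go (no a≢b)     = C.trans
        (sum-wave (toℕ a) (toℕ b) (ω≉1 (Fin.toℕ<n a) (Fin.toℕ<n b) (a≢b ∘ Fin.toℕ-injective)))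
        (C.sym (C.zeroʳ (s · 1#)))

  -- Orthogonal columns and eigenvalues

  module _ {n t N : ℕ} (t≤k : t ℕ.≤ suc n) {s : Fin (suc n) → ℕ} .⦃ s≢0 : ∀ {i} → NonZero (s i) ⦄
           (A : Array N s) (A-OA : IsOA t A) where

    χ-inner : ∀ (a b : Row s) → InF t a → InF t b →
      (sum λ x → conj (χ a (A x)) * χ b (A x)) ≈ N · 1# * product λ j → ⟪ a j Fin.≟ b j ⟫
    χ-inner a b a∈F b∈F = begin
      (sum λ x → conj (χ a (A x)) * χ b (A x))
        ≈⟨ sum-cong-≋ {N} (λ x → C.*-congʳ {χ b (A x)} (conj-product (λ j → phase (s j) (toℕ (a j) ℕ.* toℕ (A x j))))) ⟩
      (sum λ x → product (λ j → conj (phase (s j) (toℕ (a j) ℕ.* toℕ (A x j)))) * χ b (A x))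
        ≈⟨ sum-cong-≋ {N} (λ x → product-distrib-* (λ j → conj (phase (s j) (toℕ (a j) ℕ.* toℕ (A x j))))
             (λ j → phase (s j) (toℕ (b j) ℕ.* toℕ (A x j)))) ⟨
      (sum λ x → product λ j → h j (A x j))
        ≈⟨ average A A-OA t≤k (supp a ∪ supp b) (Small-∪ t (supp a) (supp b) a∈F b∈F) h (λ j → ⟪ a j Fin.≟ b j ⟫)
             h≈1 a≟b≈1 (λ j → sum-wave-Fin (s j) (a j) (b j)) ⟩
      N · 1# * product (λ j → ⟪ a j Fin.≟ b j ⟫) ∎
      where
      h : ∀ j → Fin (s j) → ℂ
      h j u = wave (s j) (toℕ (a j)) (toℕ (b j)) (toℕ u)

      a≡0 : ∀ j → j ∉ supp a ∪ supp b → toℕ (a j) ≡ 0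
      a≡0 j j∉ = ∉supp⇒≡0 a j (j∉ ∘ p⊆p∪q (supp b))

      b≡0 : ∀ j → j ∉ supp a ∪ supp b → toℕ (b j) ≡ 0
      b≡0 j j∉ = ∉supp⇒≡0 b j (j∉ ∘ q⊆p∪q (supp a) (supp b))

      a≡b : ∀ j → j ∉ supp a ∪ supp b → toℕ (a j) ≡ toℕ (b j)
      a≡b j j∉ = ≡.trans (a≡0 j j∉) (≡.sym (b≡0 j j∉))

      h≈1 : ∀ j → j ∉ supp a ∪ supp b → ∀ u → h j u ≈ 1#
      h≈1 j j∉ u = C.trans (C.reflexive (≡.cong (λ m → wave (s j) (toℕ (a j)) m (toℕ u)) (≡.sym (a≡b j j∉))))
        (wave-diagonal (s j) (toℕ (a j)) (toℕ u))

      a≟b≈1 : ∀ j → j ∉ supp a ∪ supp b → ⟪ a j Fin.≟ b j ⟫ ≈ 1#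
      a≟b≈1 j j∉ = ⟪⟫-yes (a j Fin.≟ b j) (Fin.toℕ-injective (a≡b j j∉))

    private
      Φ : Matrix N (length (ℱ t s))
      Φ = Ψ t A

      ∈ℱ : ∀ d → InF t (lookup (ℱ t s) d)
      ∈ℱ d = proj₂ (List∈.∈-filter⁻ (InF? t) {xs = rows s} (List∈.∈-lookup d))

    column-norm : ∀ d → (sum λ x → conj (Φ x d) * Φ x d) ≈ N · 1#
    column-norm d = C.trans (χ-inner a a (∈ℱ d) (∈ℱ d))
      (C.trans (C.*-congˡ {N · 1#} (product-one λ j → ⟪⟫-yes (a j Fin.≟ a j) ≡.refl)) (C.*-identityʳ (N · 1#)))
      where a = lookup (ℱ t s) d

    column-orthogonal : ∀ d e → e ≢ d → (sum λ x → conj (Φ x d) * Φ x e) ≈ 0#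
    column-orthogonal d e e≢d with ℱ-distinct t s d e (e≢d ∘ ≡.sym)
    ... | j , aj≢bj = C.trans (χ-inner a b (∈ℱ d) (∈ℱ e))
      (C.trans (C.*-congˡ {N · 1#} (product-zero (λ j → ⟪ a j Fin.≟ b j ⟫) j (⟪⟫-no (a j Fin.≟ b j) aj≢bj))) (C.zeroʳ (N · 1#)))
      where
      a = lookup (ℱ t s) d
      b = lookup (ℱ t s) e

    -- By stability of `≈` one may suppose μ ≉ |A|. Then w = Φᴴ v vanishes, hence so does μ v = Φ w,
    -- and μ ≉ 0 gives v = 0, contrary to the choice of `v`.
    eigenvalue : ∀ μ → IsEigenvalue (Φ ⊗ Φ ᴴ) μ → μ ≉ 0# → μ ≈ ofℕ N
    eigenvalue μ (v , v≉0 , Pv≈μv) μ≉0 = ℂ-≈-stable λ μ≉N → v≉0 λ i → v≈0 μ≉N i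
      where
      w : Fin (length (ℱ t s)) → ℂ
      w d = sum λ j → conj (Φ j d) * v j

      Φw≈μv : ∀ i → (sum λ d → Φ i d * w d) ≈ μ * v i
      Φw≈μv i = begin
        (sum λ d → Φ i d * w d)
          ≈⟨ sum-cong-≋ (λ d → *-distribˡ-sum (Φ i d) (λ j → conj (Φ j d) * v j)) ⟩
        (sum λ d → sum λ j → Φ i d * (conj (Φ j d) * v j))
          ≈⟨ sum-cong-≋ (λ d → sum-cong-≋ λ j → C.*-assoc (Φ i d) (conj (Φ j d)) (v j)) ⟨
        (sum λ d → sum λ j → Φ i d * conj (Φ j d) * v j)
          ≈⟨ ∑-comm (λ d j → Φ i d * conj (Φ j d) * v j) ⟩
        (sum λ j → sum λ d → Φ i d * conj (Φ j d) * v j)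
          ≈⟨ sum-cong-≋ (λ j → *-distribʳ-sum (v j) (λ d → Φ i d * conj (Φ j d))) ⟨
        (sum λ j → (Φ ⊗ Φ ᴴ) i j * v j)
          ≈⟨ Pv≈μv i ⟩
        μ * v i ∎

      -- Apply Φᴴ to Φ w = μ v: on the left, orthogonality of the columns leaves only the entry `d`,
      -- with the squared norm |A| as its factor.
      Nw≈μw : ∀ d → N · 1# * w d ≈ μ * w d
      Nw≈μw d = begin
        N · 1# * w d
          ≈⟨ C.*-congʳ {w d} (column-norm d) ⟨
        (sum λ i → conj (Φ i d) * Φ i d) * w d
          ≈⟨ sum-single (λ e → (sum λ i → conj (Φ i d) * Φ i e) * w e) d
               (λ e e≢d → C.trans (C.*-congʳ {w e} (column-orthogonal d e e≢d)) (C.zeroˡ (w e))) ⟨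
        (sum λ e → (sum λ i → conj (Φ i d) * Φ i e) * w e)
          ≈⟨ sum-cong-≋ (λ e → *-distribʳ-sum (w e) (λ i → conj (Φ i d) * Φ i e)) ⟩
        (sum λ e → sum λ i → conj (Φ i d) * Φ i e * w e)
          ≈⟨ ∑-comm (λ e i → conj (Φ i d) * Φ i e * w e) ⟩
        (sum λ i → sum λ e → conj (Φ i d) * Φ i e * w e)
          ≈⟨ sum-cong-≋ (λ i → C.trans (sum-cong-≋ λ e → C.*-assoc (conj (Φ i d)) (Φ i e) (w e))
               (C.sym (*-distribˡ-sum (conj (Φ i d)) (λ e → Φ i e * w e)))) ⟩
        (sum λ i → conj (Φ i d) * (sum λ e → Φ i e * w e))
          ≈⟨ sum-cong-≋ (λ i → C.*-congˡ {conj (Φ i d)} (Φw≈μv i)) ⟩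
        (sum λ i → conj (Φ i d) * (μ * v i))
          ≈⟨ sum-cong-≋ (λ i → CS.solve 3 (λ a b c → a CS.:* (b CS.:* c) CS.:= b CS.:* (a CS.:* c)) C.refl
               (conj (Φ i d)) μ (v i)) ⟩
        (sum λ i → μ * (conj (Φ i d) * v i))
          ≈⟨ *-distribˡ-sum μ (λ i → conj (Φ i d) * v i) ⟨
        μ * w d ∎

      w≈0 : μ ≉ ofℕ N → ∀ d → w d ≈ 0#
      w≈0 μ≉N d = z*w≈0⇒w≈0 {μ + - (N · 1#)} {w d}
        (λ μ-N≈0 → μ≉N (C.trans (z-w≈0⇒z≈w μ-N≈0) (·1≈ofℕ N))) (begin
          (μ + - (N · 1#)) * w d
            ≈⟨ CS.solve 3 (λ a b c → (a CS.:- b) CS.:* c CS.:= a CS.:* c CS.:- b CS.:* c) C.refl μ (N · 1#) (w d) ⟩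
          μ * w d + - (N · 1# * w d)
            ≈⟨ C.+-congˡ {μ * w d} (C.-‿cong (Nw≈μw d)) ⟩
          μ * w d + - (μ * w d)
            ≈⟨ C.-‿inverseʳ (μ * w d) ⟩
          0# ∎)

      v≈0 : μ ≉ ofℕ N → ∀ i → v i ≈ 0#
      v≈0 μ≉N i = z*w≈0⇒w≈0 μ≉0 (C.trans (C.sym (Φw≈μv i))
        (sum-zero {f = λ d → Φ i d * w d} λ d → C.trans (C.*-congˡ {Φ i d} (w≈0 μ≉N d)) (C.zeroʳ (Φ i d))))

open import Data.Nat.Base using (_≤_)

theorem4p5 : ∀ {c ℓ₁ ℓ₂ ℓ₃}
  (n : ℕ) → let k = suc n in
  (t : ℕ) → 1 ≤ t → t ≤ k →
  (s r : Fin k → ℕ)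
  .⦃ _ : ∀ {i} → NonZero (s i) ⦄ .⦃ _ : ∀ {i} → NonZero (r i) ⦄
  (r≤s : ∀ i → r i ≤ s i)
  (∣A∣ ∣B∣ : ℕ) .⦃ _ : NonZero ∣A∣ ⦄ .⦃ _ : NonZero ∣B∣ ⦄
  (A : Array ∣A∣ s) (B : Array ∣B∣ r) →
  IsOA t A → IsOA t B → Subarray r≤s B A →
  ((ℝ : RealNumbers c ℓ₁ ℓ₂ ℓ₃) (E : Exponential ℝ) →
    let open Complex ℝ
        open Characters E
    in ∀ μ → IsEigenvalue (Ψ t A ⊗ (Ψ t A) ᴴ) μ → μ ≉ 0# → μ ≈ ofℕ ∣A∣)
  ×
  ((∀ i → ratio s r i ℚ.≤ ratio s r zero) →
    (2 ∣ t →
      fromℕℚ ∣A∣ ℚ.≥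
        fromℕℚ ∣B∣ ℚ.* ∑ (upTo (suc ⌊ t /2⌋)) (λ i → ∑∏ i (excess s r)))
    ×
    (2 ∤ t →
      fromℕℚ ∣A∣ ℚ.≥
        fromℕℚ ∣B∣ ℚ.*
          (∑ (upTo (suc ⌊ t /2⌋)) (λ i → ∑∏ i (excess s r))
            ℚ.+ excess s r zero ℚ.* ∑∏ ⌊ t /2⌋ (excess s r ∘ suc))))
theorem4p5 n t 1≤t t≤k s r r≤s ∣A∣ ∣B∣ A B A-OA B-OA B⊆A =
  (λ ℝ E → CharacterMatrix.eigenvalue ℝ E t≤k A A-OA) ,
  λ _ → size-bound-even t≤k s r r≤s ∣A∣ ∣B∣ A B A-OA B-OA B⊆A ,
        size-bound-odd t≤k s r r≤s ∣A∣ ∣B∣ A B A-OA B-OA B⊆A
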